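{- Let $m$ and $n$ be integers with $m\geq n\geq 2$ and set $c:=m-n$. Then $$4m-1\leq R(C_{2m}, W_{2n})\leq \max\left\{4m+332-\left\lfloor\tfrac{333}{251}c\right\rfloor,\ 4m-1\right\}.$$ In particular, $R(C_{2n}, W_{2n})\leq 4n+332$ for all $n\ge 2$, and $R(C_{2m}, W_{2n})= 4m-1$ whenever $m\geq n+251$.
   Context: $C_\ell$ denotes the cycle of length $\ell$. For $k\ge 3$, the wheel $W_k$ is the graph on $k+1$ vertices obtained by joining one vertex to every vertex of a cycle of length $k$, and $W_2=K_3$. For graphs $H_1,H_2$, the Ramsey number $R(H_1,H_2)$ is the smallest integer $N$ such that in every coloring of the edges of $K_N$ with colors 1 and 2 there is a copy of $H_1$ in color 1 or a copy of $H_2$ in color 2. -}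

module Defs where

open import Data.Nat using (ℕ; zero; suc; _+_; _*_; _∸_; _<_; _≤_; _⊔_; _/_)
open import Data.Fin using (Fin; toℕ) renaming (zero to fzero; suc to fsuc)
open import Data.Bool using (Bool; true; false)
open import Data.Product using (Σ; _×_)
open import Data.Sum using (_⊎_)
open import Data.Empty using (⊥)
open import Relation.Nullary using (¬_)
open import Relation.Binary.PropositionalEquality using (_≡_)
open import Function.Definitions using (Injective)

record Graph : Set₁ where
  field
    V   : ℕ
    Adj : Fin V → Fin V → Set
open Graph public

CycAdj : (ℓ : ℕ) → Fin ℓ → Fin ℓ → Set
CycAdj ℓ i j =
  (suc (toℕ i) ≡ toℕ j) ⊎ (suc (toℕ j) ≡ toℕ i) ⊎
  ((toℕ i ≡ 0 × suc (toℕ j) ≡ ℓ) ⊎ (toℕ j ≡ 0 × suc (toℕ i) ≡ ℓ))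

-- The cycle C_ℓ (meaningful for ℓ ≥ 3).
Cycle : ℕ → Graph
Cycle ℓ = record { V = ℓ ; Adj = CycAdj ℓ }

WheelAdj : (k : ℕ) → Fin (suc k) → Fin (suc k) → Set
WheelAdj k fzero    fzero    = ⊥
WheelAdj k fzero    (fsuc j) = Fin 1
WheelAdj k (fsuc i) fzero    = Fin 1
WheelAdj k (fsuc i) (fsuc j) = CycAdj k i j

-- The wheel W_k on k+1 vertices (used only for k ≥ 3 here).
Wheel : ℕ → Graph
Wheel k = record { V = suc k ; Adj = WheelAdj k }

-- A 2-colouring of the edges of K_N: colour of edge {u,v} is c u v,
-- with true = colour 1, false = colour 2 (values on the diagonal unused).
Colouring : ℕ → Set
Colouring N = Fin N → Fin N → Bool

Symmetric : {N : ℕ} → Colouring N → Set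
Symmetric {N} c = (u v : Fin N) → c u v ≡ c v u

HasCopy : {N : ℕ} → Colouring N → Bool → Graph → Set
HasCopy {N} c col H =
  Σ (Fin (V H) → Fin N) λ f →
    Injective _≡_ _≡_ f × ((a b : Fin (V H)) → Adj H a b → c (f a) (f b) ≡ col)

Arrows : ℕ → Graph → Graph → Set
Arrows N H₁ H₂ = (c : Colouring N) → Symmetric c →
  HasCopy c true H₁ ⊎ HasCopy c false H₂

IsRamseyNumber : Graph → Graph → ℕ → Set
IsRamseyNumber H₁ H₂ R = Arrows R H₁ H₂ × ((N : ℕ) → N < R → ¬ Arrows N H₁ H₂)

-- Suppose K_N, N = 4m − 1 + e with 3e + 4(m − n) ≥ 999, is coloured without a red C_{2m} and
-- without a blue W_{2n}; in particular no blue K_{n,n} lies in a blue neighbourhood. Because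
-- R(C_{2m}, C_{2n}) ≤ 2m + n + O(1), blue degrees are small and the minimum red degree δ
-- satisfies 4δ > N + O(1). Every vertex lies on a short odd closed red walk; chaining nine of
-- them gives two vertices x, y joined by red paths of ten consecutive lengths inside a set I of
-- bounded size. Rotating the ends of a maximal red path through this gadget either closes it to
-- a cycle through the gadget with at least 2m vertices outside I, or exhibits more than n ends
-- without red neighbours in a set of about 2m vertices; the missing wheel then makes the red
-- graph on that set so dense that Dirac's theorem yields C_{2m}. Finally, as 4δ > N, a red path
-- can be shortened by an amount between 1 and 10 with its ends fixed, and the ten lengths
-- provided by the gadget make up for the difference to 2m.

module Submission where

open import Defs
open import Data.Nat using (ℕ; zero; suc; _+_; _*_; _∸_; _≤_; _<_; _⊔_; _/_; z≤n; s≤s; s≤s⁻¹; _≤?_; _<?_)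
open import Data.Nat.Properties using (≤-refl; ≤-trans; ≤-reflexive; ≤-total; ≤-antisym; <-≤-trans; +-mono-≤; *-monoʳ-≤; +-monoˡ-≤; +-monoʳ-≤; +-cancelʳ-<; *-cancelˡ-<; +-suc; +-comm; +-assoc; +-identityʳ; m≤m+n; m≤n+m; n≤1+n; m∸n+n≡m; m+[n∸m]≡n; ≰⇒>; ≮⇒≥; <-irrefl; <⇒≤; suc-injective; m≤n⇒m⊓n≡m)
open import Data.Nat.Tactic.RingSolver using (solve)
open import Data.Bool using (Bool; true; false; not; _∧_; _∨_; if_then_else_)
open import Data.Bool.Properties using (∧-comm; T?)
import Data.Bool.Properties as Boolₚ
open import Data.Empty using (⊥; ⊥-elim)
open import Data.Unit using (⊤; tt)
open import Data.Product using (Σ; ∃; ∃₂; _×_; _,_; proj₁; proj₂)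
open import Data.Sum using (_⊎_; inj₁; inj₂; swap) renaming ([_,_]′ to case-⊎)
open import Data.Fin using (Fin; toℕ; fromℕ<) renaming (zero to fzero; suc to fsuc)
import Data.Fin.Properties as Finₚ
import Data.Vec as Vec
open import Data.List using (List; []; _∷_; [_]; _++_; length; reverse; take; drop; map; lookup; allFin; filterᵇ)
import Data.List.Properties as Listₚ
open import Data.List.Properties using (++-assoc; length-++; length-reverse; length-take; length-drop; ++-identityʳ; take++drop≡id)
open import Data.List.Relation.Unary.All using (All) renaming ([] to ◇; _∷_ to _◂_)
import Data.List.Relation.Unary.All as All
import Data.List.Relation.Unary.All.Properties as Allₚ
open import Data.List.Relation.Unary.Any using (here; there)
open import Data.List.Relation.Unary.AllPairs using (AllPairs) renaming ([] to ◇; _∷_ to _◂_)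
import Data.List.Relation.Unary.AllPairs.Properties as AllPairsₚ
open import Data.List.Relation.Unary.Unique.Propositional using (Unique)
import Data.List.Relation.Unary.Unique.Propositional.Properties as Uniqueₚ
open import Data.List.Membership.Propositional using (_∈_; _∉_)
open import Data.List.Membership.Propositional.Properties using (∈-++⁺ˡ; ∈-++⁺ʳ; ∈-++⁻; ∈-allFin; ∈-lookup)
open import Data.List.Relation.Binary.Permutation.Propositional using (_↭_; ↭-refl; ↭-sym; ↭-trans; ↭-reflexive; prep)
open import Data.List.Relation.Binary.Permutation.Propositional.Properties using (↭-length; ↭-reverse; ++⁺ˡ; ++⁺ʳ; ++⁺; ++-comm; shift; shifts; ∈-resp-↭; ∷↭∷ʳ)
open import Data.List.Relation.Binary.Subset.Propositional using (_⊆_)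
open import Relation.Nullary using (¬_; Dec; yes; no; does)
open import Relation.Binary.PropositionalEquality using (_≡_; _≢_; refl; sym; trans; cong; cong₂; subst)
open import Function using (_∘_; id)
open import Function.Definitions using (Injective)
import Data.List.Relation.Binary.Permutation.Setoid.Properties as Permₛ
open import Relation.Binary.PropositionalEquality.Properties using (setoid)


-- The exchange rate between e and γ = m - n is dictated by the degrees: δ ≥ m + γ + e - 120, and so
-- 4δ - N ≥ 4γ + 3e - 479. Four red neighbourhoods have to overlap even after a bounded set is
-- discarded, and the surplus up to 999 pays for such losses. Here 999 = 3 · 333, and 4 · 251 ≥ 999
-- lets e drop to 0 at γ = 251. The 120 is the additive error in the bound for R(C_{2m}, C_{2n}),
-- which is proved by lengthening a cycle two vertices at a time. The obstacle is exactness: degrees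
-- that may be only slightly above N / 4 give long red paths without control of their length. The
-- inner vertices of the gadget are therefore reserved before the long path is grown, and ten
-- lengths are needed because a shortcut between vertices up to nine steps apart may save ten
-- vertices. Blue separations are treated in two regimes. For e ≥ 56 the surplus absorbs the at most
-- 55 reserved vertices. Otherwise γ ≥ 209, and a block up to 55 vertices short of 2m may have to be
-- completed by a detour.

-- Every linear inequality below is a nonnegative combination L ≤ R of the hypotheses;
-- the factor t absorbs rounding.
linear : ∀ t {L R g₁ g₂} k → L ≤ R → t * suc g₂ + L ≡ suc (t * g₁ + R + k) → g₁ ≤ g₂
linear t {L} {R} {g₁} {g₂} k h eq = s≤s⁻¹ (*-cancelˡ-< t g₁ (suc g₂) (+-cancelʳ-< L (t * g₁) (t * suc g₂) step))
  where
  step : t * g₁ + L < t * suc g₂ + L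
  step = ≤-trans (s≤s (≤-trans (+-monoʳ-≤ (t * g₁) h) (m≤m+n _ k))) (≤-reflexive (sym eq))

infixl 6 _⊕_
infixr 7 _⊗_

_⊕_ : ∀ {a b c d} → a ≤ b → c ≤ d → a + c ≤ b + d
_⊕_ = +-mono-≤

_⊗_ : ∀ k {a b} → a ≤ b → k * a ≤ k * b
k ⊗ h = *-monoʳ-≤ k h

1≰0 : ¬ 1 ≤ 0
1≰0 ()

opaque
  excess : (a z d : ℕ) → a ≤ z + d → z < a → 1 ≤ d
  excess a z d h1 h2 = linear 1 0 (h1 ⊕ h2) (solve (a ∷ z ∷ d ∷ []))

  excess₂ : (a b l d z : ℕ) → a + b ≤ l + d → l + z < a + b → z < d
  excess₂ a b l d z h1 h2 = linear 1 0 (h1 ⊕ h2) (solve (a ∷ b ∷ l ∷ d ∷ z ∷ []))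

-- Counting the entries of a list that satisfy a Boolean predicate

ι : Bool → ℕ
ι true  = 1
ι false = 0

ι≤1 : ∀ b → ι b ≤ 1
ι≤1 true  = ≤-refl
ι≤1 false = z≤n

∧-elimˡ : ∀ {a b} → a ∧ b ≡ true → a ≡ true
∧-elimˡ {true} _ = refl

∧-elimʳ : ∀ {a b} → a ∧ b ≡ true → b ≡ true
∧-elimʳ {true} e = e

∧-intro : ∀ {a b} → a ≡ true → b ≡ true → a ∧ b ≡ true
∧-intro refl refl = refl

not-true : ∀ {b} → not b ≡ true → b ≡ false
not-true {false} _ = refl

does-yes : ∀ {P : Set} (d : Dec P) → does d ≡ true → P
does-yes (yes p) _ = p

does-no : ∀ {P : Set} (d : Dec P) → does d ≡ false → ¬ P
does-no (no p) _ = p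

yes-does : ∀ {P : Set} (d : Dec P) → P → does d ≡ true
yes-does (yes _) p = refl
yes-does (no ¬p) p = ⊥-elim (¬p p)

module _ {A : Set} where

  # : (A → Bool) → List A → ℕ
  # p []       = 0
  # p (x ∷ xs) = ι (p x) + # p xs

  #-++ : ∀ (p : A → Bool) xs ys → # p (xs ++ ys) ≡ # p xs + # p ys
  #-++ p []       ys = refl
  #-++ p (x ∷ xs) ys = trans (cong (ι (p x) +_) (#-++ p xs ys)) (sym (+-assoc (ι (p x)) (# p xs) (# p ys)))

  #-↭ : ∀ (p : A → Bool) {xs ys} → xs ↭ ys → # p xs ≡ # p ys
  #-↭ p _↭_.refl = refl
  #-↭ p (prep x e) = cong (ι (p x) +_) (#-↭ p e)
  #-↭ p (_↭_.swap {xs} {ys} x y e) = trans (sym (+-assoc (ι (p x)) (ι (p y)) (# p xs)))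
    (trans (cong₂ _+_ (+-comm (ι (p x)) (ι (p y))) (#-↭ p e)) (+-assoc (ι (p y)) (ι (p x)) (# p ys)))
  #-↭ p (_↭_.trans e f) = trans (#-↭ p e) (#-↭ p f)

  #≤length : ∀ (p : A → Bool) xs → # p xs ≤ length xs
  #≤length p []       = z≤n
  #≤length p (x ∷ xs) = +-mono-≤ (ι≤1 (p x)) (#≤length p xs)

  #-not : ∀ (p : A → Bool) xs → # p xs + # (not ∘ p) xs ≡ length xs
  #-not p [] = refl
  #-not p (x ∷ xs) with p x
  ... | true  = cong suc (#-not p xs)
  ... | false = trans (+-suc (# p xs) (# (not ∘ p) xs)) (cong suc (#-not p xs))

  #-mono : ∀ {p q : A → Bool} xs → (∀ {x} → x ∈ xs → p x ≡ true → q x ≡ true) → # p xs ≤ # q xs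
  #-mono [] h = z≤n
  #-mono {p = p} {q} (x ∷ xs) h with p x | h (here refl)
  ... | true  | e rewrite e refl = s≤s (#-mono xs (h ∘ there))
  ... | false | _ = ≤-trans (#-mono xs (h ∘ there)) (m≤n+m _ (ι (q x)))

  #-∧ : ∀ (p q : A → Bool) xs → # p xs + # q xs ≤ length xs + # (λ x → p x ∧ q x) xs
  #-∧ p q [] = z≤n
  #-∧ p q (x ∷ xs) = combine (ι (p x)) (ι (q x)) (ι (p x ∧ q x)) {k = length xs} (pointwise (p x) (q x)) (#-∧ p q xs)
    where
    pointwise : ∀ a b → ι a + ι b ≤ 1 + ι (a ∧ b)
    pointwise true  true  = ≤-refl
    pointwise true  false = ≤-refl
    pointwise false true  = ≤-refl
    pointwise false false = z≤n
    combine : ∀ a b c {m n k l} → a + b ≤ 1 + c → m + n ≤ k + l → (a + m) + (b + n) ≤ suc k + (c + l)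
    combine a b c {m} {n} {k} {l} h₁ h₂ =
      linear 1 0 (h₁ ⊕ h₂) (solve (a ∷ b ∷ c ∷ m ∷ n ∷ k ∷ l ∷ []))

  #-∨ : ∀ (p q : A → Bool) xs → # (λ x → p x ∨ q x) xs ≤ # p xs + # q xs
  #-∨ p q [] = z≤n
  #-∨ p q (x ∷ xs) with p x | q x
  ... | true  | true  = s≤s (≤-trans (#-∨ p q xs) (+-monoʳ-≤ _ (n≤1+n _)))
  ... | true  | false = s≤s (#-∨ p q xs)
  ... | false | true  = ≤-trans (s≤s (#-∨ p q xs)) (≤-reflexive (sym (+-suc _ _)))
  ... | false | false = #-∨ p q xs

  #-find : ∀ (p : A → Bool) xs → 1 ≤ # p xs → ∃ λ x → x ∈ xs × p x ≡ true
  #-find p (x ∷ xs) h with p x in e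
  ... | true  = x , here refl , e
  ... | false with #-find p xs h
  ...   | y , y∈ , py = y , there y∈ , py

  #-false : ∀ (p : A → Bool) xs → (∀ {x} → x ∈ xs → p x ≡ false) → # p xs ≡ 0
  #-false p [] h = refl
  #-false p (x ∷ xs) h rewrite h {x} (here refl) = #-false p xs (h ∘ there)

  #-true : ∀ (p : A → Bool) xs → (∀ {x} → x ∈ xs → p x ≡ true) → # p xs ≡ length xs
  #-true p [] h = refl
  #-true p (x ∷ xs) h rewrite h {x} (here refl) = cong suc (#-true p xs (h ∘ there))

  ∃⊎∀ : ∀ (p : A → Bool) xs → (∃ λ x → x ∈ xs × p x ≡ true) ⊎ (∀ {x} → x ∈ xs → p x ≡ false)
  ∃⊎∀ p [] = inj₂ λ ()
  ∃⊎∀ p (x ∷ xs) with p x in e | ∃⊎∀ p xs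
  ... | true  | _ = inj₁ (x , here refl , e)
  ... | false | inj₁ (y , y∈ , py) = inj₁ (y , there y∈ , py)
  ... | false | inj₂ h = inj₂ λ { (here refl) → e ; (there i) → h i }

  ∃₂⊎∀₂ : ∀ (p : A → A → Bool) xs ys →
          (∃₂ λ x y → x ∈ xs × y ∈ ys × p x y ≡ true) ⊎ (∀ {x y} → x ∈ xs → y ∈ ys → p x y ≡ false)
  ∃₂⊎∀₂ p [] ys = inj₂ λ ()
  ∃₂⊎∀₂ p (x ∷ xs) ys with ∃⊎∀ (p x) ys | ∃₂⊎∀₂ p xs ys
  ... | inj₁ (y , y∈ , e) | _ = inj₁ (x , y , here refl , y∈ , e)
  ... | inj₂ _ | inj₁ (x′ , y , x∈ , y∈ , e) = inj₁ (x′ , y , there x∈ , y∈ , e)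
  ... | inj₂ h | inj₂ h′ = inj₂ λ { (here refl) j → h j ; (there i) j → h′ i j }

  ∈-filterᵇ⁻ : ∀ (p : A → Bool) xs {v} → v ∈ filterᵇ p xs → v ∈ xs × p v ≡ true
  ∈-filterᵇ⁻ p (x ∷ xs) i with p x in e
  ∈-filterᵇ⁻ p (x ∷ xs) (here refl) | true = here refl , e
  ∈-filterᵇ⁻ p (x ∷ xs) (there i)   | true with ∈-filterᵇ⁻ p xs i
  ... | j , q = there j , q
  ∈-filterᵇ⁻ p (x ∷ xs) i | false with ∈-filterᵇ⁻ p xs i
  ... | j , q = there j , q

  ∈-filterᵇ⁺ : ∀ (p : A → Bool) {xs v} → v ∈ xs → p v ≡ true → v ∈ filterᵇ p xs
  ∈-filterᵇ⁺ p {x ∷ xs} (here refl) e rewrite e = here refl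
  ∈-filterᵇ⁺ p {x ∷ xs} (there i) e with p x
  ... | true  = there (∈-filterᵇ⁺ p i e)
  ... | false = ∈-filterᵇ⁺ p i e

  length-filterᵇ : ∀ (p : A → Bool) xs → length (filterᵇ p xs) ≡ # p xs
  length-filterᵇ p [] = refl
  length-filterᵇ p (x ∷ xs) with p x
  ... | true  = cong suc (length-filterᵇ p xs)
  ... | false = length-filterᵇ p xs

  #-filterᵇ : ∀ (p q : A → Bool) xs → # q (filterᵇ p xs) ≡ # (λ x → p x ∧ q x) xs
  #-filterᵇ p q [] = refl
  #-filterᵇ p q (x ∷ xs) with p x
  ... | true  = cong (ι (q x) +_) (#-filterᵇ p q xs)
  ... | false = #-filterᵇ p q xs

  Unique-filterᵇ : ∀ (p : A → Bool) {xs} → Unique xs → Unique (filterᵇ p xs)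
  Unique-filterᵇ p u = AllPairsₚ.filter⁺ (T? ∘ p) u

  Unique-↭ : ∀ {xs ys : List A} → xs ↭ ys → Unique xs → Unique ys
  Unique-↭ e = Permₛ.Unique-resp-↭ (setoid A) (↭⇒↭ₛ e)
    where open import Data.List.Relation.Binary.Permutation.Propositional using (↭⇒↭ₛ)

  Unique-++⁻ : ∀ (xs : List A) {ys} → Unique (xs ++ ys) → Unique xs × Unique ys × (∀ {v} → v ∈ xs → v ∉ ys)
  Unique-++⁻ [] u = ◇ , u , λ ()
  Unique-++⁻ (x ∷ xs) (a ◂ u) with Unique-++⁻ xs u
  ... | u₁ , u₂ , d = (Allₚ.++⁻ˡ xs a ◂ u₁) , u₂ ,
    λ { (here refl) j → All.lookup (Allₚ.++⁻ʳ xs a) j refl ; (there i) j → d i j }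

  Unique-++⁺ : ∀ {xs ys : List A} → Unique xs → Unique ys → (∀ {v} → v ∈ xs → v ∉ ys) → Unique (xs ++ ys)
  Unique-++⁺ u₁ u₂ d = Uniqueₚ.++⁺ u₁ u₂ λ { (i , j) → d i j }

  Unique-∷⁺ : ∀ {x : A} {xs} → x ∉ xs → Unique xs → Unique (x ∷ xs)
  Unique-∷⁺ {xs = xs} x∉ u = All.tabulate (λ i e → x∉ (subst (_∈ xs) (sym e) i)) ◂ u

  Unique-∷⁻ : ∀ {x : A} {xs} → Unique (x ∷ xs) → x ∉ xs
  Unique-∷⁻ (a ◂ _) i = All.lookup a i refl

  ∈-take : ∀ k {xs : List A} {v} → v ∈ take k xs → v ∈ xs
  ∈-take (suc k) {x ∷ xs} (here e)  = here e
  ∈-take (suc k) {x ∷ xs} (there i) = there (∈-take k i)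

  Unique-take : ∀ k {xs : List A} → Unique xs → Unique (take k xs)
  Unique-take k = AllPairsₚ.take⁺ k

  length-take-≤ : ∀ k (xs : List A) → k ≤ length xs → length (take k xs) ≡ k
  length-take-≤ k xs h = trans (length-take k xs) (m≤n⇒m⊓n≡m h)

-- Duplicate-free lists as sets of vertices: membership, difference, greedy choice

module _ {N : ℕ} where

  private Vx = Fin N

  infix 7 _==_ _∈ᵇ_

  opaque
    _==_ : Vx → Vx → Bool
    u == v = does (u Finₚ.≟ v)

    ==-true : ∀ {u v} → u == v ≡ true → u ≡ v
    ==-true {u} {v} e with u Finₚ.≟ v
    ... | yes p = p

    ==-refl : ∀ u → u == u ≡ true
    ==-refl u with u Finₚ.≟ u
    ... | yes _ = refl
    ... | no ¬p = ⊥-elim (¬p refl)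

    ==-false : ∀ {u v} → u == v ≡ false → u ≢ v
    ==-false {u} e refl with trans (sym e) (==-refl u)
    ... | ()

    ≢⇒== : ∀ {u v} → u ≢ v → u == v ≡ false
    ≢⇒== {u} {v} ne with u Finₚ.≟ v
    ... | yes p = ⊥-elim (ne p)
    ... | no _  = refl

    ==-sym : ∀ u v → u == v ≡ v == u
    ==-sym u v with u Finₚ.≟ v | v Finₚ.≟ u
    ... | yes _ | yes _ = refl
    ... | yes p | no ¬q = ⊥-elim (¬q (sym p))
    ... | no ¬p | yes q = ⊥-elim (¬p (sym q))
    ... | no _  | no _  = refl

  _∈ᵇ_ : Vx → List Vx → Bool
  v ∈ᵇ []       = false
  v ∈ᵇ (z ∷ zs) = (z == v) ∨ (v ∈ᵇ zs)

  ∈ᵇ-true : ∀ {v} zs → v ∈ᵇ zs ≡ true → v ∈ zs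
  ∈ᵇ-true {v} (z ∷ zs) e with z == v in q
  ... | true  = here (sym (==-true q))
  ... | false = there (∈ᵇ-true zs e)

  ∈ᵇ-false : ∀ {v} zs → v ∈ᵇ zs ≡ false → v ∉ zs
  ∈ᵇ-false {v} (z ∷ zs) e i with z == v in q
  ∈ᵇ-false {v} (z ∷ zs) e (here p)  | false = ==-false q (sym p)
  ∈ᵇ-false {v} (z ∷ zs) e (there i) | false = ∈ᵇ-false zs e i

  ∈⇒∈ᵇ : ∀ {v zs} → v ∈ zs → v ∈ᵇ zs ≡ true
  ∈⇒∈ᵇ {v} {zs} i with v ∈ᵇ zs in e
  ... | true  = refl
  ... | false = ⊥-elim (∈ᵇ-false zs e i)

  ∉⇒∈ᵇ : ∀ {v zs} → v ∉ zs → v ∈ᵇ zs ≡ false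
  ∉⇒∈ᵇ {v} {zs} i with v ∈ᵇ zs in e
  ... | true  = ⊥-elim (i (∈ᵇ-true zs e))
  ... | false = refl

  #-==≤1 : ∀ z {xs} → Unique xs → # (z ==_) xs ≤ 1
  #-==≤1 z ◇ = z≤n
  #-==≤1 z {x ∷ xs} (a ◂ u) with z == x in e
  ... | false = #-==≤1 z u
  ... | true  = ≤-reflexive (cong suc (#-false (z ==_) xs
                  λ {y} i → ≢⇒== λ z≡y → All.lookup a i (trans (sym (==-true e)) z≡y)))

  #-∈ : ∀ zs {xs} → Unique xs → # (_∈ᵇ zs) xs ≤ length zs
  #-∈ [] {xs} u = ≤-reflexive (#-false _ xs λ _ → refl)
  #-∈ (z ∷ zs) {xs} u = ≤-trans (#-∨ (z ==_) (_∈ᵇ zs) xs) (+-mono-≤ (#-==≤1 z u) (#-∈ zs u))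

  #-∖ : ∀ p zs {xs} → Unique xs → # p xs ≤ length zs + # (λ v → p v ∧ not (v ∈ᵇ zs)) xs
  #-∖ p zs {xs} u =
    aux {# p xs} {c = length xs} {# (λ v → p v ∧ not (v ∈ᵇ zs)) xs} {z = length zs} (#-∧ p (λ v → not (v ∈ᵇ zs)) xs) (#-not (_∈ᵇ zs) xs) (#-∈ zs u)
    where
    aux : ∀ {a b c d e z} → a + b ≤ c + d → e + b ≡ c → e ≤ z → a ≤ z + d
    aux {a} {b} {c} {d} {e} {z} h₁ h₂ h₃ =
      linear 1 0 (h₁ ⊕ ≤-reflexive (sym h₂) ⊕ h₃) (solve (a ∷ b ∷ c ∷ d ∷ e ∷ z ∷ []))

  -- The greedy choice behind the linking of blocks: more candidates than forbidden vertices.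
  fresh : ∀ p zs {xs} → Unique xs → length zs < # p xs → ∃ λ v → v ∈ xs × p v ≡ true × v ∉ zs
  fresh p zs {xs} u h =
    let v , v∈ , e = #-find _ xs (excess (# p xs) (length zs) _ (#-∖ p zs u) h)
    in v , v∈ , ∧-elimˡ e , ∈ᵇ-false zs (not-true (∧-elimʳ e))

  common-fresh : ∀ p q zs {xs} → Unique xs → length xs + length zs < # p xs + # q xs →
                 ∃ λ v → v ∈ xs × p v ≡ true × q v ≡ true × v ∉ zs
  common-fresh p q zs {xs} u h =
    let v , v∈ , e , v∉ = fresh (λ v → p v ∧ q v) zs u
          (excess₂ (# p xs) (# q xs) (length xs) (# (λ v → p v ∧ q v) xs) (length zs) (#-∧ p q xs) h)
    in v , v∈ , ∧-elimˡ e , ∧-elimʳ e , v∉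

  length-⊆ : ∀ {xs ys : List Vx} → Unique xs → xs ⊆ ys → length xs ≤ length ys
  length-⊆ {xs} {ys} u s =
    ≤-trans (≤-reflexive (sym (#-true (_∈ᵇ ys) xs λ i → ∈⇒∈ᵇ (s i)))) (#-∈ ys u)

  infixl 5 _∖_

  opaque
    _∖_ : List Vx → List Vx → List Vx
    xs ∖ zs = filterᵇ (λ v → not (v ∈ᵇ zs)) xs

    ∈-∖⁻ : ∀ xs zs {v} → v ∈ xs ∖ zs → v ∈ xs × v ∉ zs
    ∈-∖⁻ xs zs i with ∈-filterᵇ⁻ _ xs i
    ... | j , e = j , ∈ᵇ-false zs (not-true e)

    ∈-∖⁺ : ∀ {xs} zs {v} → v ∈ xs → v ∉ zs → v ∈ xs ∖ zs
    ∈-∖⁺ zs i j = ∈-filterᵇ⁺ _ i (cong not (∉⇒∈ᵇ j))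

    Unique-∖ : ∀ {xs} zs → Unique xs → Unique (xs ∖ zs)
    Unique-∖ zs = Unique-filterᵇ (λ v → not (v ∈ᵇ zs))

    #-∖-off : ∀ p {xs} zs → (∀ {x} → x ∈ xs → p x ≡ true → x ∉ zs) → # p xs ≤ # p (xs ∖ zs)
    #-∖-off p {xs} zs h = ≤-trans (#-mono xs λ i e → ∧-intro (cong not (∉⇒∈ᵇ (h i e))) e)
      (≤-reflexive (sym (#-filterᵇ (λ v → not (v ∈ᵇ zs)) p xs)))

    #-∖-≤ : ∀ p {xs} zs → Unique xs → # p xs ≤ length zs + # p (xs ∖ zs)
    #-∖-≤ p {xs} zs u = ≤-trans (#-∖ p zs u) (≤-reflexive (cong (length zs +_)
      (trans (eq xs) (sym (#-filterᵇ (λ v → not (v ∈ᵇ zs)) p xs)))))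
      where
      eq : ∀ ys → # (λ v → p v ∧ not (v ∈ᵇ zs)) ys ≡ # (λ v → not (v ∈ᵇ zs) ∧ p v) ys
      eq [] = refl
      eq (y ∷ ys) = cong₂ _+_ (cong ι (∧-comm (p y) _)) (eq ys)

  length-∖ : ∀ {xs} zs → Unique xs → length xs ≤ length zs + length (xs ∖ zs)
  length-∖ {xs} zs u = ≤-trans (≤-reflexive (sym (#-true (λ _ → true) xs λ _ → refl)))
    (≤-trans (#-∖-≤ (λ _ → true) zs u) (≤-reflexive (cong (length zs +_) (#-true (λ _ → true) (xs ∖ zs) λ _ → refl))))

  length-∖-⊆ : ∀ {xs} zs → Unique xs → Unique zs → zs ⊆ xs → length zs + length (xs ∖ zs) ≤ length xs
  length-∖-⊆ {xs} zs u u′ s =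
    ≤-trans (≤-reflexive (sym (length-++ zs)))
      (length-⊆ (Unique-++⁺ u′ (Unique-∖ zs u) λ i j → proj₂ (∈-∖⁻ xs zs j) i)
        λ i → case-⊎ s (proj₁ ∘ ∈-∖⁻ xs zs) (∈-++⁻ zs i))

  #-⊆ : ∀ (p : Vx → Bool) {xs ys} → Unique xs → xs ⊆ ys → # p xs ≤ # p ys
  #-⊆ p {xs} {ys} u s = ≤-trans (≤-reflexive (sym (length-filterᵇ p xs)))
    (≤-trans (length-⊆ (Unique-filterᵇ p u) λ i → let (j , e) = ∈-filterᵇ⁻ p xs i in ∈-filterᵇ⁺ p (s j) e)
      (≤-reflexive (length-filterᵇ p ys)))

-- Walks

-- The vertex list is an index, so that lengths, disjointness and permutations are statements about
-- plain lists. The relation may vary: for the trivial one a walk is merely an ordering with named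
-- ends.
data Walk {A : Set} (R : A → A → Set) : A → A → List A → Set where
  [_]ʷ : ∀ a → Walk R a a (a ∷ [])
  _∷ʷ_ : ∀ {a b z xs} → R a b → Walk R b z xs → Walk R a z (a ∷ xs)

infixr 5 _∷ʷ_

module _ {A : Set} {R : A → A → Set} where

  join : ∀ {a b d e xs ys} → Walk R a b xs → R b d → Walk R d e ys → Walk R a e (xs ++ ys)
  join [ a ]ʷ     r w = r ∷ʷ w
  join (s ∷ʷ v)   r w = s ∷ʷ join v r w

  start-∈ : ∀ {a b xs} → Walk R a b xs → a ∈ xs
  start-∈ [ a ]ʷ   = here refl
  start-∈ (_ ∷ʷ _) = here refl

  end-∈ : ∀ {a b xs} → Walk R a b xs → b ∈ xs
  end-∈ [ a ]ʷ   = here refl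
  end-∈ (_ ∷ʷ w) = there (end-∈ w)

  walk-length : ∀ {a b xs} → Walk R a b xs → 1 ≤ length xs
  walk-length [ a ]ʷ   = s≤s z≤n
  walk-length (_ ∷ʷ _) = s≤s z≤n

  walk-head : ∀ {a b xs} → Walk R a b xs → ∃ λ ys → xs ≡ a ∷ ys
  walk-head [ a ]ʷ   = [] , refl
  walk-head (_ ∷ʷ _) = _ , refl

  reverseʷ : (∀ {u v} → R u v → R v u) → ∀ {a b xs} → Walk R a b xs → Walk R b a (reverse xs)
  reverseʷ s [ a ]ʷ = [ a ]ʷ
  reverseʷ s (_∷ʷ_ {a} {xs = xs} r w) =
    subst (Walk R _ a) (sym (unfold-reverse a xs)) (join (reverseʷ s w) (s r) [ a ]ʷ)
    where open import Data.List.Properties using (unfold-reverse)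

  drop-walk : ∀ {a z v} xs {ys} → Walk R a z (xs ++ v ∷ ys) → Walk R v z (v ∷ ys)
  drop-walk []           [ _ ]ʷ   = [ _ ]ʷ
  drop-walk []           (r ∷ʷ w) = r ∷ʷ w
  drop-walk (x ∷ [])     (r ∷ʷ w) with walk-head w
  ... | _ , refl = w
  drop-walk (x ∷ y ∷ xs) (r ∷ʷ w) = drop-walk (y ∷ xs) w

  split-walk : ∀ {a z u v} xs {ys} → Walk R a z (xs ++ u ∷ v ∷ ys) →
               Walk R a u (xs ++ [ u ]) × R u v × Walk R v z (v ∷ ys)
  split-walk [] (r ∷ʷ w) with walk-head w
  ... | _ , refl = [ _ ]ʷ , r , w
  split-walk (x ∷ []) (r ∷ʷ w) with split-walk [] w
  ... | w₁ , s , w₂ = (r ∷ʷ w₁) , s , w₂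
  split-walk (x ∷ y ∷ xs) (r ∷ʷ w) with split-walk (y ∷ xs) w
  ... | w₁ , s , w₂ = (r ∷ʷ w₁) , s , w₂

  prefix-walk : ∀ {a z u} xs {ys} → Walk R a z (xs ++ u ∷ ys) → Walk R a u (xs ++ [ u ])
  prefix-walk []           [ _ ]ʷ   = [ _ ]ʷ
  prefix-walk []           (r ∷ʷ w) = [ _ ]ʷ
  prefix-walk (x ∷ [])     (r ∷ʷ w) = r ∷ʷ prefix-walk [] w
  prefix-walk (x ∷ y ∷ xs) (r ∷ʷ w) = r ∷ʷ prefix-walk (y ∷ xs) w

  unsnoc-walk : ∀ {a z xs} → Walk R a z xs → 2 ≤ length xs →
                ∃₂ λ b ys → xs ≡ ys ++ [ z ] × Walk R a b ys × R b z
  unsnoc-walk [ _ ]ʷ (s≤s ())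
  unsnoc-walk (r ∷ʷ [ z ]ʷ) _ = _ , _ , refl , [ _ ]ʷ , r
  unsnoc-walk (r ∷ʷ w@(_ ∷ʷ v)) _ with unsnoc-walk w (s≤s (walk-length v))
  ... | b , ys , e , w′ , r′ = b , _ , cong (_ ∷_) e , (r ∷ʷ w′) , r′

  record Cut (a b u v : A) (xs : List A) : Set where
    constructor cut
    field
      {left right} : List A
      splits : xs ≡ left ++ right
      walkˡ  : Walk R a u left
      step   : R u v
      walkʳ  : Walk R v b right

  cut-before : ∀ {a b v xs} → Walk R a b xs → v ∈ xs → v ≢ a → ∃ λ u → Cut a b u v xs
  cut-before [ a ]ʷ (here refl) ne = ⊥-elim (ne refl)
  cut-before (r ∷ʷ w) (here refl) ne = ⊥-elim (ne refl)
  cut-before {v = v} (r ∷ʷ w) (there i) ne = deeper r w i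
    where
    deeper : ∀ {a b z xs} → R a b → Walk R b z xs → v ∈ xs → ∃ λ u → Cut a z u v (a ∷ xs)
    deeper r w@([ _ ]ʷ)  (here refl) = _ , cut refl [ _ ]ʷ r w
    deeper r w@(_ ∷ʷ _) (here refl) = _ , cut refl [ _ ]ʷ r w
    deeper r (r′ ∷ʷ w) (there i) with deeper r′ w i
    ... | u , cut e w₁ s w₂ = u , cut (cong (_ ∷_) e) (r ∷ʷ w₁) s w₂

  -- Pigeonhole on the `length xs` - 1 steps. The `f`-vertices other than the end, and the
  -- `g`-vertices other than the start, moved back by one place, are together at least `length xs`
  -- in number; so some step starts in `f` and ends in `g`. This is the counting in Dirac's theorem.
  cross : ∀ (f g : A → Bool) {a b xs} → Walk R a b xs →
          length xs + ι (f b) + ι (g a) ≤ # f xs + # g xs →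
          ∃₂ λ u v → Cut a b u v xs × f u ≡ true × g v ≡ true
  cross f g [ a ]ʷ h = ⊥-elim (absurd (ι (f a)) (ι (g a)) h)
    where
    absurd : ∀ x y → 1 + x + y ≤ (x + 0) + (y + 0) → ⊥
    absurd x y h = 1≰0 (linear 1 0 h (solve (x ∷ y ∷ [])))
  cross f g (_∷ʷ_ {a} {b} {z} {xs} r w) h with f a in ea | g b in eb
  ... | true | true = a , b , cut refl [ a ]ʷ r w , ea , eb
  ... | true | false with cross f g w (weaken (length xs) (ι (f z)) (ι (g b)) (ι (g a)) (# f xs) (# g xs) (≤-reflexive (cong ι eb)) h)
    where
    weaken : ∀ l x y y′ s t → y ≤ 0 → suc l + x + y′ ≤ suc s + (y′ + t) → l + x + y ≤ s + t
    weaken l x y y′ s t h₁ h₂ = linear 1 0 (h₁ ⊕ h₂) (solve (l ∷ x ∷ y ∷ y′ ∷ s ∷ t ∷ []))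
  ...   | u , v , cut refl w₁ s w₂ , eu , ev = u , v , cut refl (r ∷ʷ w₁) s w₂ , eu , ev
  cross f g (_∷ʷ_ {a} {b} {z} {xs} r w) h | false | _ with cross f g w (weaken (length xs) (ι (f z)) (ι (g b)) (ι (g a)) (# f xs) (# g xs) (ι≤1 (g b)) h)
    where
    weaken : ∀ l x y y′ s t → y ≤ 1 → suc l + x + y′ ≤ s + (y′ + t) → l + x + y ≤ s + t
    weaken l x y y′ s t h₁ h₂ = linear 1 0 (h₁ ⊕ h₂) (solve (l ∷ x ∷ y ∷ y′ ∷ s ∷ t ∷ []))
  ...   | u , v , cut refl w₁ s w₂ , eu , ev = u , v , cut refl (r ∷ʷ w₁) s w₂ , eu , ev

  walk-lookup : ∀ {a b xs} → Walk R a b xs → (i j : Fin (length xs)) → suc (toℕ i) ≡ toℕ j → R (lookup xs i) (lookup xs j)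
  walk-lookup [ a ]ʷ fzero fzero ()
  walk-lookup (r ∷ʷ [ b ]ʷ)   fzero (fsuc fzero) e = r
  walk-lookup (r ∷ʷ (_ ∷ʷ w)) fzero (fsuc fzero) e = r
  walk-lookup (_ ∷ʷ w) (fsuc i) (fsuc j) e = walk-lookup w i j (suc-injective e)

  lookup-start : ∀ {a b xs} → Walk R a b xs → (i : Fin (length xs)) → toℕ i ≡ 0 → lookup xs i ≡ a
  lookup-start [ a ]ʷ   fzero e = refl
  lookup-start (_ ∷ʷ _) fzero e = refl

  lookup-end : ∀ {a b xs} → Walk R a b xs → (i : Fin (length xs)) → suc (toℕ i) ≡ length xs → lookup xs i ≡ b
  lookup-end [ a ]ʷ fzero e = refl
  lookup-end (_ ∷ʷ [ b ]ʷ)   (fsuc i) e = lookup-end [ b ]ʷ i (suc-injective e)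
  lookup-end (_ ∷ʷ (s ∷ʷ w)) (fsuc i) e = lookup-end (s ∷ʷ w) i (suc-injective e)
  lookup-end (_ ∷ʷ [ b ]ʷ)   fzero ()
  lookup-end (_ ∷ʷ (_ ∷ʷ _)) fzero ()

-- Consecutive pairs and successors along a walk

pairs : ∀ {A : Set} → (A → A → Bool) → List A → ℕ
pairs q []           = 0
pairs q (x ∷ [])     = 0
pairs q (x ∷ y ∷ xs) = ι (q x y) + pairs q (y ∷ xs)

module _ {A : Set} {R : A → A → Set} (q : A → A → Bool) where

  pairs-join : ∀ {a b d z xs ys} → Walk R a b xs → Walk R d z ys →
               pairs q (xs ++ ys) ≡ pairs q xs + (ι (q b d) + pairs q ys)
  pairs-join [ a ]ʷ [ d ]ʷ = refl
  pairs-join [ a ]ʷ (_ ∷ʷ w) = refl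
  pairs-join {b = b} {d} {ys = ys} (_∷ʷ_ {a} _ v@([ _ ]ʷ)) w =
    trans (cong (ι (q a b) +_) (pairs-join v w)) (sym (+-assoc (ι (q a b)) 0 (ι (q b d) + pairs q ys)))
  pairs-join {b = b} {d} {ys = ys} (_∷ʷ_ {a} {a′} {xs = xs} _ v@(_ ∷ʷ _)) w =
    trans (cong (ι (q a a′) +_) (pairs-join v w)) (sym (+-assoc (ι (q a a′)) (pairs q xs) (ι (q b d) + pairs q ys)))

  pairs-reverse : (∀ u v → q u v ≡ q v u) → (∀ {u v} → R u v → R v u) →
                  ∀ {a z xs} → Walk R a z xs → pairs q (reverse xs) ≡ pairs q xs
  pairs-reverse s s′ [ a ]ʷ = refl
  pairs-reverse s s′ (_∷ʷ_ {a} {a′} {z} {xs} _ w) =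
    trans (cong (pairs q) (unfold-reverse a xs))
      (trans (pairs-join (reverseʷ s′ w) [ a ]ʷ)
        (trans (cong₂ _+_ (pairs-reverse s s′ w) (trans (+-identityʳ _) (cong ι (s a′ a))))
          (trans (+-comm (pairs q xs) _) (step w))))
    where
    open import Data.List.Properties using (unfold-reverse)
    step : ∀ {xs} → Walk R a′ z xs → ι (q a a′) + pairs q xs ≡ pairs q (a ∷ xs)
    step [ _ ]ʷ   = refl
    step (_ ∷ʷ _) = refl

  -- Cutting at the first good pair loses no later one: the equation says that all the others lie in
  -- the right part, so that `two-cuts` can cut again there.
  first-cut : ∀ {a z xs} → Walk R a z xs → 1 ≤ pairs q xs →
              ∃₂ λ u v → ∃ λ (ct : Cut {R = R} a z u v xs) → q u v ≡ true × pairs q xs ≡ suc (pairs q (Cut.right ct))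
  first-cut [ a ]ʷ ()
  first-cut (_∷ʷ_ {a} {b} r w) h = go r w h
    where
    go : ∀ {a b z xs} → R a b → Walk R b z xs → 1 ≤ pairs q (a ∷ xs) →
         ∃₂ λ u v → ∃ λ (ct : Cut {R = R} a z u v (a ∷ xs)) → q u v ≡ true × pairs q (a ∷ xs) ≡ suc (pairs q (Cut.right ct))
    go {a} r [ b ]ʷ h with q a b in e
    ... | true = a , b , cut refl [ a ]ʷ r [ b ]ʷ , e , refl
    ... | false = ⊥-elim (1≰0 h)
    go {a} {b} r w@(r′ ∷ʷ w′) h with q a b in e
    ... | true = a , b , cut refl [ a ]ʷ r w , e , refl
    ... | false with go r′ w′ h
    ...   | u , v , cut e₁ w₁ s w₂ , e′ , p = u , v , cut (cong (a ∷_) e₁) (r ∷ʷ w₁) s w₂ , e′ , p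

pairs-≤₄ : ∀ {A : Set} (q q₁ q₂ q₃ q₄ : A → A → Bool) →
           (∀ u v → ι (q u v) ≤ ι (q₁ u v) + ι (q₂ u v) + ι (q₃ u v) + ι (q₄ u v)) →
           ∀ xs → pairs q xs ≤ pairs q₁ xs + pairs q₂ xs + pairs q₃ xs + pairs q₄ xs
pairs-≤₄ q q₁ q₂ q₃ q₄ h []           = z≤n
pairs-≤₄ q q₁ q₂ q₃ q₄ h (x ∷ [])     = z≤n
pairs-≤₄ q q₁ q₂ q₃ q₄ h (x ∷ y ∷ xs) =
  add (ι (q x y)) (ι (q₁ x y)) (ι (q₂ x y)) (ι (q₃ x y)) (ι (q₄ x y)) _ (pairs q₁ (y ∷ xs)) (pairs q₂ (y ∷ xs)) (pairs q₃ (y ∷ xs)) (pairs q₄ (y ∷ xs))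
    (h x y) (pairs-≤₄ q q₁ q₂ q₃ q₄ h (y ∷ xs))
  where
  add : ∀ a a₁ a₂ a₃ a₄ b b₁ b₂ b₃ b₄ → a ≤ a₁ + a₂ + a₃ + a₄ → b ≤ b₁ + b₂ + b₃ + b₄ →
        a + b ≤ (a₁ + b₁) + (a₂ + b₂) + (a₃ + b₃) + (a₄ + b₄)
  add a a₁ a₂ a₃ a₄ b b₁ b₂ b₃ b₄ h₁ h₂ =
    linear 1 0 (h₁ ⊕ h₂) (solve (a ∷ a₁ ∷ a₂ ∷ a₃ ∷ a₄ ∷ b ∷ b₁ ∷ b₂ ∷ b₃ ∷ b₄ ∷ []))

-- Sum ι(p u) + ι(p v) ≤ 1 + ι(p u ∧ p v) over all steps. Every vertex lies in two steps except the
-- two ends, for which `ι (p a)` and `ι (p z)` make up.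
pairs-bound : ∀ {A : Set} {R : A → A → Set} (p : A → Bool) {a z xs} → Walk R a z xs →
              # p xs + # p xs + 1 ≤ length xs + ι (p a) + ι (p z) + pairs (λ u v → p u ∧ p v) xs
pairs-bound p [ a ]ʷ = ≤-reflexive (single (ι (p a)))
  where
  single : ∀ x → (x + 0) + (x + 0) + 1 ≡ 1 + x + x + 0
  single x = solve (x ∷ [])
pairs-bound p (_∷ʷ_ {a} {b} {z} {xs} r w) =
  ≤-trans (extend (ι (p a)) (ι (p b)) (ι (p z)) (# p xs) (length xs) (pairs (λ u v → p u ∧ p v) xs) (ι (p a ∧ p b)) (and (p a) (p b)) (pairs-bound p w))
    (≤-reflexive (cong (suc (length xs) + ι (p a) + ι (p z) +_) (unfold w)))
  where
  and : ∀ x y → ι x + ι y ≤ 1 + ι (x ∧ y)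
  and true  true  = ≤-refl
  and true  false = ≤-refl
  and false true  = ≤-refl
  and false false = z≤n
  unfold : ∀ {xs} → Walk _ b z xs → ι (p a ∧ p b) + pairs (λ u v → p u ∧ p v) xs ≡ pairs (λ u v → p u ∧ p v) (a ∷ xs)
  unfold [ _ ]ʷ = refl
  unfold (_ ∷ʷ _) = refl
  extend : ∀ x y t n l k o → x + y ≤ 1 + o → n + n + 1 ≤ l + y + t + k → (x + n) + (x + n) + 1 ≤ suc l + x + t + (o + k)
  extend x y t n l k o h₁ h₂ = linear 1 0 (h₁ ⊕ h₂) (solve (x ∷ y ∷ t ∷ n ∷ l ∷ k ∷ o ∷ []))

followers : ∀ {A : Set} → (A → Bool) → A → List A → List A
followers p x []       = []
followers p x (y ∷ xs) = if p x then y ∷ followers p y xs else followers p y xs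

-- If `p` selects the neighbours of the last vertex of a path, these are the ends that one rotation
-- can produce.
successors : ∀ {A : Set} → (A → Bool) → List A → List A
successors p []       = []
successors p (x ∷ xs) = followers p x xs

module _ {A : Set} (p : A → Bool) where

  ∈-followers : ∀ x xs {t} → t ∈ followers p x xs → ∃₂ λ ys zs → ∃ λ u → x ∷ xs ≡ ys ++ u ∷ t ∷ zs × p u ≡ true
  ∈-followers x (y ∷ xs) i with p x in e
  ∈-followers x (y ∷ xs) (here refl) | true = [] , xs , x , refl , e
  ∈-followers x (y ∷ xs) (there i) | true with ∈-followers y xs i
  ... | ys , zs , u , q , pu = x ∷ ys , zs , u , cong (x ∷_) q , pu
  ∈-followers x (y ∷ xs) i | false with ∈-followers y xs i
  ... | ys , zs , u , q , pu = x ∷ ys , zs , u , cong (x ∷_) q , pu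

  ∈-successors : ∀ xs {t} → t ∈ successors p xs → ∃₂ λ ys zs → ∃ λ u → xs ≡ ys ++ u ∷ t ∷ zs × p u ≡ true
  ∈-successors (x ∷ xs) = ∈-followers x xs

  followers-⊆ : ∀ x xs {t} → t ∈ followers p x xs → t ∈ xs
  followers-⊆ x (y ∷ xs) i with p x
  followers-⊆ x (y ∷ xs) (here e) | true = here e
  followers-⊆ x (y ∷ xs) (there i) | true = there (followers-⊆ y xs i)
  followers-⊆ x (y ∷ xs) i | false = there (followers-⊆ y xs i)

  Unique-followers : ∀ x {xs} → Unique xs → Unique (followers p x xs)
  Unique-followers x {[]} u = ◇
  Unique-followers x {y ∷ xs} (a ◂ u) with p x
  ... | true  = All.tabulate (λ i → All.lookup a (followers-⊆ y xs i)) ◂ Unique-followers y u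
  ... | false = Unique-followers y u

  Unique-successors : ∀ {xs} → Unique xs → Unique (successors p xs)
  Unique-successors {[]} u = ◇
  Unique-successors {x ∷ xs} (_ ◂ u) = Unique-followers x u

  #-followers : ∀ x xs → # p (x ∷ xs) ≤ length (followers p x xs) + 1
  #-followers x [] = ≤-trans (≤-reflexive (+-identityʳ _)) (ι≤1 (p x))
  #-followers x (y ∷ xs) with p x
  ... | true  = s≤s (#-followers y xs)
  ... | false = #-followers y xs

  #-successors : ∀ xs → # p xs ≤ length (successors p xs) + 1
  #-successors []       = z≤n
  #-successors (x ∷ xs) = #-followers x xs

∈⇒↭ : ∀ {A : Set} {x : A} {xs} → x ∈ xs → ∃ λ ys → xs ↭ x ∷ ys
∈⇒↭ i with ∈-∃++ i
  where open import Data.List.Membership.Propositional.Properties using (∈-∃++)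
... | ys , zs , refl = ys ++ zs , shift _ ys zs

Unique⇒lookup-injective : ∀ {A : Set} {xs : List A} → Unique xs → ∀ i j → lookup xs i ≡ lookup xs j → i ≡ j
Unique⇒lookup-injective (a ◂ u) fzero    fzero    e = refl
Unique⇒lookup-injective (a ◂ u) fzero    (fsuc j) e = ⊥-elim (All.lookup a (∈-lookup j) e)
Unique⇒lookup-injective (a ◂ u) (fsuc i) fzero    e = ⊥-elim (All.lookup a (∈-lookup i) (sym e))
Unique⇒lookup-injective (a ◂ u) (fsuc i) (fsuc j) e = cong fsuc (Unique⇒lookup-injective u i j e)

-- Two-coloured complete graphs: rings, linked blocks, wheels

module Coloured {N : ℕ} (c : Colouring N) (c-sym : Symmetric c) where

  Vertex : Set
  Vertex = Fin N

  opaque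
    -- A colouring is arbitrary on the diagonal, which is masked here: no vertex is adjacent to
    -- itself in either colour, and adjacency entails distinctness.
    adj : Bool → Vertex → Vertex → Bool
    adj b u v = not (u == v) ∧ does (c u v Boolₚ.≟ b)

    adj-sym : ∀ {b u v} → adj b u v ≡ true → adj b v u ≡ true
    adj-sym {b} {u} {v} e = trans (cong₂ _∧_ (cong not (==-sym v u)) (cong (λ x → does (x Boolₚ.≟ b)) (c-sym v u))) e

    adj-comm : ∀ b u v → adj b u v ≡ adj b v u
    adj-comm b u v = cong₂ _∧_ (cong not (==-sym u v)) (cong (λ x → does (x Boolₚ.≟ b)) (c-sym u v))

    adj-≢ : ∀ {b u v} → adj b u v ≡ true → u ≢ v
    adj-≢ e = ==-false (not-true (∧-elimˡ e))

    adj-refl : ∀ b u → adj b u u ≡ false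
    adj-refl b u rewrite ==-refl u = refl

    adj-colour : ∀ {b u v} → adj b u v ≡ true → c u v ≡ b
    adj-colour {b} {u} {v} e with c u v Boolₚ.≟ b | ∧-elimʳ {not (u == v)} e
    ... | yes p | _ = p

    adj-not : ∀ b {u v} → u ≢ v → adj b u v ≡ false → adj (not b) u v ≡ true
    adj-not b {u} {v} ne e rewrite ≢⇒== ne with c u v | b
    adj-not b ne () | true  | true
    ...             | true  | false = refl
    ...             | false | true  = refl
    adj-not b ne () | false | false

    adj-excl : ∀ b {u v} → adj b u v ≡ true → adj (not b) u v ≡ false
    adj-excl b {u} {v} e with u == v | c u v | b
    adj-excl b () | false | true  | false
    adj-excl b () | false | false | true
    adj-excl b e  | false | true  | true  = refl
    adj-excl b e  | false | false | false = refl
    adj-excl b () | true  | _ | _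

  E : Bool → Vertex → Vertex → Set
  E b u v = adj b u v ≡ true

  vertices : List Vertex
  vertices = allFin N

  vertices-unique : Unique vertices
  vertices-unique = Uniqueₚ.allFin⁺ N

  length-vertices : length vertices ≡ N
  length-vertices = Listₚ.length-tabulate id

  ∈-vertices : ∀ v → v ∈ vertices
  ∈-vertices = ∈-allFin

  nonadj≤ : ∀ b {v xs} → Unique xs → # (not ∘ adj b v) xs ≤ suc (# (adj (not b) v) xs)
  nonadj≤ b {v} {xs} u = ≤-trans (#-mono {q = λ x → (v == x) ∨ adj (not b) v x} xs λ {x} _ e → cover x e)
    (≤-trans (#-∨ (v ==_) (adj (not b) v) xs) (+-monoˡ-≤ _ (#-==≤1 v u)))
    where
    cover : ∀ x → not (adj b v x) ≡ true → (v == x) ∨ adj (not b) v x ≡ true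
    cover x e with v == x in q
    ... | true  = refl
    ... | false = adj-not b (==-false q) (not-true e)

  degree-sum : ∀ b v {xs} → Unique xs → length xs ≤ 1 + # (adj b v) xs + # (adj (not b) v) xs
  degree-sum b v {xs} u = ≤-trans (≤-reflexive (sym (#-not (adj b v) xs)))
    (≤-trans (+-monoʳ-≤ (# (adj b v) xs) (nonadj≤ b u)) (≤-reflexive (+-suc (# (adj b v) xs) (# (adj (not b) v) xs))))

  -- A stretch that is traversed as a whole. The blocks that occur are single vertices and single
  -- edges; mixing the two adjusts the length of a ring while the number of links stays fixed, see
  -- `matched-ring`.
  record Block (b : Bool) : Set where
    constructor block
    field
      {first last} : Vertex
      {members}    : List Vertex
      walk         : Walk (E b) first last members
  open Block public

  members* : ∀ {b} → List (Block b) → List Vertex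
  members* []       = []
  members* (B ∷ Bs) = members B ++ members* Bs

  last* : ∀ {b} → Block b → List (Block b) → Vertex
  last* B []        = last B
  last* B (B′ ∷ Bs) = last* B′ Bs

  last*-∈ : ∀ {b} (B : Block b) Bs → last* B Bs ∈ members* (B ∷ Bs)
  last*-∈ B []        = ∈-++⁺ˡ (end-∈ (walk B))
  last*-∈ B (B′ ∷ Bs) = ∈-++⁺ʳ (members B) (last*-∈ B′ Bs)

  last*-≢ : ∀ {b} (B : Block b) Bs → Unique (members* (B ∷ Bs)) → first B ≢ last B → last* B Bs ≢ first B
  last*-≢ B []        u ne e = ne (sym e)
  last*-≢ B (B′ ∷ Bs) u ne e = proj₂ (proj₂ (Unique-++⁻ (members B) u)) (start-∈ (walk B)) (subst (_∈ members* (B′ ∷ Bs)) e (last*-∈ B′ Bs))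

  record Chain (b : Bool) (B : Block b) (Bs : List (Block b)) (pool used : List Vertex) : Set where
    constructor chained
    field
      {verts links} : List Vertex
      walked        : Walk (E b) (first B) (last* B Bs) verts
      permuted      : verts ↭ members* (B ∷ Bs) ++ links
      links-length  : length links ≡ length Bs
      links-unique  : Unique links
      links-⊆       : links ⊆ pool
      links-fresh   : ∀ {v} → v ∈ links → v ∉ used

  common : Bool → Vertex → Vertex → Vertex → Bool
  common b u v w = adj b u w ∧ adj b v w

  -- Greedy linking: consecutive blocks are joined through distinct common neighbours in the pool.
  chain : ∀ {b} (B : Block b) Bs (pool used : List Vertex) → Unique pool → Unique (members* (B ∷ Bs)) →
          (∀ {u v} → u ∈ members* (B ∷ Bs) → v ∈ members* (B ∷ Bs) → u ≢ v →
             length used + length Bs ≤ # (common b u v) pool) →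
          Chain b B Bs pool used
  chain B [] pool used up um h =
    chained (walk B) (↭-reflexive (sym (trans (++-identityʳ _) (++-identityʳ _)))) refl ◇ (λ ()) (λ ())
  chain {b} B (B′ ∷ Bs) pool used up um h =
    chained (join (walk B) (∧-elimˡ e) (adj-sym (∧-elimʳ {adj b (last B) w} e) ∷ʷ walked))
      (↭-trans (++⁺ˡ (members B) (↭-trans (prep w permuted) (↭-sym (shift w (members* (B′ ∷ Bs)) links))))
        (↭-reflexive (sym (++-assoc (members B) (members* (B′ ∷ Bs)) (w ∷ links)))))
      (cong suc links-length)
      (Unique-∷⁺ (λ i → links-fresh i (here refl)) links-unique)
      (λ { (here refl) → w∈ ; (there i) → links-⊆ i })
      (λ { (here refl) → w∉ ; (there i) → λ j → links-fresh i (there j) })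
    where
    split = Unique-++⁻ (members B) um
    last≢first : last B ≢ first B′
    last≢first q = proj₂ (proj₂ split) (end-∈ (walk B)) (subst (_∈ members* (B′ ∷ Bs)) (sym q) (∈-++⁺ˡ (start-∈ (walk B′))))
    found : ∃ λ w → w ∈ pool × common b (last B) (first B′) w ≡ true × w ∉ used
    found = fresh (common b (last B) (first B′)) used up
      (≤-trans (≤-trans (s≤s (m≤m+n (length used) (length Bs))) (≤-reflexive (sym (+-suc (length used) (length Bs)))))
        (h (∈-++⁺ˡ (end-∈ (walk B))) (∈-++⁺ʳ (members B) (∈-++⁺ˡ (start-∈ (walk B′)))) last≢first))
    w = proj₁ found
    w∈ = proj₁ (proj₂ found)
    e = proj₁ (proj₂ (proj₂ found))
    w∉ = proj₂ (proj₂ (proj₂ found))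
    rest = chain B′ Bs pool (w ∷ used) up (proj₁ (proj₂ split))
      (λ i j ne → ≤-trans (≤-reflexive (sym (+-suc (length used) (length Bs))))
        (h (∈-++⁺ʳ (members B) i) (∈-++⁺ʳ (members B) j) ne))
    open Chain rest

  record Ring (b : Bool) (ℓ : ℕ) (S : List Vertex) : Set where
    constructor ring
    field
      {start end} : Vertex
      {verts}     : List Vertex
      walk        : Walk (E b) start end verts
      closing     : E b end start
      unique      : Unique verts
      size        : length verts ≡ ℓ
      within      : verts ⊆ S

  ⊆-++ : ∀ {xs ys zs : List Vertex} → xs ⊆ zs → ys ⊆ zs → xs ++ ys ⊆ zs
  ⊆-++ {xs} f g i = case-⊎ f g (∈-++⁻ xs i)

  ⊆-↭ : ∀ {xs ys zs : List Vertex} → xs ↭ ys → ys ⊆ zs → xs ⊆ zs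
  ⊆-↭ e f i = f (∈-resp-↭ e i)

  -- One link more than in `chain` closes the ring, whence `suc (length Bs)`. The last vertex must
  -- differ from the first because only distinct vertices are assumed to have common neighbours.
  closed-chain : ∀ {b} (B : Block b) Bs (pool : List Vertex) → Unique pool → Unique (members* (B ∷ Bs)) →
                 (∀ {v} → v ∈ members* (B ∷ Bs) → v ∉ pool) → last* B Bs ≢ first B →
                 (∀ {u v} → u ∈ members* (B ∷ Bs) → v ∈ members* (B ∷ Bs) → u ≢ v →
                    suc (length Bs) ≤ # (common b u v) pool) →
                 Ring b (length (members* (B ∷ Bs)) + suc (length Bs)) (members* (B ∷ Bs) ++ pool)
  closed-chain {b} B Bs pool up um disj ne h =
    ring (join walked (∧-elimˡ e) [ w ]ʷ) (adj-sym (∧-elimʳ {adj b (last* B Bs) w} e))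
      (Unique-↭ (↭-sym perm) (Unique-++⁺ um uw λ i j → disj i (wl⊆ j)))
      (trans (↭-length perm) (trans (length-++ (members* (B ∷ Bs))) (cong (λ l → length (members* (B ∷ Bs)) + suc l) links-length)))
      (⊆-↭ perm (⊆-++ ∈-++⁺ˡ λ i → ∈-++⁺ʳ (members* (B ∷ Bs)) (wl⊆ i)))
    where
    open Chain (chain B Bs pool [] up um λ i j ne′ → ≤-trans (n≤1+n _) (h i j ne′))
    found : ∃ λ w → w ∈ pool × common b (last* B Bs) (first B) w ≡ true × w ∉ links
    found = fresh (common b (last* B Bs) (first B)) links up
      (≤-trans (s≤s (≤-reflexive links-length)) (h (last*-∈ B Bs) (∈-++⁺ˡ (start-∈ (Block.walk B))) ne))
    w = proj₁ found
    e = proj₁ (proj₂ (proj₂ found))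
    uw : Unique (w ∷ links)
    uw = Unique-∷⁺ (proj₂ (proj₂ (proj₂ found))) links-unique
    wl⊆ : w ∷ links ⊆ pool
    wl⊆ (here refl) = proj₁ (proj₂ found)
    wl⊆ (there i)   = links-⊆ i
    perm : verts ++ [ w ] ↭ members* (B ∷ Bs) ++ (w ∷ links)
    perm = ↭-trans (++⁺ʳ [ w ] permuted) (↭-trans (↭-reflexive (++-assoc (members* (B ∷ Bs)) links [ w ]))
             (++⁺ˡ (members* (B ∷ Bs)) (↭-sym (∷↭∷ʳ w links))))

  singles : ∀ b → List Vertex → List (Block b)
  singles b = map λ v → block [ v ]ʷ

  members*-singles : ∀ b xs → members* (singles b xs) ≡ xs
  members*-singles b []       = refl
  members*-singles b (x ∷ xs) = cong (x ∷_) (members*-singles b xs)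

  length-singles : ∀ b xs → length (singles b xs) ≡ length xs
  length-singles b = Listₚ.length-map _

  last*-singles-∈ : ∀ b x xs → last* (block {b} [ x ]ʷ) (singles b xs) ∈ x ∷ xs
  last*-singles-∈ b x []       = here refl
  last*-singles-∈ b x (y ∷ ys) = there (last*-singles-∈ b y ys)

  -- n vertices of `X` alternate with n links from `Y`, so n common neighbours per pair leave a free
  -- one at every link.
  greedy-ring : ∀ {b n} X Y → 2 ≤ n → n ≤ length X → Unique X → Unique Y → (∀ {v} → v ∈ X → v ∉ Y) →
                (∀ {u v} → u ∈ X → v ∈ X → u ≢ v → n ≤ # (common b u v) Y) → Ring b (2 * n) (X ++ Y)
  greedy-ring {b} {n} X Y 2≤n nX uX uY disj enough = build (take n X) (length-take-≤ n X nX) (Unique-take n uX) (∈-take n)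
    where
    build : ∀ X′ → length X′ ≡ n → Unique X′ → X′ ⊆ X → Ring b (2 * n) (X ++ Y)
    build [] l u s = ⊥-elim (absurd 2≤n l)
      where
      absurd : 2 ≤ n → 0 ≡ n → ⊥
      absurd h refl = 1≰0 (≤-trans (s≤s z≤n) h)
    build (x ∷ []) l u s = ⊥-elim (absurd 2≤n l)
      where
      absurd : 2 ≤ n → 1 ≡ n → ⊥
      absurd (s≤s ()) refl
    build (x ∷ x₂ ∷ xs) l u s = record
      { walk = walk′ ; closing = closing ; unique = unique
      ; size = trans size (trans (cong₂ _+_ (trans (cong length eqm) l) (trans (cong suc (length-singles b (x₂ ∷ xs))) l))
                 (cong (n +_) (sym (+-identityʳ n))))
      ; within = λ i → ⊆-++ {members* (singles b (x ∷ x₂ ∷ xs))} (λ j → ∈-++⁺ˡ (toX j)) (∈-++⁺ʳ X) (within i) }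
      where
      eqm = members*-singles b (x ∷ x₂ ∷ xs)
      toX : ∀ {v} → v ∈ members* (singles b (x ∷ x₂ ∷ xs)) → v ∈ X
      toX {v} i = s (subst (v ∈_) eqm i)
      open Ring (closed-chain (block [ x ]ʷ) (singles b (x₂ ∷ xs)) Y uY (subst Unique (sym eqm) u)
        (λ i → disj (toX i))
        (λ e → Unique-∷⁻ u (subst (_∈ x₂ ∷ xs) e (last*-singles-∈ b x₂ xs)))
        (λ i j ne → ≤-trans (≤-reflexive (trans (cong suc (length-singles b (x₂ ∷ xs))) l)) (enough (toX i) (toX j) ne)))
        renaming (walk to walk′)

  biclique-ring : ∀ {b n} X Y → 2 ≤ n → n ≤ length X → n ≤ length Y → Unique X → Unique Y →
                  (∀ {x y} → x ∈ X → y ∈ Y → E b x y) → Ring b (2 * n) (X ++ Y)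
  biclique-ring X Y 2≤n nX nY uX uY full = greedy-ring X Y 2≤n nX uX uY
    (λ {v} i j → adj-≢ (full {v} {v} i j) refl)
    (λ i j _ → ≤-trans nY (≤-reflexive (sym (#-true _ Y λ y∈ → ∧-intro (full i y∈) (full j y∈)))))

  ring⇒cycle : ∀ {b ℓ S} → Ring b ℓ S → HasCopy c b (Cycle ℓ)
  ring⇒cycle {b} (ring {verts = verts} walk closing unique refl _) = lookup verts , (λ {i} {j} → Unique⇒lookup-injective unique i j) , edges
    where
    edges : ∀ i j → CycAdj (length verts) i j → c (lookup verts i) (lookup verts j) ≡ b
    edges i j (inj₁ e) = adj-colour (walk-lookup walk i j e)
    edges i j (inj₂ (inj₁ e)) = adj-colour (adj-sym (walk-lookup walk j i e))
    edges i j (inj₂ (inj₂ (inj₁ (e , e′)))) =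
      adj-colour (adj-sym (subst (λ v → E b (lookup verts j) v) (sym (lookup-start walk i e))
        (subst (λ v → E b v _) (sym (lookup-end walk j e′)) closing)))
    edges i j (inj₂ (inj₂ (inj₂ (e , e′)))) =
      adj-colour (subst (λ v → E b (lookup verts i) v) (sym (lookup-start walk j e))
        (subst (λ v → E b v _) (sym (lookup-end walk i e′)) closing))

  hub⇒wheel : ∀ {b ℓ S} h → Ring b ℓ S → (∀ {v} → v ∈ S → E b h v) → HasCopy c b (Wheel ℓ)
  hub⇒wheel {b} h R@(ring {verts = verts} _ _ _ refl within) spoke = f , inj , edges
    where
    copy = ring⇒cycle R
    inRing : ∀ i → E b h (proj₁ (ring⇒cycle R) i)
    inRing i = spoke (within (∈-lookup {xs = verts} i))
    f : Fin (suc (length verts)) → Vertex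
    f fzero    = h
    f (fsuc i) = proj₁ copy i
    inj : ∀ {i j} → f i ≡ f j → i ≡ j
    inj {fzero}  {fzero}  e = refl
    inj {fzero}  {fsuc j} e = ⊥-elim (adj-≢ (inRing j) e)
    inj {fsuc i} {fzero}  e = ⊥-elim (adj-≢ (inRing i) (sym e))
    inj {fsuc i} {fsuc j} e = cong fsuc (proj₁ (proj₂ copy) e)
    edges : ∀ i j → WheelAdj (length verts) i j → c (f i) (f j) ≡ b
    edges fzero    (fsuc j) _ = adj-colour (inRing j)
    edges (fsuc i) fzero    _ = adj-colour (adj-sym (inRing i))
    edges (fsuc i) (fsuc j) a = proj₂ (proj₂ copy) i j a

  biclique⇒wheel : ∀ {b n} h X Y → 2 ≤ n → n ≤ length X → n ≤ length Y → Unique X → Unique Y →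
                   (∀ {x y} → x ∈ X → y ∈ Y → E b x y) → (∀ {x} → x ∈ X → E b h x) → (∀ {y} → y ∈ Y → E b h y) →
                   HasCopy c b (Wheel (2 * n))
  biclique⇒wheel h X Y 2≤n nX nY uX uY full hX hY =
    hub⇒wheel h (biclique-ring X Y 2≤n nX nY uX uY full) (⊆-all X hX hY)
    where
    ⊆-all : ∀ X {Y b} → (∀ {x} → x ∈ X → E b h x) → (∀ {y} → y ∈ Y → E b h y) → ∀ {v} → v ∈ X ++ Y → E b h v
    ⊆-all X f g i = case-⊎ f g (∈-++⁻ X i)

  -- Hamiltonian paths and Dirac's theorem

  -- An ordering with prescribed ends, regardless of colour. Its non-adjacent consecutive pairs are
  -- the `defects`, which 2-opt moves remove one after the other.
  Arrangement : Vertex → Vertex → List Vertex → Set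
  Arrangement = Walk (λ _ _ → ⊤)

  defects : Bool → List Vertex → ℕ
  defects b = pairs λ u v → not (adj b u v)

  defects-join : ∀ b {a p q z xs ys} → Arrangement a p xs → Arrangement q z ys →
                 defects b (xs ++ ys) ≡ defects b xs + (ι (not (adj b p q)) + defects b ys)
  defects-join b = pairs-join λ u v → not (adj b u v)

  defects-reverse : ∀ b {a z xs} → Arrangement a z xs → defects b (reverse xs) ≡ defects b xs
  defects-reverse b = pairs-reverse (λ u v → not (adj b u v)) (λ u v → cong not (adj-comm b u v)) (λ _ → tt)

  linked⊎broken : ∀ b {a z xs} → Arrangement a z xs →
                  Walk (E b) a z xs ⊎ (∃₂ λ p q → Cut {R = λ _ _ → ⊤} a z p q xs × adj b p q ≡ false)
  linked⊎broken b [ a ]ʷ = inj₁ [ a ]ʷ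
  linked⊎broken b (_∷ʷ_ {a} {a′} _ w) with adj b a a′ in e | linked⊎broken b w
  ... | false | _ = inj₂ (a , a′ , cut refl [ a ]ʷ tt w , e)
  ... | true  | inj₁ w′ = inj₁ (e ∷ʷ w′)
  ... | true  | inj₂ (p , q , cut refl w₁ s w₂ , e′) = inj₂ (p , q , cut refl (tt ∷ʷ w₁) s w₂ , e′)

  opaque
    drop-right : (n t d₁ d₂ d₃ o₁ o₂ o₃ o₄ : ℕ) → n ≡ d₁ + (o₁ + (d₂ + (o₂ + d₃))) →
        t ≡ d₁ + (o₃ + (d₂ + (o₄ + d₃))) → o₁ ≡ 0 → o₂ ≡ 0 → o₃ ≡ 1 → n < t
    drop-right n t d₁ d₂ d₃ o₁ o₂ o₃ o₄ h1 h2 h3 h4 h5 =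
        linear 1 o₄ ((≤-reflexive h1) ⊕ (≤-reflexive (sym h2)) ⊕ (≤-reflexive h3) ⊕ (≤-reflexive h4) ⊕
        (≤-reflexive (sym h5))) (solve (n ∷ t ∷ d₁ ∷ d₂ ∷ d₃ ∷ o₁ ∷ o₂ ∷ o₃ ∷ o₄ ∷ []))

    drop-left : (n t d₁ d₂ d₃ o₁ o₂ o₃ o₄ : ℕ) → n ≡ d₁ + (o₁ + (d₂ + (o₂ + d₃))) →
        t ≡ (d₁ + (o₄ + d₂)) + (o₃ + d₃) → o₁ ≡ 0 → o₂ ≡ 0 → o₃ ≡ 1 → n < t
    drop-left n t d₁ d₂ d₃ o₁ o₂ o₃ o₄ h1 h2 h3 h4 h5 =
        linear 1 o₄ ((≤-reflexive h1) ⊕ (≤-reflexive (sym h2)) ⊕ (≤-reflexive h3) ⊕ (≤-reflexive h4) ⊕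
        (≤-reflexive (sym h5))) (solve (n ∷ t ∷ d₁ ∷ d₂ ∷ d₃ ∷ o₁ ∷ o₂ ∷ o₃ ∷ o₄ ∷ []))

  record Improved (b : Bool) (a z : Vertex) (xs : List Vertex) : Set where
    constructor improved
    field
      {ys}      : List Vertex
      arranged  : Arrangement a z ys
      permuted  : ys ↭ xs
      fewer     : defects b ys < defects b xs

  -- With p q a defect and u v another consecutive pair such that p–u and q–v are edges,
  -- reversing the stretch between the two pairs removes the defect p q.
  reverse-right : ∀ {b a z p q u v xs ys} → Arrangement a p xs → adj b p q ≡ false →
                  Cut {R = λ _ _ → ⊤} q z u v ys → adj b p u ≡ true → adj b q v ≡ true →
                  Improved b a z (xs ++ ys)
  reverse-right {b} {a} {z} {p} {q} {u} {v} {xs} w e (cut {l} {r} refl w₁ _ w₂) pu qv = improved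
    (join w tt (join w₁ʳ tt w₂))
    (++⁺ˡ xs (++⁺ʳ r (↭-reverse l)))
    (drop-right (D (xs ++ (reverse l ++ r))) (D (xs ++ (l ++ r))) (D xs) (D l) (D r) (δ p u) (δ q v) (δ p q) (δ u v) new old
      (cong (ι ∘ not) pu) (cong (ι ∘ not) qv) (cong (ι ∘ not) e))
    where
    D = defects b
    δ : Vertex → Vertex → ℕ
    δ x y = ι (not (adj b x y))
    w₁ʳ = reverseʷ (λ _ → tt) w₁
    new : D (xs ++ (reverse l ++ r)) ≡ D xs + (δ p u + (D l + (δ q v + D r)))
    new = trans (defects-join b w (join w₁ʳ tt w₂)) (cong (λ t → D xs + (δ p u + t))
            (trans (defects-join b w₁ʳ w₂) (cong (_+ (δ q v + D r)) (defects-reverse b w₁))))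
    old : D (xs ++ (l ++ r)) ≡ D xs + (δ p q + (D l + (δ u v + D r)))
    old = trans (defects-join b w (join w₁ tt w₂)) (cong (λ t → D xs + (δ p q + t)) (defects-join b w₁ w₂))

  -- The mirror case: the pair u v precedes the defect, and the stretch from v to p is reversed.
  reverse-left : ∀ {b a z p q u v xs ys} → Arrangement q z ys → adj b p q ≡ false →
                 Cut {R = λ _ _ → ⊤} a p u v xs → adj b p u ≡ true → adj b q v ≡ true →
                 Improved b a z (xs ++ ys)
  reverse-left {b} {a} {z} {p} {q} {u} {v} {xs} {ys} w e (cut {l} {r} refl w₁ _ w₂) pu qv = improved
    (join w₁ tt (join w₂ʳ tt w))
    (↭-trans (++⁺ˡ l (++⁺ʳ ys (↭-reverse r))) (↭-reflexive (sym (++-assoc l r ys))))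
    (drop-left (D (l ++ (reverse r ++ ys))) (D ((l ++ r) ++ ys)) (D l) (D r) (D ys) (δ u p) (δ v q) (δ p q) (δ u v) new old
      (cong (ι ∘ not) (adj-sym pu)) (cong (ι ∘ not) (adj-sym qv)) (cong (ι ∘ not) e))
    where
    D = defects b
    δ : Vertex → Vertex → ℕ
    δ x y = ι (not (adj b x y))
    w₂ʳ = reverseʷ (λ _ → tt) w₂
    new : D (l ++ (reverse r ++ ys)) ≡ D l + (δ u p + (D r + (δ v q + D ys)))
    new = trans (defects-join b w₁ (join w₂ʳ tt w)) (cong (λ t → D l + (δ u p + t))
            (trans (defects-join b w₂ʳ w) (cong (_+ (δ v q + D ys)) (defects-reverse b w₂))))
    old : D ((l ++ r) ++ ys) ≡ (D l + (δ u v + D r)) + (δ p q + D ys)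
    old = trans (defects-join b (join w₁ tt w₂) w) (cong (_+ (δ p q + D ys)) (defects-join b w₁ w₂))

  opaque
    two-opt-arith : (lp lq fp fq gp gq nf ng h fz ga nfz nga : ℕ) → fp + gp < lp + 0 + ga →
        fq + gq < lq + fz + 0 → (fp + fq) + nf ≡ lp + lq → (gp + gq) + ng ≡ lp + lq → nf ≤ h + nfz →
        ng ≤ h + nga → fz + nfz ≤ 1 → ga + nga ≤ 1 → 2 * h < lp + lq → ⊥
    two-opt-arith lp lq fp fq gp gq nf ng h fz ga nfz nga h1 h2 h3 h4 h5 h6 h7 h8 h9 =
        1≰0 (linear 1 0 (h1 ⊕ h2 ⊕ (≤-reflexive (sym h3)) ⊕ (≤-reflexive (sym h4)) ⊕ h5 ⊕ h6 ⊕ h7 ⊕ h8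
        ⊕ h9) (solve (lp ∷ lq ∷ fp ∷ fq ∷ gp ∷ gq ∷ nf ∷ ng ∷ h ∷ fz ∷ ga ∷ nfz ∷ nga ∷ [])))

  -- If `cross` fails on both sides of the defect, adding the two failed counts bounds the
  -- non-neighbours of p and q from below and gives `length xs` ≤ 2h. The corrections
  -- `ι (not (adj b v z))` and `ι (not (adj b v a))` cancel the boundary terms of `cross`; they also
  -- make room for the repeated vertex of a closed arrangement, where a = z.
  improve : ∀ b h {a z p q xs} → Cut {R = λ _ _ → ⊤} a z p q xs → adj b p q ≡ false → 2 * h < length xs →
            (∀ {v} → v ∈ xs → # (not ∘ adj b v) xs ≤ h + ι (not (adj b v z))) →
            (∀ {v} → v ∈ xs → # (not ∘ adj b v) xs ≤ h + ι (not (adj b v a))) →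
            Improved b a z xs
  improve b h {a} {z} {p} {q} (cut {P} {Q} refl w₁ _ w₂) e size hz ha
    with length P + ι (adj b p p) + ι (adj b q a) ≤? # (adj b p) P + # (adj b q) P
       | length Q + ι (adj b p z) + ι (adj b q q) ≤? # (adj b p) Q + # (adj b q) Q
  ... | yes y | _ = let (u , v , ct , pu , qv) = cross (adj b p) (adj b q) w₁ y in reverse-left w₂ e ct pu qv
  ... | no _ | yes y = let (u , v , ct , pu , qv) = cross (adj b p) (adj b q) w₂ y in reverse-right w₁ e ct pu qv
  ... | no x | no y = ⊥-elim (two-opt-arith (length P) (length Q) (# (adj b p) P) (# (adj b p) Q) (# (adj b q) P) (# (adj b q) Q)
      (# (not ∘ adj b p) (P ++ Q)) (# (not ∘ adj b q) (P ++ Q)) h (ι (adj b p z)) (ι (adj b q a)) (ι (not (adj b p z))) (ι (not (adj b q a)))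
      (subst (λ t → # (adj b p) P + # (adj b q) P < length P + ι t + ι (adj b q a)) (adj-refl b p) (≰⇒> x))
      (subst (λ t → # (adj b p) Q + # (adj b q) Q < length Q + ι (adj b p z) + ι t) (adj-refl b q) (≰⇒> y))
      (total p) (total q) (hz (∈-++⁺ˡ (end-∈ w₁))) (ha (∈-++⁺ʳ P (start-∈ w₂)))
      (compl (adj b p z)) (compl (adj b q a)) (≤-trans size (≤-reflexive (length-++ P))))
    where
    compl : ∀ t → ι t + ι (not t) ≤ 1
    compl true  = ≤-refl
    compl false = ≤-refl
    total : ∀ v → (# (adj b v) P + # (adj b v) Q) + # (not ∘ adj b v) (P ++ Q) ≡ length P + length Q
    total v = trans (cong (_+ # (not ∘ adj b v) (P ++ Q)) (sym (#-++ (adj b v) P Q))) (trans (#-not (adj b v) (P ++ Q)) (length-++ P))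

  two-opt : ∀ b h {a z xs} → Arrangement a z xs → 2 * h < length xs →
            (∀ {v} → v ∈ xs → # (not ∘ adj b v) xs ≤ h + ι (not (adj b v z))) →
            (∀ {v} → v ∈ xs → # (not ∘ adj b v) xs ≤ h + ι (not (adj b v a))) →
            ∃ λ ys → Walk (E b) a z ys × ys ↭ xs
  two-opt b h {a} {z} {xs} w size hz ha = go (suc (defects b xs)) w ↭-refl ≤-refl
    where
    go : ∀ fuel {ys} → Arrangement a z ys → ys ↭ xs → defects b ys < fuel → ∃ λ zs → Walk (E b) a z zs × zs ↭ xs
    go (suc fuel) {ys} w e lt with linked⊎broken b w
    ... | inj₁ w′ = ys , w′ , e
    ... | inj₂ (p , q , ct , pq) =
      let improved w″ e′ lt′ = improve b h ct pq (≤-trans size (≤-reflexive (sym (↭-length e))))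
            (λ i → ≤-trans (≤-reflexive (#-↭ _ e)) (hz (∈-resp-↭ e i)))
            (λ i → ≤-trans (≤-reflexive (#-↭ _ e)) (ha (∈-resp-↭ e i)))
      in go fuel w″ (↭-trans e′ e) (≤-trans lt′ (s≤s⁻¹ lt))

  arrange : ∀ {a z} xs → Arrangement a z (a ∷ xs ++ [ z ])
  arrange []       = tt ∷ʷ [ _ ]ʷ
  arrange (x ∷ xs) = tt ∷ʷ arrange xs

  -- 2-opt with distinct ends. Fewer than n neighbours in the other colour means at most n
  -- non-neighbours, as a vertex is also not adjacent to itself.
  hamiltonian-path : ∀ b n {a z U} → Unique U → a ∈ U → z ∈ U → a ≢ z → 2 * n < length U →
                     (∀ {v} → v ∈ U → # (adj (not b) v) U < n) → ∃ λ L → Walk (E b) a z L × L ↭ U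
  hamiltonian-path b n {a} {z} {U} u a∈ z∈ a≢z size few with ∈⇒↭ a∈
  ... | U₁ , e₁ with ∈-resp-↭ e₁ z∈
  ... | here q = ⊥-elim (a≢z (sym q))
  ... | there z∈₁ with ∈⇒↭ z∈₁
  ... | U₂ , e₂ = let (L , w , e) = two-opt b n (arrange U₂) (≤-trans size (≤-reflexive (sym (↭-length perm)))) bound bound
                 in L , w , ↭-trans e perm
    where
    perm : a ∷ U₂ ++ [ z ] ↭ U
    perm = ↭-trans (prep a (↭-trans (↭-sym (∷↭∷ʳ z U₂)) (↭-sym e₂))) (↭-sym e₁)
    bound : ∀ {x y} → x ∈ a ∷ U₂ ++ [ z ] → # (not ∘ adj b x) (a ∷ U₂ ++ [ z ]) ≤ n + y
    bound {x} i = ≤-trans (≤-reflexive (#-↭ _ perm)) (≤-trans (≤-trans (nonadj≤ b u) (few (∈-resp-↭ perm i))) (m≤m+n n _))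

  closed⇒ring : ∀ {b a L M ℓ S} → Walk (E b) a a L → L ↭ a ∷ M → Unique M → length M ≡ ℓ → 1 ≤ ℓ → M ⊆ S → Ring b ℓ S
  closed⇒ring [ _ ]ʷ e u refl 1≤ℓ s = ⊥-elim (1≰0 (≤-trans 1≤ℓ (≤-reflexive (suc-injective (sym (↭-length e))))))
  closed⇒ring (r ∷ʷ w) e u size 1≤ℓ s = ring w r (Unique-↭ (↭-sym e′) u) (trans (↭-length e′) size) (λ i → s (∈-resp-↭ e′ i))
    where
    open import Data.List.Relation.Binary.Permutation.Propositional.Properties using (drop-∷)
    e′ = drop-∷ e

  -- The cycle is an arrangement from x back to x that lists x at both ends. The second copy adds a
  -- non-neighbour of v only if v is not adjacent to x, which is just what `two-opt` tolerates.
  dirac : ∀ b m {U} → Unique U → 1 ≤ m → length U ≡ 2 * m → (∀ {v} → v ∈ U → # (adj (not b) v) U < m) → Ring b (2 * m) U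
  dirac b m {[]} u 1≤m size few = ⊥-elim (absurd m 1≤m size)
    where
    absurd : ∀ m → 1 ≤ m → 0 ≡ 2 * m → ⊥
    absurd (suc m) _ ()
  dirac b m {x ∷ xs} u 1≤m size few with two-opt b m (arrange {x} {x} xs) (s≤s (≤-reflexive (sym sz))) bound bound
    where
    sz : length (xs ++ [ x ]) ≡ 2 * m
    sz = trans (sym (↭-length (∷↭∷ʳ x xs))) size
    bound : ∀ {v} → v ∈ x ∷ xs ++ [ x ] → # (not ∘ adj b v) (x ∷ xs ++ [ x ]) ≤ m + ι (not (adj b v x))
    bound {v} i = ≤-trans (≤-reflexive (#-++ (not ∘ adj b v) (x ∷ xs) [ x ]))
      (+-mono-≤ (≤-trans (nonadj≤ b u) (few (mem i))) (≤-reflexive (+-identityʳ _)))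
      where
      mem : v ∈ x ∷ xs ++ [ x ] → v ∈ x ∷ xs
      mem (here e) = here e
      mem (there i) with ∈-++⁻ xs i
      ... | inj₁ j = there j
      ... | inj₂ (here e) = here e
  ... | L , w , e = closed⇒ring w (↭-trans e (↭-sym (prep x (∷↭∷ʳ x xs)))) u size (≤-trans 1≤m (m≤m+n m _)) id

  -- Lengthening an even cycle by two

  record TwoCuts {A : Set} (R : A → A → Set) (q : A → A → Bool) (a z : A) (xs : List A) : Set where
    constructor twoCuts
    field
      {u v u′ v′}         : A
      {left mid right}    : List A
      splits              : xs ≡ left ++ (mid ++ right)
      walkˡ               : Walk R a u left
      good                : q u v ≡ true
      walkᵐ               : Walk R v u′ mid
      good′               : q u′ v′ ≡ true
      walkʳ               : Walk R v′ z right

  two-cuts : ∀ {A : Set} {R : A → A → Set} q {a z xs} → Walk R a z xs → 2 ≤ pairs q xs → TwoCuts R q a z xs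
  two-cuts q w h with first-cut q w (≤-trans (s≤s z≤n) h)
  ... | u , v , cut refl w₁ _ w₂ , e , p with first-cut q w₂ (s≤s⁻¹ (≤-trans h (≤-reflexive p)))
  ...   | u′ , v′ , cut refl w₃ _ w₄ , e′ , _ = twoCuts refl w₁ e w₃ e′ w₄

  both : Bool → Vertex → Vertex → Vertex → Vertex → Bool
  both b x y u v = adj b x u ∧ adj b y v

  length-+2 : ∀ {k} {xs : List Vertex} {x y} → length xs ≡ 2 * k → length (x ∷ y ∷ xs) ≡ 2 * suc k
  length-+2 {k} e = trans (cong (suc ∘ suc) e) (double k)
    where
    double : ∀ k → suc (suc (2 * k)) ≡ 2 * suc k
    double k = solve (k ∷ [])

  module Lengthen (b : Bool) (k : ℕ) {S : List Vertex} (R : Ring b (2 * k) S) where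

    open Ring R renaming (verts to cs; walk to around)

    -- Prefixing the end unrolls the ring: `pairs q (end ∷ cs)` counts over all 2k cyclic steps, the
    -- closing one included.
    closed : Walk (E b) end end (end ∷ cs)
    closed = closing ∷ʷ around

    longer : ∀ {x y L} → x ∈ S → y ∈ S → x ∉ cs → y ∉ cs → x ≢ y →
             Walk (E b) end end L → L ↭ end ∷ x ∷ y ∷ cs → Ring b (2 * suc k) S
    longer {x} {y} x∈ y∈ x∉ y∉ x≢y w e = closed⇒ring w e
      (Unique-∷⁺ (λ { (here q) → x≢y q ; (there i) → x∉ i }) (Unique-∷⁺ y∉ unique))
      (length-+2 {k} {cs} {x} {y} size) (s≤s z≤n)
      λ { (here refl) → x∈ ; (there (here refl)) → y∈ ; (there (there i)) → within i }

    -- u–x–u′ … v–y–v′ … with the stretch between the two crossed pairs reversed.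
    crossing : ∀ {x y} → x ∈ S → y ∈ S → x ∉ cs → y ∉ cs → x ≢ y →
               2 ≤ pairs (both b x y) (end ∷ cs) → Ring b (2 * suc k) S
    crossing {x} {y} x∈ y∈ x∉ y∉ x≢y h with two-cuts (both b x y) closed h
    ... | twoCuts {u} {v} {u′} {v′} {l} {m} {r} eq w₁ g w₂ g′ w₃ =
      longer x∈ y∈ x∉ y∉ x≢y
        (join w₁ (adj-sym (∧-elimˡ g)) (_∷ʷ_ {b = u′} (∧-elimˡ g′)
          (join (reverseʷ adj-sym w₂) (adj-sym (∧-elimʳ {adj b x u} g)) (∧-elimʳ {adj b x u′} g′ ∷ʷ w₃))))
        (↭-trans (shift x l (reverse m ++ y ∷ r))
          (↭-trans (prep x (↭-trans (++⁺ˡ l (↭-trans (shift y (reverse m) r) (prep y (++⁺ʳ r (↭-reverse m))))) (↭-trans (shift y l (m ++ r)) (prep y (↭-reflexive (sym eq))))))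
            (shuffle x y)))
      where
      shuffle : ∀ x y → x ∷ y ∷ end ∷ cs ↭ end ∷ x ∷ y ∷ cs
      shuffle x y = shift end (x ∷ y ∷ []) cs

    -- Cut the ring at a step that accepts y. Of the two steps that accept x, at least one is
    -- different from it and lies wholly in one of the two parts.
    insert-two : ∀ {x y} → x ∈ S → y ∈ S → x ∉ cs → y ∉ cs → x ≢ y →
                 2 ≤ pairs (both b x x) (end ∷ cs) → 1 ≤ pairs (both b y y) (end ∷ cs) → Ring b (2 * suc k) S
    insert-two {x} {y} x∈ y∈ x∉ y∉ x≢y hx hy with first-cut (both b y y) closed hy
    ... | u , v , cut {l} {r} eq w₁ s w₂ , gy , _ with 1 ≤? pairs (both b x x) l
    ...   | yes h =
      let (u′ , v′ , cut {l₁} {l₂} eq′ w₃ _ w₄ , gx , _) = first-cut (both b x x) w₁ h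
      in longer x∈ y∈ x∉ y∉ x≢y
           (join w₃ (adj-sym (∧-elimˡ gx)) (∧-elimʳ {adj b x u′} gx ∷ʷ join w₄ (adj-sym (∧-elimˡ gy)) (∧-elimʳ {adj b y u} gy ∷ʷ w₂)))
           (↭-trans (shift x l₁ (l₂ ++ y ∷ r)) (↭-trans (prep x (↭-trans (↭-reflexive (sym (++-assoc l₁ l₂ (y ∷ r))))
             (↭-trans (↭-reflexive (cong (_++ y ∷ r) (sym eq′))) (↭-trans (shift y l r) (prep y (↭-reflexive (sym eq)))))))
             (shift end (x ∷ y ∷ []) cs)))
    ...   | no ¬h =
      let (u′ , v′ , cut {r₁} {r₂} eq′ w₃ _ w₄ , gx , _) = first-cut (both b x x) w₂ (right-part ¬h)
      in longer x∈ y∈ x∉ y∉ x≢y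
           (join w₁ (adj-sym (∧-elimˡ gy)) (∧-elimʳ {adj b y u} gy ∷ʷ join w₃ (adj-sym (∧-elimˡ gx)) (∧-elimʳ {adj b x u′} gx ∷ʷ w₄)))
           (↭-trans (shift y l (r₁ ++ x ∷ r₂)) (↭-trans (prep y (↭-trans (++⁺ˡ l (↭-trans (shift x r₁ r₂) (prep x (↭-reflexive (sym eq′)))))
             (↭-trans (shift x l r) (prep x (↭-reflexive (sym eq))))))
             (↭-trans (_↭_.swap y x ↭-refl) (shift end (x ∷ y ∷ []) cs))))
      where
      arith : ∀ p l o r → p ≡ l + (o + r) → 2 ≤ p → l < 1 → o ≤ 1 → 1 ≤ r
      arith p l o r h₁ h₂ h₃ h₄ = linear 1 0 (≤-reflexive h₁ ⊕ h₂ ⊕ h₃ ⊕ h₄) (solve (p ∷ l ∷ o ∷ r ∷ []))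
      right-part : ¬ 1 ≤ pairs (both b x x) l → 1 ≤ pairs (both b x x) r
      right-part ¬h = arith (pairs (both b x x) (end ∷ cs)) (pairs (both b x x) l) (ι (both b x x u v)) (pairs (both b x x) r)
        (trans (cong (pairs (both b x x)) eq) (pairs-join (both b x x) w₁ w₂)) hx (≰⇒> ¬h) (ι≤1 (both b x x u v))

    insert-edge : ∀ {u v x y} → Cut {R = E b} start end u v cs → x ∈ S → y ∈ S → x ∉ cs → y ∉ cs →
                  E b u x → E b x y → E b v y → Ring b (2 * suc k) S
    insert-edge {u} {v} {x} {y} (cut {l} {r} eq w₁ s w₂) x∈ y∈ x∉ y∉ ux xy vy =
      longer x∈ y∈ x∉ y∉ (adj-≢ xy)
        (closing ∷ʷ join w₁ ux (xy ∷ʷ adj-sym vy ∷ʷ w₂))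
        (prep end (↭-trans (shift x l (y ∷ r)) (prep x (↭-trans (shift y l r) (prep y (↭-reflexive (sym eq)))))))

    opaque
      common-arith : (s k₂ a z q q₁ q₂ q₃ q₄ n t cn k l : ℕ) → s + s + 1 ≤ l + a + z + q →
          q ≤ q₁ + q₂ + q₃ + q₄ → q₁ < 2 → q₂ < 2 → q₃ < 2 → q₄ < 2 → n + t ≡ k₂ → t ≤ cn → a ≡ z →
          s ≡ a + n → k₂ ≡ 2 * k → l ≡ 1 + k₂ → k ≤ cn + 2
      common-arith s k₂ a z q q₁ q₂ q₃ q₄ n t cn k l h1 h2 h3 h4 h5 h6 h7 h8 h9 h10 h11 h12 =
          linear 2 1 (h1 ⊕ h2 ⊕ h3 ⊕ h4 ⊕ h5 ⊕ h6 ⊕ 2 ⊗ (≤-reflexive (sym h7)) ⊕ 2 ⊗ h8 ⊕ (≤-reflexive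
          (sym h9)) ⊕ 2 ⊗ (≤-reflexive (sym h10)) ⊕ (≤-reflexive (sym h11)) ⊕ (≤-reflexive h12)) (solve
          (s ∷ k₂ ∷ a ∷ z ∷ q ∷ q₁ ∷ q₂ ∷ q₃ ∷ q₄ ∷ n ∷ t ∷ cn ∷ k ∷ l ∷ []))

    -- The set S of ring vertices seen by x or y meets S + 1 in at most four vertices, so |S| ≤ k + 2.
    common-blue : ∀ {x y} → x ∈ S → y ∈ S → x ∉ cs → y ∉ cs → x ≢ y →
                  ¬ 2 ≤ pairs (both b x x) (end ∷ cs) → ¬ 2 ≤ pairs (both b y y) (end ∷ cs) →
                  Ring b (2 * suc k) S ⊎ k ≤ # (common (not b) x y) cs + 2
    common-blue {x} {y} x∈ y∈ x∉ y∉ x≢y hx hy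
      with 2 ≤? pairs (both b x y) (end ∷ cs) | 2 ≤? pairs (both b y x) (end ∷ cs)
    ... | yes h | _ = inj₁ (crossing x∈ y∈ x∉ y∉ x≢y h)
    ... | no _ | yes h = inj₁ (crossing y∈ x∈ y∉ x∉ (x≢y ∘ sym) h)
    ... | no h₁ | no h₂ = inj₂ (common-arith (# sees (end ∷ cs)) (length cs) (ι (sees end)) (ι (sees end))
        (pairs (λ u v → sees u ∧ sees v) (end ∷ cs)) (pairs (both b x x) (end ∷ cs)) (pairs (both b x y) (end ∷ cs))
        (pairs (both b y x) (end ∷ cs)) (pairs (both b y y) (end ∷ cs)) (# sees cs) (# (not ∘ sees) cs) (# (common (not b) x y) cs) k (length (end ∷ cs))
        (pairs-bound sees closed)
        (pairs-≤₄ (λ u v → sees u ∧ sees v) (both b x x) (both b x y) (both b y x) (both b y y)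
          (λ u v → cases (adj b x u) (adj b y u) (adj b x v) (adj b y v)) (end ∷ cs))
        (≰⇒> hx) (≰⇒> h₁) (≰⇒> h₂) (≰⇒> hy) (#-not sees cs)
        (#-mono cs λ {w} i e → ∧-intro (adj-not b (λ q → x∉ (subst (_∈ cs) (sym q) i)) (fstF (adj b x w) (not-true e)))
                                       (adj-not b (λ q → y∉ (subst (_∈ cs) (sym q) i)) (sndF (adj b x w) (not-true e))))
        refl refl size refl)
      where
      sees : Vertex → Bool
      sees w = adj b x w ∨ adj b y w
      fstF : ∀ p {q} → p ∨ q ≡ false → p ≡ false
      fstF false e = refl
      sndF : ∀ p {q} → p ∨ q ≡ false → q ≡ false
      sndF false e = e
      cases : ∀ p q r s → ι ((p ∨ q) ∧ (r ∨ s)) ≤ ι (p ∧ r) + ι (p ∧ s) + ι (q ∧ r) + ι (q ∧ s)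
      cases true  _     true  _     = s≤s z≤n
      cases true  q     false true  = s≤s z≤n
      cases true  false false false = z≤n
      cases true  true  false false = z≤n
      cases false true  true  s     = ≤-trans (s≤s z≤n) (≤-reflexive refl)
      cases false true  false true  = s≤s z≤n
      cases false true  false false = z≤n
      cases false false r     s     = z≤n

  -- Cliques, matchings and stars outside an even cycle

  clique-walk : ∀ {b a z L} → Arrangement a z L → Unique L →
                (∀ {u v} → u ∈ L → v ∈ L → u ≢ v → E b u v) → Walk (E b) a z L
  clique-walk [ a ]ʷ u h = [ a ]ʷ
  clique-walk {b} (_∷ʷ_ {a} _ w) (n ◂ u) h =
    h (here refl) (there (start-∈ w)) (λ e → All.lookup n (start-∈ w) e) ∷ʷ clique-walk w u λ i j → h (there i) (there j)

  arrange-any : ∀ x xs → ∃ λ z → Arrangement x z (x ∷ xs)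
  arrange-any x [] = x , [ x ]ʷ
  arrange-any x (y ∷ xs) with arrange-any y xs
  ... | z , w = z , tt ∷ʷ w

  clique-ring : ∀ {b ℓ X} → 2 ≤ ℓ → ℓ ≤ length X → Unique X → (∀ {u v} → u ∈ X → v ∈ X → u ≢ v → E b u v) → Ring b ℓ X
  clique-ring {b} {ℓ} {X} 2≤ℓ h u full = build (take ℓ X) (length-take-≤ ℓ X h) (Unique-take ℓ u) (∈-take ℓ)
    where
    build : ∀ Y → length Y ≡ ℓ → Unique Y → Y ⊆ X → Ring b ℓ X
    build [] e u′ s = ⊥-elim (absurd e 2≤ℓ)
      where
      absurd : 0 ≡ ℓ → 2 ≤ ℓ → ⊥
      absurd refl ()
    build (y ∷ []) e u′ s = ⊥-elim (absurd e 2≤ℓ)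
      where
      absurd : 1 ≡ ℓ → 2 ≤ ℓ → ⊥
      absurd refl (s≤s ())
    build (y ∷ y₂ ∷ ys) e u′ s with arrange-any y₂ ys
    ... | z , w = ring (clique-walk (tt ∷ʷ w) u′ λ i j → full (s i) (s j))
                    (full (s (there (end-∈ w))) (s (here refl)) λ q → Unique-∷⁻ u′ (subst (_∈ y₂ ∷ ys) q (end-∈ w))) u′ e s

  record Star {X C : List Vertex} (r : Vertex → Vertex → Bool) : Set where
    constructor star
    field
      centre : Vertex
      covers : ∀ {x u} → x ∈ X → u ∈ C → x ≢ centre → u ≢ centre → r x u ≡ false

  record Disjoint₂ (X C : List Vertex) (r : Vertex → Vertex → Bool) : Set where
    constructor disjoint₂
    field
      {x x′ u u′} : Vertex
      x∈    : x ∈ X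
      u∈    : u ∈ C
      x′∈   : x′ ∈ X
      u′∈   : u′ ∈ C
      x≢x′  : x ≢ x′
      u≢u′  : u ≢ u′
      edge  : r x u ≡ true
      edge′ : r x′ u′ ≡ true

  -- König's theorem for matchings of size two: without two disjoint edges, a single vertex on
  -- either side meets all edges. Fix an edge x₀ u₀. An edge avoiding both ends is disjoint from it,
  -- and a further edge at x₀ is disjoint from a further edge at u₀, so only one end can carry
  -- further edges.
  disjoint⊎star : ∀ X C r → Vertex → Disjoint₂ X C r ⊎ Star {X} {C} r
  disjoint⊎star X C r default with ∃₂⊎∀₂ r X C
  -- Without any edge, every vertex is a valid centre.
  ... | inj₂ none = inj₂ (star default λ i j _ _ → none i j)
  ... | inj₁ (x₀ , u₀ , x₀∈ , u₀∈ , e₀)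
    with ∃₂⊎∀₂ (λ x u → (not (x₀ == x) ∧ not (u₀ == u)) ∧ r x u) X C
       | ∃⊎∀ (λ u → not (u₀ == u) ∧ r x₀ u) C
       | ∃⊎∀ (λ x → not (x₀ == x) ∧ r x u₀) X
  ... | inj₁ (x , u , x∈ , u∈ , e) | _ | _ =
    inj₁ (disjoint₂ x₀∈ u₀∈ x∈ u∈ (==-false (not-true (∧-elimˡ (∧-elimˡ e))))
      (==-false (not-true (∧-elimʳ {not (x₀ == x)} (∧-elimˡ e)))) e₀ (∧-elimʳ {not (x₀ == x) ∧ not (u₀ == u)} e))
  ... | inj₂ _ | inj₁ (u₁ , u₁∈ , e₁) | inj₁ (x₁ , x₁∈ , e₂) =
    inj₁ (disjoint₂ x₀∈ u₁∈ x₁∈ u₀∈ (==-false (not-true (∧-elimˡ e₂))) (λ q → ==-false (not-true (∧-elimˡ e₁)) (sym q))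
      (∧-elimʳ {not (u₀ == u₁)} e₁) (∧-elimʳ {not (x₀ == x₁)} e₂))
  ... | inj₂ h | inj₂ h′ | _ = inj₂ (star u₀ λ {x} {u} i j _ u≢ → at x u i j u≢)
    where
    at : ∀ x u → x ∈ X → u ∈ C → u ≢ u₀ → r x u ≡ false
    at x u i j u≢ with x₀ == x in q | h i j | h′ j
    ... | false | f | _ rewrite ≢⇒== (u≢ ∘ sym) = f
    ... | true  | _ | f rewrite ≢⇒== (u≢ ∘ sym) | sym (==-true q) = f
  ... | inj₂ h | inj₁ _ | inj₂ h′ = inj₂ (star x₀ λ {x} {u} i j x≢ _ → at x u i j x≢)
    where
    at : ∀ x u → x ∈ X → u ∈ C → x ≢ x₀ → r x u ≡ false
    at x u i j x≢ with u₀ == u in q | h i j | h′ i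
    ... | false | f | _ rewrite ≢⇒== (x≢ ∘ sym) = f
    ... | true  | _ | f rewrite ≢⇒== (x≢ ∘ sym) | sym (==-true q) = f

  record Matching (b : Bool) (p : ℕ) (X : List Vertex) : Set where
    constructor matched
    field
      blocks  : List (Block b)
      number  : length blocks ≡ p
      double  : length (members* blocks) ≡ 2 * p
      unique  : Unique (members* blocks)
      within  : members* blocks ⊆ X
      proper  : ∀ {B} → B ∈ blocks → first B ≢ last B

  record CliqueRest (b : Bool) (p : ℕ) (X : List Vertex) : Set where
    constructor cliqueRest
    field
      {Z}    : List Vertex
      unique : Unique Z
      within : Z ⊆ X
      large  : length X ≤ length Z + 2 * p
      full   : ∀ {u v} → u ∈ Z → v ∈ Z → u ≢ v → E b u v

  -- Greedy: an edge of colour `not b` among the remaining vertices joins the matching, and if there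
  -- is none these vertices are a clique of colour `b`. At most 2p vertices have been used up by
  -- then.
  matching⊎clique : ∀ b p {X} → Unique X → Matching (not b) p X ⊎ CliqueRest b p X
  matching⊎clique b zero u = inj₁ (matched [] refl refl ◇ (λ ()) λ ())
  matching⊎clique b (suc p) {X} u with ∃₂⊎∀₂ (adj (not b)) X X
  ... | inj₂ none = inj₂ (cliqueRest u id (m≤m+n _ _) λ i j ne → unblue ne (none i j))
    where
    unblue : ∀ {u v} → u ≢ v → adj (not b) u v ≡ false → adj b u v ≡ true
    unblue ne e = subst (λ t → adj t _ _ ≡ true) (Boolₚ.not-involutive b) (adj-not (not b) ne e)
  ... | inj₁ (x , y , x∈ , y∈ , e) with matching⊎clique b p (Unique-∖ (x ∷ y ∷ []) u)
  ... | inj₁ (matched Bs num dbl un wi pr) = inj₁ (matched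
      (block (e ∷ʷ [ y ]ʷ) ∷ Bs) (cong suc num) (trans (cong (suc ∘ suc) dbl) (two p))
      (Unique-∷⁺ (λ { (here q) → adj-≢ e q ; (there i) → avoid i (here refl) }) (Unique-∷⁺ (λ i → avoid i (there (here refl))) un))
      (λ { (here refl) → x∈ ; (there (here refl)) → y∈ ; (there (there i)) → proj₁ (∈-∖⁻ X (x ∷ y ∷ []) (wi i)) })
      λ { (here refl) → adj-≢ e ; (there i) → pr i })
    where
    two : ∀ p → suc (suc (2 * p)) ≡ 2 * suc p
    two p = solve (p ∷ [])
    avoid : ∀ {v} → v ∈ members* Bs → v ∉ x ∷ y ∷ []
    avoid i = proj₂ (∈-∖⁻ X (x ∷ y ∷ []) (wi i))
  ... | inj₂ (cliqueRest {Z} un wi la fu) = inj₂ (cliqueRest un (λ i → proj₁ (∈-∖⁻ X (x ∷ y ∷ []) (wi i)))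
      (size (length X) (length (X ∖ (x ∷ y ∷ []))) (length Z) p (length-∖ (x ∷ y ∷ []) u) la) fu)
    where
    size : ∀ x y z p → x ≤ 2 + y → y ≤ z + 2 * p → x ≤ z + 2 * suc p
    size x y z p h₁ h₂ = linear 1 0 (h₁ ⊕ h₂) (solve (x ∷ y ∷ z ∷ p ∷ []))

  record Rotated (b : Bool) (u : Vertex) (cs : List Vertex) : Set where
    constructor rotated
    field
      {end}    : Vertex
      {verts}  : List Vertex
      walk     : Walk (E b) u end verts
      closing  : E b end u
      permuted : verts ↭ cs

  rotate : ∀ {b ℓ S u} (R : Ring b ℓ S) → u ∈ Ring.verts R → Rotated b u (Ring.verts R)
  rotate {u = u} R u∈ with u Finₚ.≟ Ring.start R
  ... | yes refl = rotated (Ring.walk R) (Ring.closing R) ↭-refl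
  ... | no u≢ with cut-before (Ring.walk R) u∈ u≢
  ...   | p , cut {l} {r} eq w₁ s w₂ = rotated (join w₂ (Ring.closing R) w₁) s (↭-trans (++-comm r l) (↭-reflexive (sym eq)))

  record CliquePath (b : Bool) (a z : Vertex) (ℓ : ℕ) (Z : List Vertex) : Set where
    constructor cliquePath
    field
      {verts} : List Vertex
      walk    : Walk (E b) a z verts
      unique  : Unique verts
      size    : length verts ≡ ℓ
      within  : verts ⊆ Z

  clique-path : ∀ {b a z Z} ℓ → Unique Z → (∀ {u v} → u ∈ Z → v ∈ Z → u ≢ v → E b u v) → a ∈ Z → z ∈ Z → a ≢ z →
                suc (suc ℓ) ≤ length Z → CliquePath b a z (suc (suc ℓ)) Z
  clique-path {b} {a} {z} {Z} ℓ u full a∈ z∈ a≢z h =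
    cliquePath (clique-walk (arrange mid) un λ i j → full (wi i) (wi j)) un size wi
    where
    rest = Z ∖ (a ∷ z ∷ [])
    mid = take ℓ rest
    off : ∀ {v} → v ∈ mid → v ∈ Z × v ∉ a ∷ z ∷ []
    off i = ∈-∖⁻ Z (a ∷ z ∷ []) (∈-take ℓ i)
    wi : a ∷ mid ++ [ z ] ⊆ Z
    wi (here refl) = a∈
    wi (there i) = case-⊎ (proj₁ ∘ off) (λ { (here refl) → z∈ }) (∈-++⁻ mid i)
    un : Unique (a ∷ mid ++ [ z ])
    un = Unique-∷⁺ (λ i → case-⊎ (λ j → proj₂ (off j) (here refl)) (λ { (here e) → a≢z e }) (∈-++⁻ mid i))
           (Unique-++⁺ (Unique-take ℓ (Unique-∖ (a ∷ z ∷ []) u)) (◇ ◂ ◇) λ { i (here refl) → proj₂ (off i) (there (here refl)) })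
    enough : ∀ l x y → x ≤ 2 + y → suc (suc l) ≤ x → l ≤ y
    enough l x y h₁ h₂ = linear 1 0 (h₁ ⊕ h₂) (solve (l ∷ x ∷ y ∷ []))
    size : length (a ∷ mid ++ [ z ]) ≡ suc (suc ℓ)
    size = cong suc (trans (length-++ mid) (trans (+-comm (length mid) 1)
      (cong suc (length-take-≤ ℓ rest (enough ℓ (length Z) (length rest) (length-∖ (a ∷ z ∷ []) u) h)))))

  opaque
    half-arith : (p q k : ℕ) → p + q ≡ 2 * k → p ≤ q → p ≤ k
    half-arith p q k h1 h2 = linear 2 1 ((≤-reflexive h1) ⊕ h2) (solve (p ∷ q ∷ k ∷ []))

    half-arith′ : (p q k : ℕ) → p + q ≡ 2 * k → q < p → q ≤ k
    half-arith′ p q k h1 h2 = linear 2 2 ((≤-reflexive h1) ⊕ h2) (solve (p ∷ q ∷ k ∷ []))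

  module Lengthen₂ (b : Bool) (k : ℕ) {S : List Vertex} (R : Ring b (2 * k) S) where

    open Ring R renaming (verts to cs; walk to around)
    open Lengthen b k R

    -- Replaces the shorter arc between u and u′ by a clique path with two more vertices.
    arc-switch : ∀ {Z} → Disjoint₂ Z cs (adj b) → Unique Z → Z ⊆ S → (∀ {v} → v ∈ Z → v ∉ cs) →
                 (∀ {u v} → u ∈ Z → v ∈ Z → u ≢ v → E b u v) → suc k ≤ length Z → Ring b (2 * suc k) S
    arc-switch {Z} (disjoint₂ {x} {x′} {u} {u′} x∈ u∈ x′∈ u′∈ x≢x′ u≢u′ e e′) uZ Z⊆ Z∩ full size′
      with rotate R u∈
    ... | rotated {z} {L} w cl perm with cut-before w (∈-resp-↭ (↭-sym perm) u′∈) (u≢u′ ∘ sym)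
    ...   | p , cut {P} {Q} eq w₁ s w₂ = switch (length P ≤? length Q)
      where
      L⊆ : ∀ {v} → v ∈ P ++ Q → v ∈ cs
      L⊆ {v} i = ∈-resp-↭ perm (subst (v ∈_) (sym eq) i)
      uPQ : Unique (P ++ Q)
      uPQ = subst Unique eq (Unique-↭ (↭-sym perm) unique)
      sizes : length P + length Q ≡ 2 * k
      sizes = trans (sym (length-++ P)) (trans (cong length (sym eq)) (trans (↭-length perm) size))
      total : ∀ p q → p + q ≡ 2 * k → (p + suc (suc q)) ≡ 2 * suc k
      total p q e = trans (trans (+-suc p (suc q)) (cong suc (+-suc p q))) (trans (cong (suc ∘ suc) e) (double k))
        where
        double : ∀ k → suc (suc (2 * k)) ≡ 2 * suc k
        double k = solve (k ∷ [])
      disj = proj₂ (proj₂ (Unique-++⁻ P uPQ))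
      path : ∀ {a z} n → 1 ≤ n → n ≤ k → a ∈ Z → z ∈ Z → a ≢ z → CliquePath b a z (suc n) Z
      path (suc n) _ h a∈ z∈ ne = clique-path n uZ full a∈ z∈ ne (≤-trans (s≤s h) size′)
      close : ∀ {a d f t v M K} → Walk (E b) a d M → E b d v → E b v f → Walk (E b) f t K → E b t a →
              Unique M → v ∉ M → v ∈ P ++ Q → M ⊆ P ++ Q → Unique K → K ⊆ Z →
              length M + suc (length K) ≡ 2 * suc k → Ring b (2 * suc k) S
      close {v = v} {M} {K} wM dv vf wK ta uM v∉ v∈ M⊆ uK K⊆ len =
        ring (join wM dv (vf ∷ʷ wK)) ta
          (Unique-++⁺ uM (Unique-∷⁺ (λ i → Z∩ (K⊆ i) (L⊆ v∈)) uK)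
            λ { i (here refl) → v∉ i ; i (there j) → Z∩ (K⊆ j) (L⊆ (M⊆ i)) })
          (trans (length-++ M) len)
          (⊆-++ {M} (λ i → within (L⊆ (M⊆ i))) λ { (here refl) → within (L⊆ v∈) ; (there i) → Z⊆ (K⊆ i) })
      switch : Dec (length P ≤ length Q) → Ring b (2 * suc k) S
      switch (yes h) =
        let cliquePath {K} wK uK lK K⊆ = path (length P) (walk-length w₁) (half-arith (length P) (length Q) k sizes h) x∈ x′∈ x≢x′
        in close w₂ cl (adj-sym e) wK e′ (proj₁ (proj₂ (Unique-++⁻ P uPQ))) (λ i → disj (start-∈ w₁) i)
             (∈-++⁺ˡ (start-∈ w₁)) (∈-++⁺ʳ P) uK K⊆
             (trans (cong (λ t → length Q + suc t) lK) (total (length Q) (length P) (trans (+-comm (length Q) (length P)) sizes)))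
      switch (no ¬h) =
        let cliquePath {K} wK uK lK K⊆ = path (length Q) (walk-length w₂) (half-arith′ (length P) (length Q) k sizes (≰⇒> ¬h)) x′∈ x∈ (x≢x′ ∘ sym)
        in close w₁ s (adj-sym e′) wK e (proj₁ (Unique-++⁻ P uPQ)) (λ i → disj i (start-∈ w₂))
             (∈-++⁺ʳ P (start-∈ w₂)) ∈-++⁺ˡ uK K⊆
             (trans (cong (λ t → length P + suc t) lK) (total (length P) (length Q) sizes))

  members*-++ : ∀ {b} (Bs Cs : List (Block b)) → members* (Bs ++ Cs) ≡ members* Bs ++ members* Cs
  members*-++ []       Cs = refl
  members*-++ (B ∷ Bs) Cs = trans (cong (members B ++_) (members*-++ Bs Cs)) (sym (++-assoc (members B) (members* Bs) (members* Cs)))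

  opaque
    rest-arith : (x m y p q : ℕ) → x ≤ m + y → m ≡ 2 * p → 2 * p + q ≤ x → q ≤ y
    rest-arith x m y p q h1 h2 h3 =
        linear 1 0 (h1 ⊕ (≤-reflexive h2) ⊕ h3) (solve (x ∷ m ∷ y ∷ p ∷ q ∷ []))

  -- p edges and q single vertices need p + q links and give 3p + 2q vertices, which is p more than
  -- alternation achieves with as many links. This yields cycles of length 2n although pairs have
  -- fewer than n common neighbours.
  matched-ring : ∀ {b p X Y} q → 1 ≤ p → Matching b p X → Unique X → Unique Y → (∀ {v} → v ∈ X → v ∉ Y) →
                 2 * p + q ≤ length X → (∀ {u v} → u ∈ X → v ∈ X → u ≢ v → p + q ≤ # (common b u v) Y) →
                 Ring b ((2 * p + q) + (p + q)) (X ++ Y)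
  matched-ring {b} {p} {X} {Y} q 1≤p (matched [] num dbl un wi pr) uX uY disj big enough =
    ⊥-elim (1≰0 (≤-trans 1≤p (≤-reflexive (sym num))))
  matched-ring {b} {p} {X} {Y} q 1≤p (matched (B ∷ Ms) num dbl un wi pr) uX uY disj big enough =
    record { walk = walk′ ; closing = closing ; unique = unique
           ; size = trans size (cong₂ _+_ len number)
           ; within = λ i → ⊆-++ {members* (B ∷ Bs)} (λ j → ∈-++⁺ˡ (toX j)) (∈-++⁺ʳ X) (within i) }
    where
    rest = take q (X ∖ members* (B ∷ Ms))
    Bs = Ms ++ singles b rest
    eqm : members* (B ∷ Bs) ≡ members* (B ∷ Ms) ++ rest
    eqm = trans (members*-++ (B ∷ Ms) (singles b rest)) (cong (members* (B ∷ Ms) ++_) (members*-singles b rest))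
    off : ∀ {v} → v ∈ rest → v ∈ X × v ∉ members* (B ∷ Ms)
    off i = ∈-∖⁻ X (members* (B ∷ Ms)) (∈-take q i)
    toX : ∀ {v} → v ∈ members* (B ∷ Bs) → v ∈ X
    toX {v} i = case-⊎ wi (proj₁ ∘ off) (∈-++⁻ (members* (B ∷ Ms)) (subst (v ∈_) eqm i))
    uB : Unique (members* (B ∷ Bs))
    uB = subst Unique (sym eqm) (Unique-++⁺ un (Unique-take q (Unique-∖ (members* (B ∷ Ms)) uX)) λ i j → proj₂ (off j) i)
    lrest : length rest ≡ q
    lrest = length-take-≤ q _ (rest-arith (length X) (length (members* (B ∷ Ms))) (length (X ∖ members* (B ∷ Ms))) p q (length-∖ (members* (B ∷ Ms)) uX) dbl big)
    len : length (members* (B ∷ Bs)) ≡ 2 * p + q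
    len = trans (cong length eqm) (trans (length-++ (members* (B ∷ Ms))) (cong₂ _+_ dbl lrest))
    number : suc (length Bs) ≡ p + q
    number = trans (cong suc (length-++ Ms)) (cong₂ _+_ num (trans (length-singles b rest) lrest))
    open Ring (closed-chain B Bs Y uY uB (λ i → disj (toX i)) (last*-≢ B Bs uB (pr (here refl)))
      (λ i j ne → ≤-trans (≤-reflexive number) (enough (toX i) (toX j) ne))) renaming (walk to walk′)

  ring-⊆ : ∀ {b ℓ S T} → S ⊆ T → Ring b ℓ S → Ring b ℓ T
  ring-⊆ s R = record { walk = walk′ ; closing = closing ; unique = unique ; size = size ; within = λ i → s (within i) }
    where open Ring R renaming (walk to walk′)

  -- From a cycle of length 2k to one of length 2k + 2

  module Prune (b : Bool) (k n r : ℕ) {S : List Vertex} (R : Ring b (2 * k) S) (2≤n : 2 ≤ n) (r≡ : suc r ≡ 2 * n) where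

    open Ring R renaming (verts to cs; walk to around)
    open Lengthen b k R

    Found : Set
    Found = Ring b (2 * suc k) S ⊎ Ring (not b) (2 * n) S

    record Outside (X : List Vertex) : Set where
      constructor outside
      field
        uniqueX : Unique X
        ⊆S      : X ⊆ S
        off     : ∀ {v} → v ∈ X → v ∉ cs
    open Outside

    outside-filter : ∀ p {X} → Outside X → Outside (filterᵇ p X)
    outside-filter p {X} (outside u s o) =
      outside (Unique-filterᵇ p u) (λ i → s (proj₁ (∈-filterᵇ⁻ p X i))) (λ i → o (proj₁ (∈-filterᵇ⁻ p X i)))

    record Thinned (u v : Vertex) (X : List Vertex) : Set where
      constructor thinned
      field
        w       : Vertex
        which   : w ≡ u ⊎ w ≡ v
        {X′}    : List Vertex
        kept    : X′ ⊆ X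
        out     : Outside X′
        blue    : ∀ {x} → x ∈ X′ → E (not b) w x
        size    : length X ≤ length X′ + r

    opaque
      thin-arith : (x y z r : ℕ) → y + z ≡ x → y ≤ r → x ≤ z + r
      thin-arith x y z r h1 h2 =
          linear 1 0 ((≤-reflexive (sym h1)) ⊕ h2) (solve (x ∷ y ∷ z ∷ r ∷ []))

      thin-arith₂ : (a b l n r : ℕ) → a ≡ n → l ≤ a + b → r < l → 1 + r ≡ 2 * n → n ≤ b
      thin-arith₂ a b l n r h1 h2 h3 h4 =
          linear 1 0 ((≤-reflexive h1) ⊕ h2 ⊕ h3 ⊕ (≤-reflexive (sym h4))) (solve (a ∷ b ∷ l ∷ n ∷ r ∷
          []))

    drop-neighbours : ∀ {u v X} w → w ≡ u ⊎ w ≡ v → w ∈ cs → Outside X → # (adj b w) X ≤ r → Thinned u v X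
    drop-neighbours {X = X} w which w∈ o few = thinned w which
      (λ i → proj₁ (∈-filterᵇ⁻ (λ x → not (adj b w x)) X i))
      (outside-filter (λ x → not (adj b w x)) o)
      (λ {x} i → let (j , e) = ∈-filterᵇ⁻ (λ x → not (adj b w x)) X i
                 in adj-not b (λ q → off o j (subst (_∈ cs) q w∈)) (not-true e))
      (thin-arith (length X) (# (adj b w) X) (length (filterᵇ (λ x → not (adj b w x)) X)) r
        (trans (cong (# (adj b w) X +_) (length-filterᵇ (λ x → not (adj b w x)) X)) (#-not (adj b w) X)) few)

    -- Two consecutive ring vertices: their neighbourhoods in X are completely blue to each
    -- other (else an edge can be inserted), so one of them has few neighbours.
    thin : ∀ {u v X} → Cut {R = E b} start end u v cs → Outside X → Found ⊎ Thinned u v X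
    thin {u} {v} {X} ct o with # (adj b u) X ≤? r | # (adj b v) X ≤? r
    ... | yes h | _ = inj₂ (drop-neighbours u (inj₁ refl) (subst (u ∈_) (sym (Cut.splits ct)) (∈-++⁺ˡ (end-∈ (Cut.walkˡ ct)))) o h)
    ... | no _ | yes h = inj₂ (drop-neighbours v (inj₂ refl) (subst (v ∈_) (sym (Cut.splits ct)) (∈-++⁺ʳ (Cut.left ct) (start-∈ (Cut.walkʳ ct)))) o h)
    ... | no hu | no hv with ∃₂⊎∀₂ (adj b) (take n (filterᵇ (adj b u) X)) (filterᵇ (adj b v) X ∖ take n (filterᵇ (adj b u) X))
    ...   | inj₁ (x , y , x∈ , y∈ , xy) =
      let (x∈X , ux) = ∈-filterᵇ⁻ (adj b u) X (∈-take n x∈)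
          (y∈X , vy) = ∈-filterᵇ⁻ (adj b v) X (proj₁ (∈-∖⁻ _ (take n (filterᵇ (adj b u) X)) y∈))
      in inj₁ (inj₁ (insert-edge ct (⊆S o x∈X) (⊆S o y∈X) (off o x∈X) (off o y∈X) ux xy vy))
    ...   | inj₂ none = inj₁ (inj₂ (ring-⊆ (⊆-++ {A} (λ i → ⊆S o (A⊆ i)) λ i → ⊆S o (B⊆ i))
        (biclique-ring A B 2≤n (≤-reflexive (sym lenA))
          (thin-arith₂ (length A) (length B) (length Xv) n r lenA (length-∖ A (Unique-filterᵇ (adj b v) (uniqueX o)))
            (≤-trans (≰⇒> hv) (≤-reflexive (sym (length-filterᵇ (adj b v) X)))) r≡)
          (Unique-take n (Unique-filterᵇ (adj b u) (uniqueX o)))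
          (Unique-∖ A (Unique-filterᵇ (adj b v) (uniqueX o)))
          λ {x} {y} i j → adj-not b (λ q → proj₂ (∈-∖⁻ Xv A j) (subst (_∈ A) q i)) (none i j))))
      where
      -- Both u and v have at least 2n neighbours here: n of those of u form `A`, and removing `A`
      -- from those of v leaves n. Hence the threshold r = 2n - 1.
      A  = take n (filterᵇ (adj b u) X)
      Xv = filterᵇ (adj b v) X
      B  = Xv ∖ A
      A⊆ : A ⊆ X
      A⊆ i = proj₁ (∈-filterᵇ⁻ (adj b u) X (∈-take n i))
      B⊆ : B ⊆ X
      B⊆ i = proj₁ (∈-filterᵇ⁻ (adj b v) X (proj₁ (∈-∖⁻ Xv A i)))
      n≤r : ∀ n r → suc r ≡ 2 * n → 2 ≤ n → n ≤ suc r
      n≤r n r e _ = ≤-trans (m≤m+n n _) (≤-reflexive (sym e))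
      lenA : length A ≡ n
      lenA = length-take-≤ n _ (≤-trans (n≤r n r r≡ 2≤n) (≤-trans (≰⇒> hu) (≤-reflexive (sym (length-filterᵇ (adj b u) X)))))

    record Pruned (j : ℕ) (ds X : List Vertex) : Set where
      constructor pruned
      field
        {W X′}  : List Vertex
        uniqueW : Unique W
        W⊆      : W ⊆ ds
        lengthW : length W ≡ j
        out     : Outside X′
        kept    : X′ ⊆ X
        blue    : ∀ {w x} → w ∈ W → x ∈ X′ → E (not b) w x
        size    : length X ≤ length X′ + j * r

    prune-arith : ∀ x y z j r → x ≤ y + r → y ≤ z + j * r → x ≤ z + (r + j * r)
    prune-arith x y z j r h₁ h₂ = ≤-trans h₁ (≤-trans (+-monoˡ-≤ r h₂) (≤-reflexive (trans (+-assoc z (j * r) r) (cong (z +_) (+-comm (j * r) r)))))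

    two-more : ∀ {j l} → suc (suc l) ≡ 2 * suc j → l ≡ 2 * j
    two-more {j} e = suc-injective (suc-injective (trans e (double j)))
      where
      double : ∀ j → 2 * suc j ≡ suc (suc (2 * j))
      double j = solve (j ∷ [])

    empty : ∀ {ds X} → Outside X → Pruned 0 ds X
    empty o = pruned ◇ (λ ()) refl o id (λ ()) (m≤m+n _ 0)

    extend : ∀ {j u v ds X} → u ∉ ds → v ∉ ds → (T : Thinned u v X) → Pruned j ds (Thinned.X′ T) → Pruned (suc j) (u ∷ v ∷ ds) X
    extend {j} {u} {v} {ds} {X} u∉ v∉ (thinned w which {X₁} kept o blue size) (pruned {W} {X₂} uW W⊆ lW o′ kept′ blue′ size′) = record
      { W = w ∷ W ; X′ = X₂
      ; uniqueW = Unique-∷⁺ (λ i → case-⊎ (λ { refl → u∉ (W⊆ i) }) (λ { refl → v∉ (W⊆ i) }) which) uW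
      ; W⊆ = λ { (here refl) → case-⊎ (λ { refl → here refl }) (λ { refl → there (here refl) }) which ; (there i) → there (there (W⊆ i)) }
      ; lengthW = cong suc lW
      ; out = o′
      ; kept = λ i → kept (kept′ i)
      ; blue = λ { (here refl) j → blue (kept′ j) ; (there i) j → blue′ i j }
      ; size = prune-arith (length X) (length X₁) (length X₂) j r size size′ }

    -- The ring is read in disjoint consecutive pairs. By `thin`, each pair contributes one vertex
    -- that is joined in the other colour to all that is left of `X`, so half of the ring is
    -- selected at a price of at most `r` vertices per pair.
    prune : ∀ j {s t ds X} → Walk (E b) s t ds → (∀ {u v} → Cut {R = E b} s t u v ds → Cut {R = E b} start end u v cs) →
            Unique ds → length ds ≡ 2 * suc j → Outside X → Found ⊎ Pruned (suc j) ds X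
    prune j [ _ ]ʷ f u e o = ⊥-elim (absurd (trans e (double j)))
      where
      double : ∀ j → 2 * suc j ≡ suc (suc (2 * j))
      double j = solve (j ∷ [])
      absurd : ∀ {l} → ¬ 1 ≡ suc (suc l)
      absurd ()
    prune zero (s ∷ʷ w@([ v ]ʷ)) f u e o with thin (f (cut refl [ _ ]ʷ s w)) o
    ... | inj₁ found = inj₁ found
    ... | inj₂ T = inj₂ (extend (λ ()) (λ ()) T (empty (Thinned.out T)))
    prune (suc j) (s ∷ʷ [ v ]ʷ) f u e o = ⊥-elim (absurd (two-more {suc j} {0} e))
      where
      absurd : ¬ 0 ≡ 2 * suc j
      absurd ()
    prune zero (s ∷ʷ s₂ ∷ʷ w) f u e o = ⊥-elim (absurd (walk-length w) (suc-injective (suc-injective e)))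
      where
      absurd : ∀ {l} → 1 ≤ l → ¬ l ≡ 0
      absurd (s≤s _) ()
    prune (suc j) (s ∷ʷ s₂ ∷ʷ w) f (a ◂ a₂ ◂ u) e o with thin (f (cut refl [ _ ]ʷ s (s₂ ∷ʷ w))) o
    ... | inj₁ found = inj₁ found
    ... | inj₂ T with prune j w (λ { (cut q w₁ t w₂) → f (cut (cong (λ l → _ ∷ _ ∷ l) q) (s ∷ʷ s₂ ∷ʷ w₁) t w₂) }) u (two-more {suc j} e) (Thinned.out T)
    ...   | inj₁ found = inj₁ found
    ...   | inj₂ P = inj₂ (extend (λ i → All.lookup a (there i) refl) (λ i → All.lookup a₂ i refl) T P)

  opaque
    outside-arith : (s c x k n : ℕ) → s ≤ c + x → c ≡ 2 * k → 2 * (1 + k) + n + 119 ≤ s → n + 121 ≤ x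
    outside-arith s c x k n h1 h2 h3 =
        linear 1 0 (h1 ⊕ (≤-reflexive h2) ⊕ h3) (solve (s ∷ c ∷ x ∷ k ∷ n ∷ []))

    small-arith : (x z k n t : ℕ) → n + 121 ≤ x → x ≤ z + t → t ≤ 105 → k ≤ 7 → n ≡ 1 + k →
        2 * (1 + k) + 4 ≤ z
    small-arith x z k n t h1 h2 h3 h4 h5 =
        linear 1 4 (h1 ⊕ h2 ⊕ h3 ⊕ h4 ⊕ (≤-reflexive (sym h5))) (solve (x ∷ z ∷ k ∷ n ∷ t ∷ []))

    small-arith₂ : (x z n t : ℕ) → n + 121 ≤ x → x ≤ z + t → t ≤ 105 → n ≤ z
    small-arith₂ x z n t h1 h2 h3 = linear 1 16 (h1 ⊕ h2 ⊕ h3) (solve (x ∷ z ∷ n ∷ t ∷ []))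

    small-arith₃ : (x z k : ℕ) → 2 * (1 + k) + 4 ≤ x → x ≤ z + 2 * 2 → 2 * (1 + k) ≤ z
    small-arith₃ x z k h1 h2 = linear 1 0 (h1 ⊕ h2) (solve (x ∷ z ∷ k ∷ []))

    small-arith₄ : (x k q : ℕ) → 2 * (1 + k) + 4 ≤ x → k ≡ 2 + q → 2 * 2 + q ≤ x
    small-arith₄ x k q h1 h2 =
        linear 1 (k + 4) (h1 ⊕ (≤-reflexive (sym h2))) (solve (x ∷ k ∷ q ∷ []))

    range-arith : (r n k : ℕ) → 1 + r ≡ 2 * n → n ≤ 1 + k → k ≤ 7 → r ≤ 15
    range-arith r n k h1 h2 h3 =
        linear 1 0 ((≤-reflexive h1) ⊕ 2 ⊗ h2 ⊕ 2 ⊗ h3) (solve (r ∷ n ∷ k ∷ []))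

    delete-one : (x y n : ℕ) → n + 121 ≤ x → x ≤ 1 + y → n + 120 ≤ y
    delete-one x y n h1 h2 = linear 1 0 (h1 ⊕ h2) (solve (x ∷ y ∷ n ∷ []))

    clique-arith : (x z n κ j p : ℕ) → n + 120 ≤ x → x ≤ z + 2 * p → n ≡ κ + j → p ≡ 2 * j → 1 ≤ j →
        j ≤ 3 → (2 + κ) + 1 ≤ z
    clique-arith x z n κ j p h1 h2 h3 h4 h5 h6 =
        linear 1 108 (h1 ⊕ h2 ⊕ (≤-reflexive (sym h3)) ⊕ 2 ⊗ (≤-reflexive h4) ⊕ 3 ⊗ h6) (solve (x ∷ z
        ∷ n ∷ κ ∷ j ∷ p ∷ []))

    clique-arith₂ : (x z z′ n κ j p : ℕ) → n + 120 ≤ x → x ≤ z + 2 * p → n ≡ κ + j → p ≡ 2 * j → j ≤ 3 →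
        z ≤ 1 + z′ → n ≤ z′
    clique-arith₂ x z z′ n κ j p h1 h2 h3 h4 h5 h6 =
        linear 1 107 (h1 ⊕ h2 ⊕ 2 ⊗ (≤-reflexive h4) ⊕ 4 ⊗ h5 ⊕ h6) (solve (x ∷ z ∷ z′ ∷ n ∷ κ ∷ j ∷ p
        ∷ []))

    clique-arith₃ : (c c′ n k : ℕ) → c ≡ 2 * k → c ≤ 1 + c′ → n ≤ 1 + k → 2 ≤ k → n ≤ c′
    clique-arith₃ c c′ n k h1 h2 h3 h4 =
        linear 1 0 ((≤-reflexive (sym h1)) ⊕ h2 ⊕ h3 ⊕ h4) (solve (c ∷ c′ ∷ n ∷ k ∷ []))

    match-arith : (x n κ p q j : ℕ) → n + 120 ≤ x → n ≡ κ + j → κ ≡ p + q → p ≤ 6 → j ≤ 3 →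
        2 * p + q ≤ x
    match-arith x n κ p q j h1 h2 h3 h4 h5 =
        linear 1 (j + 114) (h1 ⊕ (≤-reflexive (sym h2)) ⊕ (≤-reflexive (sym h3)) ⊕ h4) (solve (x ∷ n ∷
        κ ∷ p ∷ q ∷ j ∷ []))

  module EvenStep (b : Bool) (k n : ℕ) {S : List Vertex} (uS : Unique S) (R : Ring b (2 * k) S)
                  (2≤k : 2 ≤ k) (2≤n : 2 ≤ n) (n≤k+1 : n ≤ suc k) (big : 2 * suc k + n + 119 ≤ length S) where

    open Ring R renaming (verts to cs; walk to around)
    open Lengthen b k R
    open Lengthen₂ b k R

    Found : Set
    Found = Ring b (2 * suc k) S ⊎ Ring (not b) (2 * n) S

    X : List Vertex
    X = S ∖ cs

    size-X : n + 121 ≤ length X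
    size-X = outside-arith (length S) (length cs) (length X) k n (length-∖ cs uS) size big

    X⊆ : X ⊆ S
    X⊆ i = proj₁ (∈-∖⁻ S cs i)

    X-off : ∀ {v} → v ∈ X → v ∉ cs
    X-off i = proj₂ (∈-∖⁻ S cs i)

    -- Small k, where `long-ring` has too few common neighbours to work with. The k vertices
    -- selected by `prune` and the rest of `X` contain the cycle of the other colour if n ≤ k. If n
    -- = k + 1, two edges of the other colour in `X′` supply the missing two vertices; failing
    -- these, `X′` contains a clique of colour `b` that already has a cycle of length 2k + 2.
    short-ring : k ≤ 7 → Found
    short-ring k≤7 = at n refl
      where
      at : ∀ n′ → n′ ≡ n → Found
      at zero e = ⊥-elim (absurd (subst (2 ≤_) (sym e) 2≤n))
        where
        absurd : ¬ 2 ≤ 0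
        absurd ()
      at (suc n′) e = go 2≤k refl
        where
        r = n′ + suc (n′ + 0)
        open Prune b k n r R 2≤n (trans refl (cong (2 *_) e)) hiding (Found)
        go : ∀ {k′} → 2 ≤ k′ → k′ ≡ k → Found
        go {suc κ} _ k≡ with prune κ {X = X} around id unique (trans size (cong (2 *_) (sym k≡))) (outside (Unique-∖ cs uS) X⊆ X-off)
        ... | inj₁ found = found
        ... | inj₂ (pruned {W} {X′} uW W⊆ lW (outside uX′ X′⊆ off) kept blue sz) = finish (n ≤? k)
          where
          -- At most 7 pairs at a price of r = 2n - 1 ≤ 15 each. At least n + 16 of the n + 121
          -- vertices survive, which is what the 119 in `big` provides for.
          t≤ : suc κ * r ≤ 105
          t≤ = *-mono-≤ (≤-trans (≤-reflexive k≡) k≤7) (range-arith r n k (cong (2 *_) e) n≤k+1 k≤7)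
            where open import Data.Nat.Properties using (*-mono-≤)
          W⊆S : W ⊆ S
          W⊆S i = within (W⊆ i)
          finish : Dec (n ≤ k) → Found
          finish (yes n≤k) = inj₂ (ring-⊆ (⊆-++ {W} W⊆S X′⊆) (biclique-ring W X′ 2≤n
            (≤-trans n≤k (≤-reflexive (sym (trans lW k≡)))) (small-arith₂ (length X) (length X′) n _ size-X sz t≤) uW uX′ blue))
          finish (no n≰k) with ≤-antisym n≤k+1 (≰⇒> n≰k)
          ... | n≡ with small-arith (length X) (length X′) k n _ size-X sz t≤ k≤7 n≡ | matching⊎clique b 2 uX′
          ...   | z | inj₂ (cliqueRest uZ Z⊆ la full) =
            inj₁ (ring-⊆ (λ i → X′⊆ (Z⊆ i)) (clique-ring (s≤s (≤-trans (s≤s z≤n) (m≤n+m _ k))) (small-arith₃ (length X′) _ k z la) uZ full))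
          ...   | z | inj₁ M = inj₂ (subst (λ ℓ → Ring (not b) ℓ S) len (ring-⊆ (⊆-++ {X′} X′⊆ W⊆S)
            (matched-ring (k ∸ 2) (s≤s z≤n) M uX′ uW (λ i j → off i (W⊆ j))
              (small-arith₄ (length X′) k (k ∸ 2) z (sym k′))
              (λ i j ne → ≤-reflexive (trans k′ (sym (trans (#-true _ W λ w∈ → ∧-intro (adj-sym (blue w∈ i)) (adj-sym (blue w∈ j))) (trans lW k≡))))))))
            where
            k′ : 2 + (k ∸ 2) ≡ k
            k′ = m+[n∸m]≡n 2≤k
            len : (2 * 2 + (k ∸ 2)) + (2 + (k ∸ 2)) ≡ 2 * n
            len = trans (total (k ∸ 2)) (cong (2 *_) (trans (cong suc k′) (sym n≡)))
              where
              total : ∀ q → (2 * 2 + q) + (2 + q) ≡ 2 * (1 + (2 + q))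
              total q = solve (q ∷ [])

    record Tame (Y : List Vertex) : Set where
      constructor tame
      field
        uniqueY : Unique Y
        Y⊆X     : Y ⊆ X
        sizeY   : n + 120 ≤ length Y
        single  : ∀ {x} → x ∈ Y → ¬ 2 ≤ pairs (both b x x) (end ∷ cs)

    twice : Vertex → Bool
    twice x = does (2 ≤? pairs (both b x x) (end ∷ cs))

    -- Two vertices that each fit into two steps of the ring could both be inserted by `insert-two`;
    -- so all of `X` is tame after deleting at most one vertex.
    tame-part : Found ⊎ ∃ Tame
    tame-part with ∃⊎∀ twice X
    ... | inj₂ none = inj₂ (X , tame (Unique-∖ cs uS) id (≤-trans (+-monoʳ-≤ n (n≤1+n 120)) size-X) λ i → does-no (2 ≤? _) (none i))
    ... | inj₁ (x , x∈ , tx) with ∃⊎∀ twice (X ∖ [ x ])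
    ...   | inj₁ (y , y∈ , ty) = let (y∈X , y∉) = ∈-∖⁻ X [ x ] y∈ in
            inj₁ (inj₁ (insert-two (X⊆ x∈) (X⊆ y∈X) (X-off x∈) (X-off y∈X) (λ q → y∉ (here (sym q)))
              (does-yes (2 ≤? _) tx) (≤-trans (s≤s z≤n) (does-yes (2 ≤? pairs (both b y y) (end ∷ cs)) ty))))
    ...   | inj₂ none = inj₂ (X ∖ [ x ] , tame (Unique-∖ [ x ] (Unique-∖ cs uS)) (λ i → proj₁ (∈-∖⁻ X [ x ] i))
              (delete-one (length X) (length (X ∖ [ x ])) n size-X (length-∖ [ x ] (Unique-∖ cs uS))) λ i → does-no (2 ≤? _) (none i))

    few : Vertex → Vertex → Bool
    few x y = not (x == y) ∧ does (# (common (not b) x y) cs + 2 <? k)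

    well-linked : ∀ {Y} → Tame Y → Found ⊎ (∀ {x y} → x ∈ Y → y ∈ Y → x ≢ y → k ≤ # (common (not b) x y) cs + 2)
    well-linked {Y} (tame uY Y⊆X _ single) with ∃₂⊎∀₂ few Y Y
    ... | inj₂ none = inj₂ λ {x} {y} i j ne → ≮⇒≥ (does-no (_ <? k) (trans (sym (cong (λ t → not t ∧ does (# (common (not b) x y) cs + 2 <? k)) (≢⇒== ne))) (none i j)))
    ... | inj₁ (x , y , x∈ , y∈ , e) with common-blue (X⊆ (Y⊆X x∈)) (X⊆ (Y⊆X y∈)) (X-off (Y⊆X x∈)) (X-off (Y⊆X y∈))
                                           (==-false (not-true (∧-elimˡ e))) (single x∈) (single y∈)
    ...   | inj₁ found = inj₁ (inj₁ found)
    ...   | inj₂ h = ⊥-elim (<-irrefl refl (<-≤-trans (does-yes (_ <? k) (∧-elimʳ {not (x == y)} e)) h))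

    -- Two tame vertices have κ = k - 2 common neighbours of the other colour on the ring, enough to
    -- alternate if n ≤ κ. Otherwise n = κ + j with 1 ≤ j ≤ 3, and `matched-ring` with 2j edges
    -- reaches 2κ + 2j = 2n; this requires 2j ≤ κ and hence κ ≥ 6. If 2j disjoint edges are missing,
    -- a large clique of colour `b` remains: two disjoint edges to the ring permit `arc-switch`, and
    -- a star leaves a complete bipartite graph of the other colour once its centre is deleted.
    long-ring : ∀ κ → 6 ≤ κ → k ≡ 2 + κ → Found
    long-ring κ 6≤κ k≡ with tame-part
    ... | inj₁ found = found
    ... | inj₂ (Y , T@(tame uY Y⊆X sizeY _)) with well-linked T
    ...   | inj₁ found = found
    ...   | inj₂ linked = finish (n ≤? κ)
      where
      Y⊆S : Y ⊆ S
      Y⊆S i = X⊆ (Y⊆X i)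
      Y-off : ∀ {v} → v ∈ Y → v ∉ cs
      Y-off i = X-off (Y⊆X i)
      link : ∀ {x y} → x ∈ Y → y ∈ Y → x ≢ y → κ ≤ # (common (not b) x y) cs
      link {x} {y} i j ne = cancel (# (common (not b) x y) cs) (≤-trans (≤-reflexive (sym k≡)) (linked i j ne))
        where
        cancel : ∀ t → 2 + κ ≤ t + 2 → κ ≤ t
        cancel t h = linear 1 0 h (solve (κ ∷ t ∷ []))
      case-clique : ∀ j → n ≡ κ + j → 1 ≤ j → j ≤ 3 → CliqueRest b (2 * j) Y → Found
      case-clique j n≡ 1≤j j≤3 (cliqueRest {Z} uZ Z⊆ la full) with disjoint⊎star Z cs (adj b) start
      ... | inj₁ D = inj₁ (arc-switch D uZ (λ i → Y⊆S (Z⊆ i)) (λ i → Y-off (Z⊆ i)) full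
              (≤-trans (≤-reflexive (trans (cong suc k≡) (+-comm 1 (2 + κ)))) (clique-arith (length Y) (length Z) n κ j (2 * j) sizeY la n≡ refl 1≤j j≤3)))
      ... | inj₂ (star z none) = inj₂ (ring-⊆ (⊆-++ {Z ∖ [ z ]} (λ i → Y⊆S (Z⊆ (proj₁ (∈-∖⁻ Z [ z ] i)))) λ i → within (proj₁ (∈-∖⁻ cs [ z ] i)))
              (biclique-ring (Z ∖ [ z ]) (cs ∖ [ z ]) 2≤n
                (clique-arith₂ (length Y) (length Z) (length (Z ∖ [ z ])) n κ j (2 * j) sizeY la n≡ refl j≤3 (length-∖ [ z ] uZ))
                (clique-arith₃ (length cs) (length (cs ∖ [ z ])) n k size (length-∖ [ z ] unique) n≤k+1 2≤k)
                (Unique-∖ [ z ] uZ) (Unique-∖ [ z ] unique)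
                λ {x} {y} i j → let (x∈ , x∉) = ∈-∖⁻ Z [ z ] i ; (y∈ , y∉) = ∈-∖⁻ cs [ z ] j in
                  adj-not b (λ q → Y-off (Z⊆ x∈) (subst (_∈ cs) (sym q) y∈)) (none x∈ y∈ (x∉ ∘ here) (y∉ ∘ here))))
      case-matching : ∀ j → n ≡ κ + j → 1 ≤ j → j ≤ 3 → Matching (not b) (2 * j) Y → Found
      case-matching j n≡ 1≤j j≤3 M = inj₂ (subst (λ ℓ → Ring (not b) ℓ S) len (ring-⊆ (⊆-++ {Y} Y⊆S within)
          (matched-ring q (≤-trans 1≤j (m≤m+n j _)) M uY unique Y-off
            (match-arith (length Y) n κ (2 * j) q j sizeY n≡ (sym κ≡) (2 ⊗ j≤3) j≤3)
            (λ i i′ ne → ≤-trans (≤-reflexive κ≡) (link i i′ ne)))))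
        where
        q = κ ∸ 2 * j
        κ≡ : 2 * j + q ≡ κ
        κ≡ = m+[n∸m]≡n (≤-trans (2 ⊗ j≤3) 6≤κ)
        len : (2 * (2 * j) + q) + (2 * j + q) ≡ 2 * n
        len = trans (total j q) (cong (2 *_) (trans (cong (_+ j) κ≡) (sym n≡)))
          where
          total : ∀ j q → (2 * (2 * j) + q) + (2 * j + q) ≡ 2 * ((2 * j + q) + j)
          total j q = solve (j ∷ q ∷ [])
      finish : Dec (n ≤ κ) → Found
      finish (yes n≤κ) = inj₂ (ring-⊆ (⊆-++ {Y} Y⊆S within) (greedy-ring Y cs 2≤n (≤-trans (m≤m+n n 120) sizeY) uY unique Y-off
        λ i j ne → ≤-trans n≤κ (link i j ne)))
      finish (no n≰κ) = case-⊎ (case-matching j n≡ 1≤j j≤3) (case-clique j n≡ 1≤j j≤3) (matching⊎clique b (2 * j) uY)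
        where
        j = n ∸ κ
        n≡ : n ≡ κ + j
        n≡ = sym (m+[n∸m]≡n (<⇒≤ (≰⇒> n≰κ)))
        lower : ∀ j → κ < n → n ≡ κ + j → 1 ≤ j
        lower j h e = linear 1 0 (h ⊕ ≤-reflexive e) (solve (κ ∷ j ∷ n ∷ []))
        upper : ∀ j → n ≤ suc k → k ≡ 2 + κ → n ≡ κ + j → j ≤ 3
        upper j h e e′ = linear 1 0 (h ⊕ ≤-reflexive e ⊕ ≤-reflexive (sym e′)) (solve (κ ∷ j ∷ n ∷ k ∷ []))
        1≤j = lower j (≰⇒> n≰κ) n≡
        j≤3 = upper j n≤k+1 k≡ n≡

    even-step : Found
    even-step with k ≤? 7
    ... | yes h = short-ring h
    ... | no ¬h = long-ring (k ∸ 2) (sub (k ∸ 2) (≰⇒> ¬h) (m+[n∸m]≡n 2≤k)) (sym (m+[n∸m]≡n 2≤k))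
      where
      sub : ∀ κ → 8 ≤ k → 2 + κ ≡ k → 6 ≤ κ
      sub κ h e = linear 1 0 (h ⊕ ≤-reflexive (sym e)) (solve (κ ∷ k ∷ []))

  -- Ramsey numbers of even cycles

  square : ∀ d {S v w} → Unique S → v ∈ S → w ∈ S → v ≢ w → Ring d 4 S ⊎ # (common d v w) S ≤ 1
  square d {S} {v} {w} u v∈ w∈ v≢w with 2 ≤? # (common d v w) S
  ... | no h  = inj₂ (s≤s⁻¹ (≰⇒> h))
  ... | yes h = inj₁ (ring-⊆ (⊆-++ {v ∷ w ∷ []} (λ { (here refl) → v∈ ; (there (here refl)) → w∈ }) λ i → proj₁ (∈-filterᵇ⁻ (common d v w) S i))
    (biclique-ring (v ∷ w ∷ []) (filterᵇ (common d v w) S) ≤-refl ≤-refl (≤-trans h (≤-reflexive (sym (length-filterᵇ (common d v w) S))))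
      (Unique-∷⁺ (λ { (here q) → v≢w q }) (◇ ◂ ◇)) (Unique-filterᵇ (common d v w) u)
      λ { {y = y} (here refl) j → ∧-elimˡ (proj₂ (∈-filterᵇ⁻ (common d v w) S j))
        ; {y = y} (there (here refl)) j → ∧-elimʳ {adj d v y} (proj₂ (∈-filterᵇ⁻ (common d v w) S j)) }))

  opaque
    star-arith : (x p p′ q q′ r : ℕ) → x ≤ 1 + p + p′ → x ≤ 1 + q + q′ → p ≤ 1 → q ≤ 1 →
        p′ + q′ ≤ x + r → r ≤ 1 → x ≤ 5
    star-arith x p p′ q q′ r h1 h2 h3 h4 h5 h6 =
        linear 1 0 (h1 ⊕ h2 ⊕ h3 ⊕ h4 ⊕ h5 ⊕ h6) (solve (x ∷ p ∷ p′ ∷ q ∷ q′ ∷ r ∷ []))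

    base-arith : (s x y : ℕ) → s ≤ 1 + x + y → x ≤ 5 → y ≤ 5 → 12 ≤ s → ⊥
    base-arith s x y h1 h2 h3 h4 = 1≰0 (linear 1 0 (h1 ⊕ h2 ⊕ h3 ⊕ h4) (solve (s ∷ x ∷ y ∷ [])))

  -- Three vertices and two colours: were all common neighbourhoods of size at most one,
  -- there would be fewer than twelve vertices.
  four-ring : ∀ b {S} → Unique S → 12 ≤ length S → Ring b 4 S ⊎ Ring (not b) 4 S
  four-ring b {S} u big = search S u big id
    where
    Found = Ring b 4 S ⊎ Ring (not b) 4 S
    -- Let X be the neighbourhood of v in colour d. In it w and z have at most one neighbour of
    -- colour d each, hence at least |X| - 2 of the other colour, and these two sets share at most
    -- one vertex: 2|X| - 4 ≤ |X| + 1.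
    at-most-five : ∀ d d′ → d′ ≡ not d → ∀ {v w z} → # (common d v w) S ≤ 1 → # (common d v z) S ≤ 1 → # (common d′ w z) S ≤ 1 → # (adj d v) S ≤ 5
    at-most-five d _ refl {v} {w} {z} h₁ h₂ h₃ = ≤-trans (≤-reflexive (sym (length-filterᵇ (adj d v) S)))
      (star-arith (length X) (# (adj d w) X) (# (adj (not d) w) X) (# (adj d z) X) (# (adj (not d) z) X) (# (common (not d) w z) X)
        (degree-sum d w uX) (degree-sum d z uX)
        (≤-trans (≤-reflexive (#-filterᵇ (adj d v) (adj d w) S)) h₁)
        (≤-trans (≤-reflexive (#-filterᵇ (adj d v) (adj d z) S)) h₂)
        (#-∧ (adj (not d) w) (adj (not d) z) X)
        (≤-trans (≤-reflexive (#-filterᵇ (adj d v) (common (not d) w z) S)) (≤-trans (#-mono S λ {x} _ e → ∧-elimʳ {adj d v x} e) h₃)))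
      where
      X = filterᵇ (adj d v) S
      uX = Unique-filterᵇ (adj d v) u
    search : ∀ T → Unique T → 12 ≤ length T → T ⊆ S → Found
    search [] _ () _
    search (_ ∷ []) _ (s≤s ()) _
    search (_ ∷ _ ∷ []) _ (s≤s (s≤s ())) _
    search (v ∷ w ∷ z ∷ T) ((v≢w ◂ v≢z ◂ _) ◂ ((w≢z ◂ _) ◂ _)) _ T⊆
      with square b u v∈ w∈ v≢w | square b u v∈ z∈ v≢z | square b u w∈ z∈ w≢z
         | square (not b) u v∈ w∈ v≢w | square (not b) u v∈ z∈ v≢z | square (not b) u w∈ z∈ w≢z
      where
      v∈ = T⊆ (here refl)
      w∈ = T⊆ (there (here refl))
      z∈ = T⊆ (there (there (here refl)))
    ... | inj₁ r | _ | _ | _ | _ | _ = inj₁ r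
    ... | inj₂ _ | inj₁ r | _ | _ | _ | _ = inj₁ r
    ... | inj₂ _ | inj₂ _ | inj₁ r | _ | _ | _ = inj₁ r
    ... | inj₂ _ | inj₂ _ | inj₂ _ | inj₁ r | _ | _ = inj₂ r
    ... | inj₂ _ | inj₂ _ | inj₂ _ | inj₂ _ | inj₁ r | _ = inj₂ r
    ... | inj₂ _ | inj₂ _ | inj₂ _ | inj₂ _ | inj₂ _ | inj₁ r = inj₂ r
    ... | inj₂ h₁ | inj₂ h₂ | inj₂ h₃ | inj₂ h₄ | inj₂ h₅ | inj₂ h₆ =
      ⊥-elim (base-arith (length S) (# (adj b v) S) (# (adj (not b) v) S) (degree-sum b v u)
        (at-most-five b (not b) refl h₁ h₂ h₆) (at-most-five (not b) b (sym (Boolₚ.not-involutive b)) h₄ h₅ h₃) big)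

  opaque
    diagonal-size : (i s : ℕ) → 2 * (3 + i) + (3 + i) + 119 ≤ s → 2 * (2 + i) + (2 + i) + 119 ≤ s
    diagonal-size i s h1 = linear 1 3 h1 (solve (i ∷ s ∷ []))

    off-diagonal-size : (j n s : ℕ) → 2 * ((1 + j) + n) + n + 119 ≤ s → 2 * (j + n) + n + 119 ≤ s
    off-diagonal-size j n s h1 = linear 1 2 h1 (solve (j ∷ n ∷ s ∷ []))

  -- `EvenStep` is applied with n = k + 1, the largest value it allows: it yields a cycle of length
  -- 2k + 2 in the colour of the given cycle or in the other one. The induction can thus continue
  -- from either colour.
  even-diagonal : ∀ i b {S} → Unique S → 2 * (2 + i) + (2 + i) + 119 ≤ length S →
                  Ring b (2 * (2 + i)) S ⊎ Ring (not b) (2 * (2 + i)) S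
  even-diagonal zero b u h = four-ring b u (≤-trans (m≤m+n 12 113) h)
  even-diagonal (suc i) b {S} u h with even-diagonal i b u (diagonal-size i (length S) h)
  ... | inj₁ R = EvenStep.even-step b (2 + i) (3 + i) u R (s≤s (s≤s z≤n)) (s≤s (s≤s z≤n)) ≤-refl h
  ... | inj₂ R = subst (λ d → Ring d (2 * (3 + i)) S ⊎ Ring (not b) (2 * (3 + i)) S) (Boolₚ.not-involutive b)
    (swap (EvenStep.even-step (not b) (2 + i) (3 + i) u R (s≤s (s≤s z≤n)) (s≤s (s≤s z≤n)) ≤-refl h))

  -- R(C_{2m}, C_{2n}) ≤ 2m + n − 1 with additive slack 120, where m = j + n.
  even-cycles : ∀ j n b {S} → 2 ≤ n → Unique S → 2 * (j + n) + n + 119 ≤ length S →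
                Ring b (2 * (j + n)) S ⊎ Ring (not b) (2 * n) S
  even-cycles zero (suc (suc i)) b 2≤n u h = even-diagonal i b u h
  even-cycles zero (suc zero) b (s≤s ()) u h
  even-cycles (suc j) n b {S} 2≤n u h with even-cycles j n b 2≤n u (off-diagonal-size j n (length S) h)
  ... | inj₂ R = inj₂ R
  ... | inj₁ R = EvenStep.even-step b (j + n) n u R (≤-trans 2≤n (m≤n+m n j)) 2≤n (≤-trans (m≤n+m n j) (n≤1+n _)) h

  -- The colouring without red C_{2m} and blue W_{2n}: red degrees and odd walks

  module Contradiction
         {m n γ e : ℕ} (m≡ : m ≡ γ + n) (2≤n : 2 ≤ n) (N≡ : suc N ≡ 4 * m + e) (slack : 999 ≤ 3 * e + 4 * γ)
         (no-ring : ¬ Ring true (2 * m) vertices) (no-wheel : ¬ HasCopy c false (Wheel (2 * n))) where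

    n≤m : n ≤ m
    n≤m = ≤-trans (m≤n+m n γ) (≤-reflexive (sym m≡))

    red blue : Vertex → List Vertex → ℕ
    red v  = # (adj true v)
    blue v = # (adj false v)

    no-red-cycle : ∀ {S} → ¬ Ring true (2 * m) S
    no-red-cycle R = no-ring (ring-⊆ (λ {v} _ → ∈-vertices v) R)

    no-blue-biclique : ∀ h X Y → n ≤ length X → n ≤ length Y → Unique X → Unique Y →
                       (∀ {x y} → x ∈ X → y ∈ Y → E false x y) → (∀ {x} → x ∈ X → E false h x) → (∀ {y} → y ∈ Y → E false h y) → ⊥
    no-blue-biclique h X Y nX nY uX uY full hX hY = no-wheel (biclique⇒wheel h X Y 2≤n nX nY uX uY full hX hY)

    opaque
      red-arith : (m n γ e N r B : ℕ) → m ≡ γ + n → 1 + N ≡ 4 * m + e → N ≤ 1 + r + B →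
          B < 2 * m + n + 119 → m + γ + e ≤ r + 120
      red-arith m n γ e N r B h1 h2 h3 h4 =
          linear 1 0 ((≤-reflexive (sym h1)) ⊕ (≤-reflexive (sym h2)) ⊕ h3 ⊕ h4) (solve (m ∷ n ∷ γ ∷ e ∷
          N ∷ r ∷ B ∷ []))

    -- In a blue neighbourhood of 2m + n + 119 vertices, `even-cycles` would find a red C_{2m}, or a
    -- blue C_{2n} that v completes to a blue wheel.
    red-degree : ∀ v → m + γ + e ≤ red v vertices + 120
    red-degree v = go (2 * m + n + 119 ≤? length B)
      where
      B = filterᵇ (adj false v) vertices
      go : Dec (2 * m + n + 119 ≤ length B) → m + γ + e ≤ red v vertices + 120
      go (yes h) = case-⊎
        (λ R → ⊥-elim (no-red-cycle (subst (λ t → Ring true (2 * t) B) (sym m≡) R)))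
        (λ R → ⊥-elim (no-wheel (hub⇒wheel v R λ i → proj₂ (∈-filterᵇ⁻ (adj false v) vertices i))))
        (even-cycles γ n true 2≤n (Unique-filterᵇ (adj false v) vertices-unique) (subst (λ t → 2 * t + n + 119 ≤ length B) m≡ h))
      go (no h) = red-arith m n γ e N (red v vertices) (length B) m≡ N≡ split (≰⇒> h)
        where
        split : N ≤ 1 + red v vertices + length B
        split = ≤-trans (≤-reflexive (sym length-vertices)) (≤-trans (degree-sum true v vertices-unique)
          (≤-reflexive (cong (1 + red v vertices +_) (sym (length-filterᵇ (adj false v) vertices)))))

    opaque
      N-arith : (N m n γ e : ℕ) → 1 + N ≡ 4 * m + e → 2 ≤ n → m ≡ γ + n → 1 ≤ N
      N-arith N m n γ e h1 h2 h3 =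
          linear 1 (3 * m + γ + e) (6 ⊗ (≤-reflexive h1) ⊕ 7 ⊗ (≤-reflexive (sym h1)) ⊕ h2 ⊕
          (≤-reflexive (sym h3))) (solve (N ∷ m ∷ n ∷ γ ∷ e ∷ []))

    some-vertex : Vertex
    some-vertex = fromℕ< (N-arith N m n γ e N≡ 2≤n m≡)

    opaque
      grow-arith : (m γ e l d : ℕ) → m < 20 → 999 ≤ 3 * e + 4 * γ → m + γ + e ≤ d + 120 → l < 2 * m →
          l < d
      grow-arith m γ e l d h1 h2 h3 h4 =
          linear 4 (3 * m + e + 389) (7 ⊗ h1 ⊕ h2 ⊕ 4 ⊗ h3 ⊕ 4 ⊗ h4) (solve (m ∷ γ ∷ e ∷ l ∷ d ∷ []))

      close-arith : (m γ e N l a z : ℕ) → m < 20 → 999 ≤ 3 * e + 4 * γ → 1 + N ≡ 4 * m + e →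
          m + γ + e ≤ a + 120 → m + γ + e ≤ z + 120 → l + 1 ≡ 2 * m → N + l < a + z
      close-arith m γ e N l a z h1 h2 h3 h4 h5 h6 =
          linear 3 (m + 2 * γ + 37) (13 ⊗ h1 ⊕ h2 ⊕ 3 ⊗ (≤-reflexive h3) ⊕ 3 ⊗ h4 ⊕ 3 ⊗ h5 ⊕ 3 ⊗
          (≤-reflexive h6)) (solve (m ∷ γ ∷ e ∷ N ∷ l ∷ a ∷ z ∷ []))

    -- For small m the red degrees exceed N / 2, and greedy extension already gives the cycle.
    small-m : ¬ m < 20
    small-m m<20 = close (2 * m ∸ 1) (m∸n+n≡m {2 * m} {1} (≤-trans (≤-trans (s≤s z≤n) (≤-trans 2≤n n≤m)) (m≤m+n m _)))
      where
      grow : ∀ l → l < 2 * m → 1 ≤ l → ∃₂ λ a z → ∃ λ L → Walk (E true) a z L × Unique L × length L ≡ l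
      grow (suc zero) h _ = some-vertex , some-vertex , _ , [ some-vertex ]ʷ , (◇ ◂ ◇) , refl
      grow (suc (suc l)) h _ =
        let (a , z , L , w , u , len) = grow (suc l) (<⇒≤ h) (s≤s z≤n)
            (v , _ , va , v∉) = fresh (adj true a) L vertices-unique
              (≤-trans (s≤s (≤-reflexive len)) (grow-arith m γ e (suc l) (red a vertices) m<20 slack (red-degree a) (<⇒≤ h)))
        in v , z , v ∷ L , adj-sym va ∷ʷ w , Unique-∷⁺ v∉ u , cong suc len
      close : ∀ l → l + 1 ≡ 2 * m → ⊥
      close zero e = ⊥-elim (absurd e (≤-trans 2≤n n≤m))
        where
        absurd : ∀ {m} → 1 ≡ 2 * m → ¬ 2 ≤ m
        absurd {suc (suc m)} () _
        absurd {suc zero} e (s≤s ())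
      close l@(suc _) e =
        let (a , z , L , w , u , len) = grow l (≤-reflexive (trans (+-comm 1 l) e)) (s≤s z≤n)
            (v , _ , av , zv , v∉) = common-fresh (adj true a) (adj true z) L vertices-unique
              (≤-trans (s≤s (≤-reflexive (cong₂ _+_ length-vertices len)))
                (close-arith m γ _ N l (red a vertices) (red z vertices) m<20 slack N≡ (red-degree a) (red-degree z) e))
        in no-red-cycle (ring {S = vertices} (adj-sym av ∷ʷ w) zv (Unique-∷⁺ v∉ u) (trans (cong suc len) (trans (+-comm 1 l) e)) (λ {v} _ → ∈-vertices v))

    20≤m : 20 ≤ m
    20≤m = ≮⇒≥ small-m

    opaque
      book-arith : (z z′ n : ℕ) → 2 * n + 1 ≤ z → z ≤ (1 + n) + z′ → n ≤ z′
      book-arith z z′ n h1 h2 = linear 1 0 (h1 ⊕ h2) (solve (z ∷ z′ ∷ n ∷ []))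

      book-arith₂ : (p p′ n : ℕ) → n + 1 ≤ p → p ≤ 1 + p′ → n ≤ p′
      book-arith₂ p p′ n h1 h2 = linear 1 0 (h1 ⊕ h2) (solve (p ∷ p′ ∷ n ∷ []))

    -- As P lies in Z, it is a blue clique. Any vertex of P can be the hub; n further vertices of P
    -- and n remaining vertices of Z form the biclique around it.
    no-blue-book : ∀ P Z → Unique P → Unique Z → P ⊆ Z → (∀ {p z} → p ∈ P → z ∈ Z → p ≢ z → E false p z) →
                   n + 1 ≤ length P → ¬ 2 * n + 1 ≤ length Z
    no-blue-book [] Z uP uZ P⊆ full bigP bigZ = 1≰0 (≤-trans (m≤n+m 1 n) bigP)
    no-blue-book (h ∷ P) Z uP uZ P⊆ full bigP bigZ =
      no-blue-biclique h X Y (≤-reflexive (sym lX))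
        (book-arith (length Z) (length Y) n bigZ (≤-trans (length-∖ (h ∷ X) uZ) (≤-reflexive (cong (λ t → suc t + length Y) lX))))
        (Unique-take n uP′) (Unique-∖ (h ∷ X) uZ)
        (λ {x} {y} i j → full (there (∈-take n i)) (proj₁ (offY j)) (λ q → proj₂ (offY j) (there (subst (_∈ X) q i))))
        (λ i → full (here refl) (P⊆ (there (∈-take n i))) (λ q → Unique-∷⁻ uP (subst (_∈ P) (sym q) (∈-take n i))))
        (λ j → full (here refl) (proj₁ (offY j)) (λ q → proj₂ (offY j) (here (sym q))))
      where
      X = take n P
      Y = Z ∖ (h ∷ X)
      uP′ = proj₁ (proj₂ (Unique-++⁻ [ h ] uP))
      lX : length X ≡ n
      lX = length-take-≤ n P (book-arith₂ (suc (length P)) (length P) n bigP ≤-refl)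
      offY : ∀ {v} → v ∈ Y → v ∈ Z × v ∉ h ∷ X
      offY = ∈-∖⁻ Z (h ∷ X)

    -- Two red ways from v to y, with ρ and ρ + 1 steps. They may share vertices, because a path
    -- through the switch uses only one of them.
    record Switch (v : Vertex) (U : List Vertex) : Set where
      constructor switch
      field
        {y a₁ a₂}        : Vertex
        ρ                : ℕ
        1≤ρ              : 1 ≤ ρ
        ρ≤3              : ρ ≤ 3
        {short long new} : List Vertex
        start₁           : E true v a₁
        walk₁            : Walk (E true) a₁ y short
        length₁          : length short ≡ ρ
        unique₁          : Unique short
        start₂           : E true v a₂
        walk₂            : Walk (E true) a₂ y long
        length₂          : length long ≡ suc ρ
        unique₂          : Unique long
        short⊆           : short ⊆ new
        long⊆            : long ⊆ new
        new-size         : length new ≤ 6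
        new-fresh        : ∀ {x} → x ∈ new → x ∉ U

    opaque
      n₂-arith : (m n γ e r r′ u : ℕ) → m ≡ γ + n → 999 ≤ 3 * e + 4 * γ → m + γ + e ≤ r + 120 →
          r ≤ u + r′ → u ≤ 55 → n + 1 ≤ r′
      n₂-arith m n γ e r r′ u h1 h2 h3 h4 h5 =
          linear 3 (2 * γ + 473) (3 ⊗ (≤-reflexive (sym h1)) ⊕ h2 ⊕ 3 ⊗ h3 ⊕ 3 ⊗ h4 ⊕ 3 ⊗ h5) (solve (m
          ∷ n ∷ γ ∷ e ∷ r ∷ r′ ∷ u ∷ []))

      n₁-arith : (n r : ℕ) → n + 1 ≤ r → 1 ≤ r
      n₁-arith n r h1 = linear 1 n h1 (solve (n ∷ r ∷ []))

      clique-size : (n l : ℕ) → 2 * n + 1 ≤ l → n + 1 ≤ l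
      clique-size n l h1 = linear 1 n h1 (solve (n ∷ l ∷ []))

      n₃-arith : (m n γ e N u v z n₃ : ℕ) → m ≡ γ + n → 999 ≤ 3 * e + 4 * γ → 1 + N ≡ 4 * m + e →
          N ≤ u + v → v ≤ n₃ + z → u ≤ 55 → n₃ < 2 * n + 1 → 2 * n + 1 ≤ z
      n₃-arith m n γ e N u v z n₃ h1 h2 h3 h4 h5 h6 h7 =
          linear 3 (8 * γ + 830) (12 ⊗ (≤-reflexive (sym h1)) ⊕ h2 ⊕ 3 ⊗ (≤-reflexive (sym h3)) ⊕ 3 ⊗ h4
          ⊕ 3 ⊗ h5 ⊕ 3 ⊗ h6 ⊕ 3 ⊗ h7) (solve (m ∷ n ∷ γ ∷ e ∷ N ∷ u ∷ v ∷ z ∷ n₃ ∷ []))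

    -- An odd closed walk of length 3, 5 or 7 through v: a red edge inside the first, second
    -- or third neighbourhood. Without one, the second neighbourhood is a blue clique that is
    -- completely blue to everything outside the third.
    find-switch : ∀ v U → v ∈ U → length U ≤ 55 → Switch v U
    find-switch v U v∈U U≤55 = step₁ (∃₂⊎∀₂ (adj true) N₁ N₁)
      where
      V′ N₁ N₂ N₃ : List Vertex
      V′ = vertices ∖ U
      uV′ = Unique-∖ U vertices-unique
      N₁ = filterᵇ (adj true v) V′
      touches : List Vertex → Vertex → Bool
      touches L x = does (1 ≤? # (adj true x) L)
      N₂ = filterᵇ (touches N₁) V′
      N₃ = filterᵇ (touches N₂) V′
      off : ∀ {x} → x ∈ V′ → x ∉ U
      off i = proj₂ (∈-∖⁻ vertices U i)
      ∈N₁ : ∀ {x} → x ∈ N₁ → x ∈ V′ × E true v x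
      ∈N₁ = ∈-filterᵇ⁻ (adj true v) V′
      touch : ∀ L {x} → x ∈ filterᵇ (touches L) V′ → x ∈ V′ × ∃ λ y → y ∈ L × E true x y
      touch L {x} i = let (j , e) = ∈-filterᵇ⁻ (touches L) V′ i in j , #-find (adj true x) L (does-yes (1 ≤? _) e)
      touching : ∀ L {x y} → x ∈ V′ → y ∈ L → E true x y → x ∈ filterᵇ (touches L) V′
      touching L {x} {y} i j e = ∈-filterᵇ⁺ (touches L) i (yes-does (1 ≤? # (adj true x) L) (#-pos L j e))
        where
        #-pos : ∀ L {y} → y ∈ L → E true x y → 1 ≤ # (adj true x) L
        #-pos (z ∷ L) (here refl) e rewrite e = s≤s z≤n
        #-pos (z ∷ L) (there j) e = ≤-trans (#-pos L j e) (m≤n+m _ _)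
      red⊥ : ∀ {P : Set} {x y} → adj true x y ≡ false → E true x y → P
      red⊥ e f with trans (sym e) f
      ... | ()
      step₃ : (∀ {x y} → x ∈ N₁ → y ∈ N₁ → adj true x y ≡ false) → (∀ {x y} → x ∈ N₂ → y ∈ N₂ → adj true x y ≡ false) →
              ((∃₂ λ x y → x ∈ N₃ × y ∈ N₃ × E true x y) ⊎ (∀ {x y} → x ∈ N₃ → y ∈ N₃ → adj true x y ≡ false)) → Switch v U
      step₃ ind₁ ind₂ (inj₁ (d , d′ , d∈ , d′∈ , dd′)) =
        let (dV , b , b∈ , db) = touch N₂ d∈
            (d′V , b′ , b′∈ , d′b′) = touch N₂ d′∈
            (bV , a , a∈ , ba) = touch N₁ b∈
            (b′V , a′ , a′∈ , b′a′) = touch N₁ b′∈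
            -- Otherwise d′ would lie in `N₂`, and d′ b′ would be a red edge inside it.
            d∉N₁ : d ∉ N₁
            d∉N₁ i = red⊥ (ind₂ (touching N₁ d′V i (adj-sym dd′)) b′∈) d′b′
            d′∉N₁ : d′ ∉ N₁
            d′∉N₁ i = red⊥ (ind₂ (touching N₁ dV i dd′) b∈) db
            N₁∉N₂ : ∀ {x} → x ∈ N₁ → x ∉ N₂
            N₁∉N₂ i j = let (_ , y , y∈ , xy) = touch N₁ j in red⊥ (ind₁ i y∈) xy
            d∉N₂ : d ∉ N₂
            d∉N₂ i = red⊥ (ind₂ i b∈) db
        in switch 3 (s≤s z≤n) ≤-refl {new = a ∷ b ∷ d ∷ a′ ∷ b′ ∷ d′ ∷ []}
             (proj₂ (∈N₁ a∈)) (adj-sym ba ∷ʷ adj-sym db ∷ʷ [ d ]ʷ) refl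
             (Unique-∷⁺ (λ { (here q) → adj-≢ ba (sym q) ; (there (here q)) → d∉N₁ (subst (_∈ N₁) q a∈) })
               (Unique-∷⁺ (λ { (here q) → adj-≢ db (sym q) }) (◇ ◂ ◇)))
             (proj₂ (∈N₁ a′∈)) (adj-sym b′a′ ∷ʷ adj-sym d′b′ ∷ʷ adj-sym dd′ ∷ʷ [ d ]ʷ) refl
             (Unique-∷⁺ (λ { (here q) → adj-≢ b′a′ (sym q) ; (there (here q)) → d′∉N₁ (subst (_∈ N₁) q a′∈)
                           ; (there (there (here q))) → d∉N₁ (subst (_∈ N₁) q a′∈) })
               (Unique-∷⁺ (λ { (here q) → adj-≢ d′b′ (sym q) ; (there (here q)) → d∉N₂ (subst (_∈ N₂) q b′∈) })
                 (Unique-∷⁺ (λ { (here q) → adj-≢ dd′ (sym q) }) (◇ ◂ ◇))))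
             (λ { (here q) → here q ; (there (here q)) → there (here q) ; (there (there (here q))) → there (there (here q)) })
             (λ { (here q) → there (there (there (here q))) ; (there (here q)) → there (there (there (there (here q))))
                ; (there (there (here q))) → there (there (there (there (there (here q))))) ; (there (there (there (here q)))) → there (there (here q)) })
             ≤-refl
             (λ { (here refl) → off (proj₁ (∈N₁ a∈)) ; (there (here refl)) → off bV ; (there (there (here refl))) → off dV
                ; (there (there (there (here refl)))) → off (proj₁ (∈N₁ a′∈)) ; (there (there (there (there (here refl))))) → off b′V
                ; (there (there (there (there (there (here refl)))))) → off d′V })
      step₃ ind₁ ind₂ (inj₂ ind₃) = ⊥-elim (no-blue-book N₂ Z uN₂ (Unique-∖ N₃ uV′) N₂⊆Z
          (λ {p} {z} i j ne → adj-not true ne (unred p z i j))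
          big₂ (n₃-arith m n γ e N (length U) (length V′) (length Z) (length N₃) m≡ slack N≡
            (≤-trans (≤-reflexive (sym length-vertices)) (length-∖ U vertices-unique)) (length-∖ N₃ uV′) U≤55
            (≰⇒> λ h → no-blue-book N₃ N₃ uN₃ uN₃ id (λ i j ne → adj-not true ne (ind₃ i j)) (clique-size n (length N₃) h) h)))
        where
        uN₂ = Unique-filterᵇ (touches N₁) uV′
        uN₃ = Unique-filterᵇ (touches N₂) uV′
        Z = V′ ∖ N₃
        N₂⊆Z : N₂ ⊆ Z
        N₂⊆Z i = ∈-∖⁺ N₃ (proj₁ (touch N₁ i)) λ j → let (_ , y , y∈ , xy) = touch N₂ j in red⊥ (ind₂ i y∈) xy
        unred : ∀ p z → p ∈ N₂ → z ∈ Z → adj true p z ≡ false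
        unred p z i j with adj true p z in q
        ... | false = refl
        ... | true  = ⊥-elim (proj₂ (∈-∖⁻ V′ N₃ j) (touching N₂ (proj₁ (∈-∖⁻ V′ N₃ j)) i (adj-sym q)))
        degree′ : ∀ x → n + 1 ≤ red x V′
        degree′ x = n₂-arith m n γ e (red x vertices) (red x V′) (length U) m≡ slack (red-degree x) (#-∖-≤ (adj true x) U vertices-unique) U≤55
        -- Outside `U`, all red neighbours of one vertex of `N₁` lie in `N₂`, which thus inherits
        -- the degree bound.
        big₂ : n + 1 ≤ length N₂
        big₂ = let (a , a∈V′ , va) = #-find (adj true v) V′ (n₁-arith n (red v V′) (degree′ v))
                   a∈ = ∈-filterᵇ⁺ (adj true v) a∈V′ va
               in ≤-trans (degree′ a) (≤-trans (#-mono V′ λ i e → proj₂ (∈-filterᵇ⁻ (touches N₁) V′ (touching N₁ i a∈ (adj-sym e))))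
                    (≤-reflexive (sym (length-filterᵇ (touches N₁) V′))))
      step₂ : (∀ {x y} → x ∈ N₁ → y ∈ N₁ → adj true x y ≡ false) →
              ((∃₂ λ x y → x ∈ N₂ × y ∈ N₂ × E true x y) ⊎ (∀ {x y} → x ∈ N₂ → y ∈ N₂ → adj true x y ≡ false)) → Switch v U
      step₂ ind₁ (inj₂ ind₂) = step₃ ind₁ ind₂ (∃₂⊎∀₂ (adj true) N₃ N₃)
      step₂ ind₁ (inj₁ (b , b′ , b∈ , b′∈ , bb′)) =
        let (bV , a , a∈ , ba) = touch N₁ b∈
            (b′V , a′ , a′∈ , b′a′) = touch N₁ b′∈
            N₁∉N₂ : ∀ {x} → x ∈ N₁ → x ∉ N₂
            N₁∉N₂ i j = let (_ , y , y∈ , xy) = touch N₁ j in red⊥ (ind₁ i y∈) xy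
        in switch 2 (s≤s z≤n) (s≤s (s≤s z≤n)) {new = a ∷ b ∷ a′ ∷ b′ ∷ []}
             (proj₂ (∈N₁ a∈)) (adj-sym ba ∷ʷ [ b ]ʷ) refl (Unique-∷⁺ (λ { (here q) → adj-≢ ba (sym q) }) (◇ ◂ ◇))
             (proj₂ (∈N₁ a′∈)) (adj-sym b′a′ ∷ʷ adj-sym bb′ ∷ʷ [ b ]ʷ) refl
             (Unique-∷⁺ (λ { (here q) → adj-≢ b′a′ (sym q) ; (there (here q)) → N₁∉N₂ a′∈ (subst (_∈ N₂) (sym q) b∈) })
               (Unique-∷⁺ (λ { (here q) → adj-≢ bb′ (sym q) }) (◇ ◂ ◇)))
             (λ { (here q) → here q ; (there (here q)) → there (here q) })
             (λ { (here q) → there (there (here q)) ; (there (here q)) → there (there (there (here q))) ; (there (there (here q))) → there (here q) })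
             (s≤s (s≤s (s≤s (s≤s z≤n))))
             (λ { (here refl) → off (proj₁ (∈N₁ a∈)) ; (there (here refl)) → off bV
                ; (there (there (here refl))) → off (proj₁ (∈N₁ a′∈)) ; (there (there (there (here refl)))) → off b′V })
      step₁ : ((∃₂ λ x y → x ∈ N₁ × y ∈ N₁ × E true x y) ⊎ (∀ {x y} → x ∈ N₁ → y ∈ N₁ → adj true x y ≡ false)) → Switch v U
      step₁ (inj₂ ind₁) = step₂ ind₁ (∃₂⊎∀₂ (adj true) N₂ N₂)
      step₁ (inj₁ (a , a′ , a∈ , a′∈ , aa′)) =
        switch 1 ≤-refl (s≤s z≤n) {new = a ∷ a′ ∷ []} (proj₂ (∈N₁ a∈)) [ a ]ʷ refl (◇ ◂ ◇)
          (proj₂ (∈N₁ a′∈)) (adj-sym aa′ ∷ʷ [ a ]ʷ) refl (Unique-∷⁺ (λ { (here q) → adj-≢ aa′ (sym q) }) (◇ ◂ ◇))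
          (λ { (here q) → here q }) (λ { (here q) → there (here q) ; (there (here q)) → here q })
          (s≤s (s≤s z≤n)) (λ { (here refl) → off (proj₁ (∈N₁ a∈)) ; (there (here refl)) → off (proj₁ (∈N₁ a′∈)) })

    -- Gadgets and nearly separated graphs

    -- Each switch adds at most 6 vertices to the body and between 1 and 3 to the base. For w = 9
    -- this means ten consecutive lengths, base ≤ 27 and at most 55 vertices.
    record Gadget (x : Vertex) (w : ℕ) : Set where
      constructor gadget
      field
        {y}    : Vertex
        base   : ℕ
        w≤base : w ≤ base
        base≤  : base ≤ 3 * w
        {body} : List Vertex
        size   : length body ≤ 1 + 6 * w
        x∈     : x ∈ body
        y∈     : y ∈ body
        path   : ∀ s → s ≤ w → ∃ λ L → Walk (E true) x y L × Unique L × length L ≡ suc (base + s) × L ⊆ body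

    opaque
      body-arith : (b n l w : ℕ) → l ≡ b + n → b ≤ 1 + 6 * w → n ≤ 6 → l ≤ 1 + 6 * (1 + w)
      body-arith b n l w h1 h2 h3 =
          linear 1 0 ((≤-reflexive h1) ⊕ h2 ⊕ h3) (solve (b ∷ n ∷ l ∷ w ∷ []))

      body-fits : (b w : ℕ) → b ≤ 1 + 6 * w → w ≤ 8 → b ≤ 55
      body-fits b w h1 h2 = linear 1 6 (h1 ⊕ 6 ⊗ h2) (solve (b ∷ w ∷ []))

      base-upper : (b r w : ℕ) → b ≤ 3 * w → r ≤ 3 → b + r ≤ 3 * (1 + w)
      base-upper b r w h1 h2 = linear 1 0 (h1 ⊕ h2) (solve (b ∷ r ∷ w ∷ []))

    -- A switch is attached at y. Its short arm shifts all available lengths by ρ, and its long arm,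
    -- after the longest path, supplies one more.
    extend-gadget : ∀ {x w} → w ≤ 8 → Gadget x w → Gadget x (suc w)
    extend-gadget {x} {w} w≤8 (gadget {y} base w≤base base≤ {body} size x∈ y∈ path)
      with find-switch y body y∈ (body-fits (length body) w size w≤8)
    ... | switch {y′} ρ 1≤ρ ρ≤3 {short} {long} {new} s₁ w₁ l₁ u₁ s₂ w₂ l₂ u₂ short⊆ long⊆ new-size new-fresh =
      gadget (base + ρ) (≤-trans (≤-reflexive (+-comm 1 w)) (+-mono-≤ w≤base 1≤ρ)) (base-upper base ρ w base≤ ρ≤3)
        {body ++ new} (body-arith (length body) (length new) (length (body ++ new)) w (length-++ body) size new-size)
        (∈-++⁺ˡ x∈) (∈-++⁺ʳ body (short⊆ (end-∈ w₁)))
        λ s h → paths s (s ≤? w) h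
      where
      shorter : ∀ b s r → suc (b + s) + r ≡ suc (b + r + s)
      shorter b s r = solve (b ∷ s ∷ r ∷ [])
      longer : ∀ b w r → suc (b + w) + suc r ≡ suc (b + r + suc w)
      longer b w r = solve (b ∷ w ∷ r ∷ [])
      attach : ∀ {s a M} → s ≤ w → E true y a → Walk (E true) a y′ M → Unique M → M ⊆ new → ∀ {l} → suc (base + s) + length M ≡ l →
               ∃ λ L → Walk (E true) x y′ L × Unique L × length L ≡ l × L ⊆ body ++ new
      attach {s} {M = M} h e wM uM M⊆ len = let (L , wL , uL , lL , L⊆) = path s h in
        L ++ M , join wL e wM , Unique-++⁺ uL uM (λ i j → new-fresh (M⊆ j) (L⊆ i)) ,
        trans (length-++ L) (trans (cong (_+ length M) lL) len) , ⊆-++ {L} (λ i → ∈-++⁺ˡ (L⊆ i)) (λ i → ∈-++⁺ʳ body (M⊆ i))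
      paths : ∀ s → Dec (s ≤ w) → s ≤ suc w → ∃ λ L → Walk (E true) x y′ L × Unique L × length L ≡ suc (base + ρ + s) × L ⊆ body ++ new
      paths s (yes h) _ = attach h s₁ w₁ u₁ short⊆ (trans (cong (suc (base + s) +_) l₁) (shorter base s ρ))
      paths s (no ¬h) h = subst (λ t → ∃ λ L → Walk (E true) x y′ L × Unique L × length L ≡ suc (base + ρ + t) × L ⊆ body ++ new)
        (≤-antisym (≰⇒> ¬h) h) (attach ≤-refl s₂ w₂ u₂ long⊆ (trans (cong (suc (base + w) +_) l₂) (longer base w ρ)))

    build-gadget : ∀ w → w ≤ 9 → Gadget some-vertex w
    build-gadget zero _ = gadget 0 z≤n z≤n {[ some-vertex ]} ≤-refl (here refl) (here refl)
      λ { zero _ → [ some-vertex ] , [ some-vertex ]ʷ , (◇ ◂ ◇) , refl , id ; (suc s) () }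
    build-gadget (suc w) (s≤s h) = extend-gadget h (build-gadget w (≤-trans h (n≤1+n 8)))

    few-in : List Vertex → Vertex → Bool
    few-in A v = does (blue v A <? n)

    #-take : ∀ (p : Vertex → Bool) k xs → # p (take k xs) ≤ # p xs
    #-take p zero xs = z≤n
    #-take p (suc k) [] = z≤n
    #-take p (suc k) (x ∷ xs) = +-monoʳ-≤ (ι (p x)) (#-take p k xs)

    opaque
      dense-arith : (b b₁ b₂ n m a r k : ℕ) → b ≡ b₁ + b₂ → b₁ < n → b₂ ≤ r → r ≡ k → k + a ≡ 2 * m →
          n + 2 * m ≤ m + a → b < m
      dense-arith b b₁ b₂ n m a r k h1 h2 h3 h4 h5 h6 =
          linear 1 0 ((≤-reflexive h1) ⊕ h2 ⊕ h3 ⊕ (≤-reflexive h4) ⊕ (≤-reflexive h5) ⊕ h6) (solve (b ∷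
          b₁ ∷ b₂ ∷ n ∷ m ∷ a ∷ r ∷ k ∷ []))

      dense-rest : (u a r k m : ℕ) → 2 * m ≤ u → u ≤ a + r → k + a ≡ 2 * m → k ≤ r
      dense-rest u a r k m h1 h2 h3 =
          linear 1 0 (h1 ⊕ h2 ⊕ (≤-reflexive h3)) (solve (u ∷ a ∷ r ∷ k ∷ m ∷ []))

    -- At most m - n vertices of `A′` have to be added to `A` to reach 2m. Blue degrees below n in
    -- `A` then stay below m, as `dirac` demands.
    dense-block : ∀ A A′ → Unique A → Unique A′ → A ⊆ A′ → (∀ {v} → v ∈ A′ → blue v A < n) →
                  n + 2 * m ≤ m + length A → ¬ 2 * m ≤ length A′
    dense-block A A′ uA uA′ A⊆ few near big = go (2 * m ≤? length A)
      where
      1≤m = ≤-trans (s≤s z≤n) (≤-trans 2≤n n≤m)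
      go : Dec (2 * m ≤ length A) → ⊥
      go (yes h) = no-red-cycle (dirac true m {take (2 * m) A} (Unique-take (2 * m) uA) 1≤m (length-take-≤ (2 * m) A h)
        λ {v} i → ≤-trans (s≤s (#-take (adj false v) (2 * m) A)) (≤-trans (few (A⊆ (∈-take (2 * m) i))) n≤m))
      go (no ¬h) = no-red-cycle (dirac true m {U} uU 1≤m lU fewU)
        where
        k = 2 * m ∸ length A
        k≡ : k + length A ≡ 2 * m
        k≡ = m∸n+n≡m (<⇒≤ (≰⇒> ¬h))
        C = take k (A′ ∖ A)
        U = A ++ C
        lC : length C ≡ k
        lC = length-take-≤ k (A′ ∖ A) (dense-rest (length A′) (length A) (length (A′ ∖ A)) k m big (length-∖ A uA′) k≡)
        lU : length U ≡ 2 * m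
        lU = trans (length-++ A) (trans (cong (length A +_) lC) (trans (+-comm (length A) k) k≡))
        off : ∀ {v} → v ∈ C → v ∈ A′ × v ∉ A
        off i = ∈-∖⁻ A′ A (∈-take k i)
        uU = Unique-++⁺ uA (Unique-take k (Unique-∖ A uA′)) λ i j → proj₂ (off j) i
        fewU : ∀ {v} → v ∈ U → blue v U < m
        fewU {v} i = dense-arith (blue v U) (blue v A) (blue v C) n m (length A) (length C) k (#-++ (adj false v) A C)
          (few (⊆-++ {A} A⊆ (λ j → proj₁ (off j)) i)) (#≤length (adj false v) C) lC k≡ near

    -- With n blue neighbours on both sides, h would be the hub over a blue K_{n,n}. So `few-in`
    -- holds for every vertex with respect to X or to Y.
    hub-bound : ∀ X Y h → Unique X → Unique Y → (∀ {x y} → x ∈ X → y ∈ Y → E false x y) → n ≤ blue h X → ¬ n ≤ blue h Y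
    hub-bound X Y h uX uY full hX hY = no-blue-biclique h (filterᵇ (adj false h) X) (filterᵇ (adj false h) Y)
      (≤-trans hX (≤-reflexive (sym (length-filterᵇ (adj false h) X)))) (≤-trans hY (≤-reflexive (sym (length-filterᵇ (adj false h) Y))))
      (Unique-filterᵇ (adj false h) uX) (Unique-filterᵇ (adj false h) uY)
      (λ i j → full (proj₁ (∈-filterᵇ⁻ (adj false h) X i)) (proj₁ (∈-filterᵇ⁻ (adj false h) Y j)))
      (λ i → proj₂ (∈-filterᵇ⁻ (adj false h) X i)) (λ i → proj₂ (∈-filterᵇ⁻ (adj false h) Y i))

    few-beside : ∀ X Y {x} → Unique X → Unique Y → (∀ {x y} → x ∈ X → y ∈ Y → E false x y) → n ≤ length Y → x ∈ X → blue x X < n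
    few-beside X Y {x} uX uY full nY i = ≰⇒> λ h → hub-bound X Y x uX uY full h
      (≤-trans nY (≤-reflexive (sym (#-true (adj false x) Y λ j → full i j))))

    flip-full : ∀ {X Y} → (∀ {x y} → x ∈ X → y ∈ Y → E false x y) → (∀ {y x} → y ∈ Y → x ∈ X → E false y x)
    flip-full full i j = adj-sym (full j i)

    opaque
      halves-arith : (N p q r m e : ℕ) → p + r ≡ N → r ≤ q → 1 + N ≡ 4 * m + e → p < 2 * m → q < 2 * m →
          ⊥
      halves-arith N p q r m e h1 h2 h3 h4 h5 =
          1≰0 (linear 1 e ((≤-reflexive (sym h1)) ⊕ h2 ⊕ (≤-reflexive (sym h3)) ⊕ h4 ⊕ h5) (solve (N ∷ p
          ∷ q ∷ r ∷ m ∷ e ∷ [])))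

      near-arith : (m n γ a : ℕ) → m ≡ γ + n → 209 ≤ γ → 2 * m ≤ a + 60 → n + 2 * m ≤ m + a
      near-arith m n γ a h1 h2 h3 =
          linear 1 149 ((≤-reflexive (sym h1)) ⊕ h2 ⊕ h3) (solve (m ∷ n ∷ γ ∷ a ∷ []))

      n≤-arith : (m n γ a : ℕ) → m ≡ γ + n → 209 ≤ γ → 2 * m ≤ a + 60 → n ≤ a
      n≤-arith m n γ a h1 h2 h3 =
          linear 1 (m + 149) ((≤-reflexive (sym h1)) ⊕ h2 ⊕ h3) (solve (m ∷ n ∷ γ ∷ a ∷ []))

    -- By hub-bound every vertex has few blue neighbours in X or in Y, so one of the two
    -- sides grows to 2m vertices.
    no-blue-cut : ∀ X Y → 209 ≤ γ → Unique X → Unique Y → (∀ {x y} → x ∈ X → y ∈ Y → E false x y) →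
                  2 * m ≤ length X + 60 → 2 * m ≤ length Y + 60 → ⊥
    no-blue-cut X Y big uX uY full sX sY = halves-arith N (# (few-in X) vertices) (# (few-in Y) vertices) (# (not ∘ few-in X) vertices) m e
      (trans (#-not (few-in X) vertices) length-vertices) (#-mono vertices λ {v} _ q → other v q) N≡
      (side X Y uX uY full sX nY) (side Y X uY uX (flip-full full) sY nX)
      where
      nX = n≤-arith m n γ (length X) m≡ big sX
      nY = n≤-arith m n γ (length Y) m≡ big sY
      other : ∀ v → not (few-in X v) ≡ true → few-in Y v ≡ true
      other v q = yes-does (blue v Y <? n) (≰⇒> (hub-bound X Y v uX uY full (≮⇒≥ (does-no (blue v X <? n) (not-true q)))))
      side : ∀ X Y → Unique X → Unique Y → (∀ {x y} → x ∈ X → y ∈ Y → E false x y) → 2 * m ≤ length X + 60 → n ≤ length Y →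
             # (few-in X) vertices < 2 * m
      side X Y uX uY full sX nY = ≰⇒> λ h → dense-block X (filterᵇ (few-in X) vertices) uX (Unique-filterᵇ (few-in X) vertices-unique)
        (λ {v} i → ∈-filterᵇ⁺ (few-in X) (∈-vertices v) (yes-does (blue v X <? n) (few-beside X Y uX uY full nY i)))
        (λ {v} i → does-yes (blue v X <? n) (proj₂ (∈-filterᵇ⁻ (few-in X) vertices i)))
        (near-arith m n γ (length X) m≡ big sX)
        (≤-trans h (≤-reflexive (sym (length-filterᵇ (few-in X) vertices))))

    opaque
      large-arith : (m n γ a : ℕ) → m ≡ γ + n → 2 * m ≤ a → n + 2 * m ≤ m + a
      large-arith m n γ a h1 h2 =
          linear 1 γ ((≤-reflexive (sym h1)) ⊕ h2) (solve (m ∷ n ∷ γ ∷ a ∷ []))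

    -- A vertex of A is blue to all of T and therefore, by `few-beside`, has fewer than n blue
    -- neighbours in A; Dirac's theorem applies inside A.
    sep-large : ∀ T A → Unique T → Unique A → (∀ {t a} → t ∈ T → a ∈ A → E false t a) → n ≤ length T → ¬ 2 * m ≤ length A
    sep-large T A uT uA full nT big = dense-block A A uA uA id
      (few-beside A T uA uT (flip-full full) nT) (large-arith m n γ (length A) m≡ big) big

    last*-snoc : ∀ {b} x xs z → last* (block {b} [ x ]ʷ) (singles b (xs ++ [ z ])) ≡ z
    last*-snoc x []       z = refl
    last*-snoc x (y ∷ ys) z = last*-snoc y ys z

    opaque
      link-arith : (m γ e N du dv ru rv p cm w a : ℕ) → m + γ + e ≤ du + 120 → m + γ + e ≤ dv + 120 →
          du ≤ 29 + ru → dv ≤ 29 + rv → ru + rv ≤ p + cm → p ≤ w → a + w ≤ N → 2 * m ≤ a + 55 →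
          1 + N ≡ 4 * m + e → 209 ≤ γ → 26 ≤ cm
      link-arith m γ e N du dv ru rv p cm w a h1 h2 h3 h4 h5 h6 h7 h8 h9 h10 =
          linear 1 (e + 40) (h1 ⊕ h2 ⊕ h3 ⊕ h4 ⊕ h5 ⊕ h6 ⊕ h7 ⊕ h8 ⊕ (≤-reflexive h9) ⊕ 2 ⊗ h10) (solve
          (m ∷ γ ∷ e ∷ N ∷ du ∷ dv ∷ ru ∷ rv ∷ p ∷ cm ∷ w ∷ a ∷ []))

      red-in-arith : (n t r b : ℕ) → n + 30 ≤ t → t ≤ 1 + r + b → b < n → 3 ≤ r
      red-in-arith n t r b h1 h2 h3 = linear 1 27 (h1 ⊕ h2 ⊕ h3) (solve (n ∷ t ∷ r ∷ b ∷ []))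

      mid-arith : (n t k : ℕ) → n + 30 ≤ t → t ≤ 2 + k → 25 ≤ k
      mid-arith n t k h1 h2 = linear 1 (n + 3) (h1 ⊕ h2) (solve (n ∷ t ∷ k ∷ []))

      A-arith : (m a r q : ℕ) → 2 * m ≤ a + 55 → a ≤ 2 + r → q + 57 ≡ 2 * m → q ≤ r
      A-arith m a r q h1 h2 h3 =
          linear 1 0 (h1 ⊕ h2 ⊕ (≤-reflexive h3)) (solve (m ∷ a ∷ r ∷ q ∷ []))

      big-arith : (m n γ : ℕ) → m ≡ γ + n → 209 ≤ γ → 57 ≤ 2 * m
      big-arith m n γ h1 h2 =
          linear 1 (m + n + 152) ((≤-reflexive (sym h1)) ⊕ h2) (solve (m ∷ n ∷ γ ∷ []))

      ham-arith : (m n γ q : ℕ) → m ≡ γ + n → 209 ≤ γ → q + 57 ≡ 2 * m → 2 * n < 2 + q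
      ham-arith m n γ q h1 h2 h3 =
          linear 1 (γ + 153) (2 ⊗ (≤-reflexive (sym h1)) ⊕ h2 ⊕ (≤-reflexive (sym h3))) (solve (m ∷ n ∷
          γ ∷ q ∷ []))

      cut-arith : (m a a′ : ℕ) → 2 * m ≤ a + 55 → a ≤ 1 + a′ → 2 * m ≤ a′ + 60
      cut-arith m a a′ h1 h2 = linear 1 4 (h1 ⊕ h2) (solve (m ∷ a ∷ a′ ∷ []))

      cut-arith₂ : (m e N a b b′ : ℕ) → 1 + N ≡ 4 * m + e → N ≤ a + b → a < 2 * m → b ≤ 1 + b′ →
          2 * m ≤ b′ + 60
      cut-arith₂ m e N a b b′ h1 h2 h3 h4 =
          linear 1 (e + 59) ((≤-reflexive (sym h1)) ⊕ h2 ⊕ h3 ⊕ h4) (solve (m ∷ e ∷ N ∷ a ∷ b ∷ b′ ∷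
          []))

    -- A is a block of almost 2m vertices. Either enough further vertices attach to it, or two
    -- disjoint red edges leave it and a Hamiltonian path of part of A closes up through T, or a
    -- single vertex meets all red edges leaving it.
    sep-near : ∀ T A → 209 ≤ γ → Unique T → Unique A → (∀ {t a} → t ∈ T → a ∈ A → E false t a) →
               n + 30 ≤ length T → ¬ 2 * m ≤ length A + 55
    sep-near T A big uT uA full sT sA = go (2 * m ≤? length A′)
      where
      A′ = filterᵇ (few-in A) vertices
      B  = vertices ∖ A′
      uA′ = Unique-filterᵇ (few-in A) vertices-unique
      nT = ≤-trans (m≤m+n n 30) sT
      A⊆A′ : A ⊆ A′
      A⊆A′ {v} i = ∈-filterᵇ⁺ (few-in A) (∈-vertices v) (yes-does (blue v A <? n) (few-beside A T uA uT (flip-full full) nT i))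
      fewA : ∀ {v} → v ∈ A′ → blue v A < n
      fewA {v} i = does-yes (blue v A <? n) (proj₂ (∈-filterᵇ⁻ (few-in A) vertices i))
      B-off : ∀ {v} → v ∈ B → v ∉ A
      B-off i j = proj₂ (∈-∖⁻ vertices A′ i) (A⊆A′ j)
      T-off : ∀ {v} → v ∈ T → v ∉ A
      T-off i j = adj-≢ (full i j) refl
      B-many : ∀ {v} → v ∈ B → n ≤ blue v A
      B-many {v} i = ≮⇒≥ λ h → proj₂ (∈-∖⁻ vertices A′ i) (∈-filterᵇ⁺ (few-in A) (∈-vertices v) (yes-does (blue v A <? n) h))
      -- A vertex of `B` has n blue neighbours in A, hence fewer than n in T, so most of the 30
      -- extra vertices of T guarantee red neighbours there.
      linked : ∀ {v} → v ∈ B → 3 ≤ red v T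
      linked {v} i = red-in-arith n (length T) (red v T) (blue v T) sT (degree-sum true v uT)
        (≰⇒> (hub-bound A T v uA uT (flip-full full) (B-many i)))
      W = vertices ∖ A
      uW = Unique-∖ A vertices-unique

      through : Disjoint₂ A B (adj true) → ⊥
      through D = let (t₁ , t₁∈ , f₁ , _)  = fresh (adj true u′) [] uT (≤-trans (s≤s z≤n) (linked u′∈))
                      (t₂ , t₂∈ , f₂ , t₂∉) = fresh (adj true u) [ t₁ ] uT (≤-trans (s≤s (s≤s z≤n)) (linked u∈))
                  in assemble D t₁ t₂ t₁∈ t₂∈ f₁ f₂ (λ q → t₂∉ (here (sym q)))
        where
        open Disjoint₂ D
        assemble : (D : Disjoint₂ A B (adj true)) → ∀ t₁ t₂ → t₁ ∈ T → t₂ ∈ T →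
                   E true (Disjoint₂.u′ D) t₁ → E true (Disjoint₂.u D) t₂ → t₁ ≢ t₂ → ⊥
        assemble (disjoint₂ {a₁} {a₂} {b₁} {b₂} a₁∈ b₁∈ a₂∈ b₂∈ a₁≢a₂ b₁≢b₂ e₁ e₂) t₁ t₂ t₁∈ t₂∈ f₁ f₂ t₁≢t₂ =
          finish (chain (block {true} [ t₁ ]ʷ) Bs pool [] (Unique-∖ X uW) (subst Unique (sym eqm) uts)
              λ {u} {v} i j _ → ≤-trans (≤-reflexive lBs) (enough (toT i) (toT j)))
            (hamiltonian-path true n uA₁ (here refl) (there (here refl)) a₁≢a₂
              (≤-trans (ham-arith m n γ q m≡ big q≡) (≤-reflexive (sym lA₁)))
              λ {v} i → ≤-trans (s≤s (#-⊆ (adj false v) uA₁ A₁⊆)) (fewA (A⊆A′ (A₁⊆ i))))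
          where
          rest = T ∖ (t₁ ∷ t₂ ∷ [])
          -- 25 inner vertices, t₁ and t₂ need 26 links; with b₁ and b₂ the detour has 27 + 26 + 2 =
          -- 55 vertices and complements the 2m - 55 vertices of `A₁`.
          mid = take 25 rest
          off : ∀ {v} → v ∈ mid → v ∈ T × v ∉ t₁ ∷ t₂ ∷ []
          off i = ∈-∖⁻ T (t₁ ∷ t₂ ∷ []) (∈-take 25 i)
          lmid : length mid ≡ 25
          lmid = length-take-≤ 25 rest (mid-arith n (length T) (length rest) sT (length-∖ (t₁ ∷ t₂ ∷ []) uT))
          ts = t₁ ∷ mid ++ [ t₂ ]
          uts : Unique ts
          uts = Unique-∷⁺ (λ i → case-⊎ (λ j → proj₂ (off j) (here refl)) (λ { (here q) → t₁≢t₂ q }) (∈-++⁻ mid i))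
                  (Unique-++⁺ (Unique-take 25 (Unique-∖ (t₁ ∷ t₂ ∷ []) uT)) (◇ ◂ ◇) λ { i (here refl) → proj₂ (off i) (there (here refl)) })
          ts⊆ : ts ⊆ T
          ts⊆ (here refl) = t₁∈
          ts⊆ (there i) = case-⊎ (λ j → proj₁ (off j)) (λ { (here refl) → t₂∈ }) (∈-++⁻ mid i)
          lts : length ts ≡ 27
          lts = cong suc (trans (length-++ mid) (cong (_+ 1) lmid))
          X = b₁ ∷ b₂ ∷ ts
          pool = W ∖ X
          Bs = singles true (mid ++ [ t₂ ])
          eqm : members* (block {true} [ t₁ ]ʷ ∷ Bs) ≡ ts
          eqm = members*-singles true ts
          lBs : length Bs ≡ 26
          lBs = trans (length-singles true (mid ++ [ t₂ ])) (suc-injective lts)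
          toT : ∀ {v} → v ∈ members* (block {true} [ t₁ ]ʷ ∷ Bs) → v ∈ T
          toT {v} i = ts⊆ (subst (v ∈_) eqm i)
          -- Vertices of T have no red neighbours in A, so only the 29 vertices of `X` are lost.
          in-pool : ∀ {v} → v ∈ T → red v vertices ≤ 29 + red v pool
          in-pool {v} i = ≤-trans (#-∖-off (adj true v) A λ {x} _ e j → no-red (adj-excl false (full i j)) e)
            (≤-trans (#-∖-≤ (adj true v) X uW) (≤-reflexive (cong (_+ red v pool) (cong (suc ∘ suc) lts))))
            where
            no-red : ∀ {x} → adj true v x ≡ false → adj true v x ≡ true → ⊥
            no-red p q with trans (sym p) q
            ... | ()
          -- Both red neighbourhoods lie outside A, among at most 2m + e + 54 vertices, so they
          -- share at least 2γ + e - 352; with γ ≥ 209 this exceeds 26.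
          enough : ∀ {u v} → u ∈ T → v ∈ T → 26 ≤ # (common true u v) pool
          enough {u} {v} i j = link-arith m γ e N (red u vertices) (red v vertices) (red u pool) (red v pool) (length pool)
            (# (common true u v) pool) (length W) (length A) (red-degree u) (red-degree v) (in-pool i) (in-pool j)
            (#-∧ (adj true u) (adj true v) pool) (length-⊆ (Unique-∖ X uW) λ k → proj₁ (∈-∖⁻ W X k))
            (≤-trans (length-∖-⊆ A vertices-unique uA λ {v} _ → ∈-vertices v) (≤-reflexive length-vertices)) sA N≡ big
          q = 2 * m ∸ 57
          q≡ : q + 57 ≡ 2 * m
          q≡ = m∸n+n≡m (big-arith m n γ m≡ big)
          A₀ = A ∖ (a₁ ∷ a₂ ∷ [])
          A₁ = a₁ ∷ a₂ ∷ take q A₀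
          offA : ∀ {v} → v ∈ take q A₀ → v ∈ A × v ∉ a₁ ∷ a₂ ∷ []
          offA i = ∈-∖⁻ A (a₁ ∷ a₂ ∷ []) (∈-take q i)
          lA₁ : length A₁ ≡ 2 + q
          lA₁ = cong (suc ∘ suc) (length-take-≤ q A₀ (A-arith m (length A) (length A₀) q sA (length-∖ (a₁ ∷ a₂ ∷ []) uA) q≡))
          uA₁ : Unique A₁
          uA₁ = Unique-∷⁺ (λ { (here q) → a₁≢a₂ q ; (there i) → proj₂ (offA i) (here refl) })
                  (Unique-∷⁺ (λ i → proj₂ (offA i) (there (here refl))) (Unique-take q (Unique-∖ (a₁ ∷ a₂ ∷ []) uA)))
          A₁⊆ : A₁ ⊆ A
          A₁⊆ (here refl) = a₁∈
          A₁⊆ (there (here refl)) = a₂∈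
          A₁⊆ (there (there i)) = proj₁ (offA i)
          b∉T : ∀ {a b} → a ∈ A → E true a b → b ∉ T
          b∉T {a} {b} i ab j with trans (sym (adj-excl true ab)) (adj-sym (full j i))
          ... | ()
          finish : Chain true (block [ t₁ ]ʷ) Bs pool [] → (∃ λ L → Walk (E true) a₁ a₂ L × L ↭ A₁) → ⊥
          finish (chained {verts} {links} walked permuted links-length links-unique links-⊆ links-fresh) (L , wL , pL) =
            no-red-cycle (ring {S = vertices} (join wL e₂ wP) (adj-sym e₁) unique size (λ {v} _ → ∈-vertices v))
            where
            pool-off : ∀ {v} → v ∈ links → v ∈ W × v ∉ X
            pool-off i = ∈-∖⁻ W X (links-⊆ i)
            perm : verts ↭ ts ++ links
            perm = ↭-trans permuted (↭-reflexive (cong (_++ links) eqm))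
            P = b₂ ∷ verts ++ [ b₁ ]
            wP : Walk (E true) b₂ b₁ P
            wP = f₁ ∷ʷ join (subst (λ z → Walk (E true) t₁ z verts) (last*-snoc t₁ mid t₂) walked) (adj-sym f₂) [ b₁ ]ʷ
            b∉verts : ∀ {a b} → a ∈ A → E true a b → b ∈ X → b ∉ verts
            b∉verts i ab x j = case-⊎ (λ k → b∉T i ab (ts⊆ k)) (λ k → proj₂ (pool-off k) x) (∈-++⁻ ts (∈-resp-↭ perm j))
            uverts : Unique verts
            uverts = Unique-↭ (↭-sym perm) (Unique-++⁺ uts links-unique λ i j → proj₂ (pool-off j) (there (there i)))
            uP : Unique P
            uP = Unique-∷⁺ (λ i → case-⊎ (b∉verts a₂∈ e₂ (there (here refl))) (λ { (here q) → b₁≢b₂ (sym q) }) (∈-++⁻ verts i))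
                   (Unique-++⁺ uverts (◇ ◂ ◇) λ { i (here refl) → b∉verts a₁∈ e₁ (here refl) i })
            P-off : ∀ {v} → v ∈ P → v ∉ A
            P-off (here refl) = B-off b₂∈
            P-off (there i) = case-⊎
              (λ j → case-⊎ (λ k → T-off (ts⊆ k)) (λ k → proj₂ (∈-∖⁻ vertices A (proj₁ (pool-off k)))) (∈-++⁻ ts (∈-resp-↭ perm j)))
              (λ { (here refl) → B-off b₁∈ }) (∈-++⁻ verts i)
            lP : length P ≡ 55
            lP = cong suc (trans (length-++ verts) (cong (_+ 1) (trans (↭-length perm) (trans (length-++ ts) (cong₂ _+_ lts (trans links-length lBs))))))
            unique : Unique (L ++ P)
            unique = Unique-++⁺ (Unique-↭ (↭-sym pL) uA₁) uP λ i j → P-off j (A₁⊆ (∈-resp-↭ pL i))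
            size : length (L ++ P) ≡ 2 * m
            size = trans (length-++ L) (trans (cong₂ _+_ (trans (↭-length pL) lA₁) lP) (trans (shift57 q) q≡))
              where
              shift57 : ∀ q → 2 + q + 55 ≡ q + 57
              shift57 q = solve (q ∷ [])

      go : Dec (2 * m ≤ length A′) → ⊥
      go (yes h) = dense-block A A′ uA uA′ A⊆A′ fewA (near-arith m n γ (length A) m≡ big (≤-trans sA (+-monoʳ-≤ (length A) (m≤m+n 55 5)))) h
      go (no ¬h) = case-⊎ through
        (λ { (star z none) → no-blue-cut (A ∖ [ z ]) (B ∖ [ z ]) big (Unique-∖ [ z ] uA) (Unique-∖ [ z ] (Unique-∖ A′ vertices-unique))
          (λ {x} {y} i j → let (x∈ , x∉) = ∈-∖⁻ A [ z ] i ; (y∈ , y∉) = ∈-∖⁻ B [ z ] j in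
            adj-not true (λ q → B-off y∈ (subst (_∈ A) q x∈)) (none x∈ y∈ (x∉ ∘ here) (y∉ ∘ here)))
          (cut-arith m (length A) (length (A ∖ [ z ])) sA (length-∖ [ z ] uA))
          (cut-arith₂ m e N (length A′) (length B) (length (B ∖ [ z ])) N≡ (≤-trans (≤-reflexive (sym length-vertices)) (length-∖ A′ vertices-unique))
            (≰⇒> ¬h) (length-∖ [ z ] (Unique-∖ A′ vertices-unique))) })
        (disjoint⊎star A B (adj true) some-vertex)

    -- The two regimes: either N exceeds 4m by enough, or m exceeds n by enough.
    separated : ∀ T A → Unique T → Unique A → (∀ {t a} → t ∈ T → a ∈ A → E false t a) → n + 30 ≤ length T →
                2 * m ≤ length A ⊎ (209 ≤ γ × 2 * m ≤ length A + 55) → ⊥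
    separated T A uT uA full sT (inj₁ h) = sep-large T A uT uA full (≤-trans (m≤m+n n 30) sT) h
    separated T A uT uA full sT (inj₂ (big , h)) = sep-near T A big uT uA full sT h

    -- Long paths through a gadget

    module LongPaths (I : List Vertex) (uI : Unique I) (I≤55 : length I ≤ 55) where

      record LongPath (x y : Vertex) : Set where
        constructor longPath
        field
          {verts} : List Vertex
          walk    : Walk (E true) x y verts
          unique  : Unique verts
          avoids  : ∀ {v} → v ∈ verts → v ∉ I
          long    : 2 * m ≤ length verts

      reverse-long : ∀ {x y} → LongPath x y → LongPath y x
      reverse-long (longPath {L} w u a l) = longPath (reverseʷ adj-sym w) (Unique-↭ (↭-sym (↭-reverse L)) u)
        (λ i → a (∈-resp-↭ (↭-reverse L) i)) (≤-trans l (≤-reflexive (sym (length-reverse L))))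

      -- Two disjoint paths α … x and y … β; the pair x y stands for the gadget joining them.
      record Tails (x y : Vertex) : Set where
        constructor tails
        field
          {α β} : Vertex
          {A B} : List Vertex
          walkA : Walk (E true) α x A
          walkB : Walk (E true) y β B
          unique : Unique (A ++ B)
          avoids : ∀ {v} → v ∈ A ++ B → v ∉ I
      open Tails

      bag : ∀ {x y} → Tails x y → List Vertex
      bag S = A S ++ B S

      mirror : ∀ {x y} → Tails x y → Tails y x
      mirror S = tails (reverseʷ adj-sym (walkB S)) (reverseʷ adj-sym (walkA S))
        (Unique-↭ (↭-sym perm) (unique S)) (λ i → avoids S (∈-resp-↭ perm i))
        where
        perm : reverse (B S) ++ reverse (A S) ↭ A S ++ B S
        perm = ↭-trans (++⁺ (↭-reverse (B S)) (↭-reverse (A S))) (++-comm (B S) (A S))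

      mirror-bag : ∀ {x y} (S : Tails x y) → length (bag (mirror S)) ≡ length (bag S)
      mirror-bag S = ↭-length (↭-trans (++⁺ (↭-reverse (B S)) (↭-reverse (A S))) (++-comm (B S) (A S)))

      Progress : Vertex → Vertex → ℕ → Set
      Progress x y s = LongPath x y ⊎ ∃ λ (S : Tails x y) → s < length (bag S)

      mirror-progress : ∀ {x y s} → Progress x y s → Progress y x s
      mirror-progress (inj₁ P) = inj₁ (reverse-long P)
      mirror-progress (inj₂ (S , h)) = inj₂ (mirror S , ≤-trans h (≤-reflexive (sym (mirror-bag S))))

      advance : ∀ {x y} (S : Tails x y) {z} → E true (β S) z → z ∉ bag S → z ∉ I → Progress x y (length (bag S))
      advance (tails {A = A} {B} wA wB u av) {z} e z∉ zI = inj₂ (tails wA (join wB e [ z ]ʷ)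
        (subst Unique eq (Unique-++⁺ u (◇ ◂ ◇) λ { i (here refl) → z∉ i }))
        (λ {v} i → case-⊎ av (λ { (here refl) → zI }) (∈-++⁻ (A ++ B) (subst (v ∈_) (sym eq) i))) ,
        ≤-reflexive (trans (+-comm 1 _) (trans (sym (length-++ (A ++ B))) (cong length eq))))
        where
        eq : (A ++ B) ++ [ z ] ≡ A ++ (B ++ [ z ])
        eq = ++-assoc A B [ z ]

      opaque
        close-size : (t b f g : ℕ) → t ≤ 1 + (g + b) → t ≤ b + (1 + (f + g))
        close-size t b f g h1 = linear 1 f h1 (solve (t ∷ b ∷ f ∷ g ∷ []))

      -- The path runs y ... β w ... x. Besides w it contains all of `B` and `G`, which makes it
      -- long enough.
      close-up : ∀ {x y} (S : Tails x y) {F G w} → A S ≡ F ++ G → w ∈ F → E true (β S) w →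
                 2 * m ≤ 1 + (length G + length (B S)) → LongPath x y
      close-up (tails {A = A} {B} wA wB u av) {F} {G} {w} refl w∈ e big with ∈-∃++ w∈
        where open import Data.List.Membership.Propositional.Properties using (∈-∃++)
      ... | F₁ , F₂ , refl = reverse-long (longPath (join wB e (drop-walk F₁ (subst (Walk (E true) _ _) (++-assoc F₁ (w ∷ F₂) G) wA)))
          (proj₁ (proj₂ (Unique-++⁻ F₁ (Unique-↭ perm u))))
          (λ i → av (∈-resp-↭ (↭-sym perm) (∈-++⁺ʳ F₁ i)))
          (≤-trans (close-size (2 * m) (length B) (length F₂) (length G) big)
            (≤-reflexive (sym (trans (length-++ B) (cong (λ t → length B + suc t) (length-++ F₂)))))))
        where
        perm : ((F₁ ++ w ∷ F₂) ++ G) ++ B ↭ F₁ ++ (B ++ (w ∷ F₂ ++ G))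
        perm = ↭-trans (↭-reflexive (trans (cong (_++ B) (++-assoc F₁ (w ∷ F₂) G)) (++-assoc F₁ (w ∷ F₂ ++ G) B)))
          (++⁺ˡ F₁ (++-comm (w ∷ F₂ ++ G) B))

      -- A red neighbour z of the end β is useful in either place that the hypotheses leave: in `F`
      -- it closes up a long path, and outside both tails it extends `B`.
      exploit : ∀ {x y} (S : Tails x y) {F G z} → A S ≡ F ++ G → E true (β S) z → z ∉ I → z ∉ G ++ B S →
                (∀ {w} → w ∈ F → 2 * m ≤ 1 + (length G + length (B S))) → Progress x y (length (bag S))
      exploit S {F} {G} {z} eq e zI z∉ big with z ∈ᵇ F in q
      ... | true  = inj₁ (close-up S eq (∈ᵇ-true F q) e (big (∈ᵇ-true F q)))
      ... | false = advance S e (λ i → case-⊎ (λ j → case-⊎ (∈ᵇ-false F q) (λ k → z∉ (∈-++⁺ˡ k)) (∈-++⁻ F (subst (z ∈_) eq j)))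
                                   (λ j → z∉ (∈-++⁺ʳ G j)) (∈-++⁻ (A S) i)) zI

      -- Pósa rotation: with the edge β u the tail becomes y ... u β ... t on the same vertices, and
      -- t takes the role of β.
      rotate-B : ∀ {x y} (S : Tails x y) {F G xs ys u t z} → A S ≡ F ++ G → B S ≡ xs ++ u ∷ t ∷ ys → E true (β S) u →
                 E true t z → z ∉ I → z ∉ G ++ B S → (∀ {w} → w ∈ F → 2 * m ≤ 1 + (length G + length (B S))) → Progress x y (length (bag S))
      rotate-B (tails {A = A} wA wB un av) {F} {G} {xs} {ys} {u} {t} {z} eq refl βu tz zI z∉ big with split-walk xs wB
      ... | w₁ , _ , w₂ = subst (Progress _ _) (↭-length perm) (exploit S′ eq tz zI
          (λ i → z∉ (∈-resp-↭ (++⁺ˡ G permB) i))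
          (λ i → ≤-trans (big i) (≤-reflexive (cong (λ l → 1 + (length G + l)) (sym (↭-length permB))))))
        where
        B′ = (xs ++ [ u ]) ++ reverse (t ∷ ys)
        permB : B′ ↭ xs ++ u ∷ t ∷ ys
        permB = ↭-trans (++⁺ˡ (xs ++ [ u ]) (↭-reverse (t ∷ ys))) (↭-reflexive (++-assoc xs [ u ] (t ∷ ys)))
        perm : A ++ B′ ↭ A ++ (xs ++ u ∷ t ∷ ys)
        perm = ++⁺ˡ A permB
        S′ = tails {A = A} {B′} wA (join w₁ (adj-sym βu) (reverseʷ adj-sym w₂)) (Unique-↭ (↭-sym perm) un) (λ i → av (∈-resp-↭ perm i))

      -- Rotation across the gadget: the edge β u turns the tails into α ... u β ... y and x ... t.
      -- The two ends of the gadget exchange their roles, whence the mirroring, while `F` remains in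
      -- front.
      rotate-A : ∀ {x y} (S : Tails x y) {F G xs ys u t z} → A S ≡ F ++ G → G ≡ xs ++ u ∷ t ∷ ys → E true (β S) u →
                 E true t z → z ∉ I → z ∉ G ++ B S → (∀ {w} → w ∈ F → 2 * m ≤ 1 + (length G + length (B S))) → Progress x y (length (bag S))
      rotate-A (tails {B = B} wA wB un av) {F} {G} {xs} {ys} {u} {t} {z} refl refl βu tz zI z∉ big
        with split-walk (F ++ xs) (subst (Walk (E true) _ _) (sym (++-assoc F xs (u ∷ t ∷ ys))) wA)
      ... | w₁ , _ , w₂ = mirror-progress (subst (Progress _ _) (↭-length perm) (exploit S′ eqA tz zI
          (λ i → z∉ (∈-resp-↭ permG i))
          (λ i → ≤-trans (big i) (≤-reflexive (cong suc (trans (sym (length-++ G₀)) (trans (sym (↭-length permG)) (length-++ G′))))))))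
        where
        G₀ = xs ++ u ∷ t ∷ ys
        G′ = (xs ++ [ u ]) ++ reverse B
        A′ = ((F ++ xs) ++ [ u ]) ++ reverse B
        eqA : A′ ≡ F ++ G′
        eqA = trans (cong (_++ reverse B) (++-assoc F xs [ u ])) (++-assoc F (xs ++ [ u ]) (reverse B))
        permG : G′ ++ reverse (t ∷ ys) ↭ G₀ ++ B
        permG = ↭-trans (++⁺ (++⁺ˡ (xs ++ [ u ]) (↭-reverse B)) (↭-reverse (t ∷ ys)))
          (↭-trans (↭-reflexive (++-assoc (xs ++ [ u ]) B (t ∷ ys)))
            (↭-trans (++⁺ˡ (xs ++ [ u ]) (++-comm B (t ∷ ys)))
              (↭-reflexive (trans (sym (++-assoc (xs ++ [ u ]) (t ∷ ys) B)) (cong (_++ B) (++-assoc xs [ u ] (t ∷ ys)))))))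
        perm : A′ ++ reverse (t ∷ ys) ↭ (F ++ G₀) ++ B
        perm = ↭-trans (↭-reflexive (trans (cong (_++ reverse (t ∷ ys)) eqA) (++-assoc F G′ (reverse (t ∷ ys)))))
          (↭-trans (++⁺ˡ F permG) (↭-reflexive (sym (++-assoc F G₀ B))))
        S′ = tails {A = A′} {reverse (t ∷ ys)} (join w₁ (adj-sym βu) (reverseʷ adj-sym wB)) (reverseʷ adj-sym w₂)
               (Unique-↭ (↭-sym perm) un) (λ i → av (∈-resp-↭ perm i))

      -- The tail α ... x is split where closing up becomes profitable: an edge from β into `F`
      -- already gives 2m vertices. What must be avoided is `G` with `B`, which is either smaller
      -- than 2m or `B` alone; this keeps `Z` large in `progress`.
      record Front (x y : Vertex) (S : Tails x y) : Set where
        constructor front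
        field
          {F G}  : List Vertex
          splits : A S ≡ F ++ G
          long   : ∀ {w} → w ∈ F → 2 * m ≤ 1 + (length G + length (B S))
          short  : length G + length (B S) < 2 * m ⊎ G ≡ []

      opaque
        front-arith : (j a b t : ℕ) → j + t ≡ 1 + (a + b) → 1 + b < t → j ≤ a
        front-arith j a b t h1 h2 = linear 1 1 ((≤-reflexive h1) ⊕ h2) (solve (j ∷ a ∷ b ∷ t ∷ []))

      choose-front : ∀ {x y} (S : Tails x y) → Front x y S
      choose-front S with 2 * m ≤? 1 + length (B S) | length (A S) + length (B S) <? 2 * m
      ... | yes h | _ = front (sym (Listₚ.++-identityʳ (A S))) (λ _ → h) (inj₂ refl)
      ... | no _ | yes h = front {F = []} refl (λ ()) (inj₁ h)
      ... | no h₁ | no h₂ = front {F = take j (A S)} {drop j (A S)} (sym (take++drop≡id j (A S)))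
          (λ _ → ≤-reflexive lenG) (inj₁ (≤-reflexive (sym lenG)))
        where
        j = suc (length (A S) + length (B S)) ∸ 2 * m
        j≡ : j + 2 * m ≡ 1 + (length (A S) + length (B S))
        j≡ = m∸n+n≡m (≤-trans (≮⇒≥ h₂) (n≤1+n _))
        lenG : 2 * m ≡ 1 + (length (drop j (A S)) + length (B S))
        lenG = +-cancelˡ-≡ j (2 * m) _ (trans j≡ (trans (cong (λ a → 1 + (a + length (B S))) (sym j+g)) (regroup j (length (drop j (A S))) (length (B S)))))
          where
          open import Data.Nat.Properties using (+-cancelˡ-≡)
          regroup : ∀ j g b → 1 + ((j + g) + b) ≡ j + (1 + (g + b))
          regroup j g b = solve (j ∷ g ∷ b ∷ [])
          j+g : j + length (drop j (A S)) ≡ length (A S)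
          j+g = trans (cong (j +_) (length-drop j (A S))) (m+[n∸m]≡n (front-arith j (length (A S)) (length (B S)) (2 * m) j≡ (≰⇒> h₁)))

      ends : ∀ {x y} (S : Tails x y) → List Vertex → List Vertex
      ends S G = successors (adj true (β S)) G ++ successors (adj true (β S)) (B S)

      opaque
        ends-arith : (m n γ e d l i r g b t₁ t₂ t : ℕ) → m ≡ γ + n → 999 ≤ 3 * e + 4 * γ →
            m + γ + e ≤ d + 120 → d ≤ i + r → i ≤ 55 → r ≤ l → l ≡ g + b → g ≤ t₁ + 1 → b ≤ t₂ + 1 →
            t ≡ t₁ + t₂ → n + 30 ≤ t
        ends-arith m n γ e d l i r g b t₁ t₂ t h1 h2 h3 h4 h5 h6 h7 h8 h9 h10 =
            linear 3 (2 * γ + 380) (3 ⊗ (≤-reflexive (sym h1)) ⊕ h2 ⊕ 3 ⊗ h3 ⊕ 3 ⊗ h4 ⊕ 3 ⊗ h5 ⊕ 3 ⊗ h6 ⊕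
            3 ⊗ (≤-reflexive h7) ⊕ 3 ⊗ h8 ⊕ 3 ⊗ h9 ⊕ 3 ⊗ (≤-reflexive (sym h10))) (solve (m ∷ n ∷ γ ∷ e ∷
            d ∷ l ∷ i ∷ r ∷ g ∷ b ∷ t₁ ∷ t₂ ∷ t ∷ []))

        wide-arith : (m e N i z g b : ℕ) → 1 + N ≡ 4 * m + e → N ≤ (i + (g + b)) + z → i ≤ 55 →
            g + b < 2 * m → 56 ≤ e → 2 * m ≤ z
        wide-arith m e N i z g b h1 h2 h3 h4 h5 =
            linear 1 1 ((≤-reflexive (sym h1)) ⊕ h2 ⊕ h3 ⊕ h4 ⊕ h5) (solve (m ∷ e ∷ N ∷ i ∷ z ∷ g ∷ b ∷
            []))

        wide-arith′ : (m e N i z g b : ℕ) → 1 + N ≡ 4 * m + e → N ≤ (i + (g + b)) + z → i ≤ 55 →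
            g + b < 2 * m → 2 * m ≤ z + 55
        wide-arith′ m e N i z g b h1 h2 h3 h4 =
            linear 1 e ((≤-reflexive (sym h1)) ⊕ h2 ⊕ h3 ⊕ h4) (solve (m ∷ e ∷ N ∷ i ∷ z ∷ g ∷ b ∷ []))

        half-arith₂ : (m e N i z a b : ℕ) → 1 + N ≡ 4 * m + e → N ≤ (i + (0 + b)) + z → i ≤ 55 → b ≤ a →
            i + (a + b) ≤ N → 56 ≤ e → 2 * m ≤ z
        half-arith₂ m e N i z a b h1 h2 h3 h4 h5 h6 =
            linear 2 1 ((≤-reflexive (sym h1)) ⊕ 2 ⊗ h2 ⊕ h3 ⊕ h4 ⊕ h5 ⊕ h6) (solve (m ∷ e ∷ N ∷ i ∷ z ∷ a
            ∷ b ∷ []))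

        half-arith₃ : (m e N i z a b : ℕ) → 1 + N ≡ 4 * m + e → N ≤ (i + (0 + b)) + z → i ≤ 55 → b ≤ a →
            i + (a + b) ≤ N → 2 * m ≤ z + 55
        half-arith₃ m e N i z a b h1 h2 h3 h4 h5 =
            linear 2 (e + 55) ((≤-reflexive (sym h1)) ⊕ 2 ⊗ h2 ⊕ h3 ⊕ h4 ⊕ h5) (solve (m ∷ e ∷ N ∷ i ∷ z ∷
            a ∷ b ∷ []))

        regime-arith : (γ e : ℕ) → 999 ≤ 3 * e + 4 * γ → e < 56 → 209 ≤ γ
        regime-arith γ e h1 h2 = linear 4 1 (h1 ⊕ 3 ⊗ h2) (solve (γ ∷ e ∷ []))

      -- If neither β nor any end reachable by one rotation has a red neighbour in `Z`, these ends
      -- are completely blue to `Z`, contrary to `separated`; there are at least n + 30 of them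
      -- because all red neighbours of β outside `I` lie in `G` and `B`. The hypothesis |B| ≤ |A|
      -- serves the case `G ≡ []`, where only halving the vertices outside `I` bounds `B`.
      progress : ∀ {x y} (S : Tails x y) → length (B S) ≤ length (A S) → Progress x y (length (bag S))
      progress {x} {y} S b≤a with choose-front S
      ... | front {F} {G} eq long short = case-end (∃⊎∀ (adj true (β S)) Z)
        where
        Z = vertices ∖ (I ++ (G ++ B S))
        uZ = Unique-∖ (I ++ (G ++ B S)) vertices-unique
        T = ends S G
        Z-off : ∀ {z} → z ∈ Z → z ∉ I × z ∉ G ++ B S
        Z-off i = let o = proj₂ (∈-∖⁻ vertices (I ++ (G ++ B S)) i) in (λ j → o (∈-++⁺ˡ j)) , (λ j → o (∈-++⁺ʳ I j))
        uGB : Unique (G ++ B S)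
        uGB = proj₁ (proj₂ (Unique-++⁻ F (subst Unique (trans (cong (_++ B S) eq) (++-assoc F G (B S))) (unique S))))
        T⊆G : ∀ {t} → t ∈ successors (adj true (β S)) G → t ∈ G
        T⊆G {t} i = let (ys , zs , u , q , _) = ∈-successors (adj true (β S)) G i in subst (t ∈_) (sym q) (∈-++⁺ʳ ys (there (here refl)))
        T⊆B : ∀ {t} → t ∈ successors (adj true (β S)) (B S) → t ∈ B S
        T⊆B {t} i = let (ys , zs , u , q , _) = ∈-successors (adj true (β S)) (B S) i in subst (t ∈_) (sym q) (∈-++⁺ʳ ys (there (here refl)))
        T⊆ : T ⊆ G ++ B S
        T⊆ i = case-⊎ (λ j → ∈-++⁺ˡ (T⊆G j)) (λ j → ∈-++⁺ʳ G (T⊆B j)) (∈-++⁻ (successors (adj true (β S)) G) i)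
        uT : Unique T
        uT = let (uG , uB , d) = Unique-++⁻ G uGB in
          Unique-++⁺ (Unique-successors (adj true (β S)) uG) (Unique-successors (adj true (β S)) uB) λ i j → d (T⊆G i) (T⊆B j)
        sizeZ : N ≤ (length I + (length G + length (B S))) + length Z
        sizeZ = ≤-trans (≤-reflexive (sym length-vertices)) (≤-trans (length-∖ (I ++ (G ++ B S)) vertices-unique)
          (≤-reflexive (cong (_+ length Z) (trans (length-++ I) (cong (length I +_) (length-++ G))))))
        fits : length I + (length (A S) + length (B S)) ≤ N
        fits = ≤-trans (≤-reflexive (trans (cong (length I +_) (sym (length-++ (A S)))) (sym (length-++ I))))
          (≤-trans (length-⊆ (Unique-++⁺ uI (unique S) λ i j → avoids S j i) λ {v} _ → ∈-vertices v) (≤-reflexive length-vertices))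
        wide : 2 * m ≤ length Z ⊎ (209 ≤ γ × 2 * m ≤ length Z + 55)
        wide = by short (56 ≤? e)
          where
          by : length G + length (B S) < 2 * m ⊎ G ≡ [] → Dec (56 ≤ e) → 2 * m ≤ length Z ⊎ (209 ≤ γ × 2 * m ≤ length Z + 55)
          by (inj₁ h) (yes h′) = inj₁ (wide-arith m e N (length I) (length Z) (length G) (length (B S)) N≡ sizeZ I≤55 h h′)
          by (inj₁ h) (no ¬h′) = inj₂ (regime-arith γ e slack (≰⇒> ¬h′) , wide-arith′ m e N (length I) (length Z) (length G) (length (B S)) N≡ sizeZ I≤55 h)
          by (inj₂ q) (yes h′) = inj₁ (half-arith₂ m e N (length I) (length Z) (length (A S)) (length (B S)) N≡ (subst (λ g → N ≤ (length I + (length g + length (B S))) + length Z) q sizeZ) I≤55 b≤a fits h′)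
          by (inj₂ q) (no ¬h′) = inj₂ (regime-arith γ e slack (≰⇒> ¬h′) ,
            half-arith₃ m e N (length I) (length Z) (length (A S)) (length (B S)) N≡ (subst (λ g → N ≤ (length I + (length g + length (B S))) + length Z) q sizeZ) I≤55 b≤a fits)
        many : (∀ {z} → z ∈ Z → adj true (β S) z ≡ false) → n + 30 ≤ length T
        many none = ends-arith m n γ e (red (β S) vertices) (red (β S) (G ++ B S)) (length I) (red (β S) (vertices ∖ I)) (red (β S) G) (red (β S) (B S))
          (length (successors (adj true (β S)) G)) (length (successors (adj true (β S)) (B S))) (length T) m≡ slack (red-degree (β S))
          (#-∖-≤ (adj true (β S)) I vertices-unique) I≤55 inside (#-++ (adj true (β S)) G (B S)) (#-successors (adj true (β S)) G)
          (#-successors (adj true (β S)) (B S)) (length-++ (successors (adj true (β S)) G))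
          where
          inside : red (β S) (vertices ∖ I) ≤ red (β S) (G ++ B S)
          inside = ≤-trans (≤-reflexive (sym (length-filterᵇ (adj true (β S)) (vertices ∖ I))))
            (≤-trans (length-⊆ (Unique-filterᵇ (adj true (β S)) (Unique-∖ I vertices-unique)) sub)
              (≤-reflexive (length-filterᵇ (adj true (β S)) (G ++ B S))))
            where
            sub : filterᵇ (adj true (β S)) (vertices ∖ I) ⊆ filterᵇ (adj true (β S)) (G ++ B S)
            sub {v} i with ∈-filterᵇ⁻ (adj true (β S)) (vertices ∖ I) i
            ... | j , e′ with v ∈ᵇ (G ++ B S) in q
            ...   | true  = ∈-filterᵇ⁺ (adj true (β S)) (∈ᵇ-true (G ++ B S) q) e′
            ...   | false with trans (sym e′) (none (∈-∖⁺ (I ++ (G ++ B S)) (∈-vertices v)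
                              λ k → case-⊎ (proj₂ (∈-∖⁻ vertices I j)) (∈ᵇ-false (G ++ B S) q) (∈-++⁻ I k)))
            ...     | ()
        case-end : (∃ λ z → z ∈ Z × adj true (β S) z ≡ true) ⊎ (∀ {z} → z ∈ Z → adj true (β S) z ≡ false) → Progress x y (length (bag S))
        case-rotated : (∀ {z} → z ∈ Z → adj true (β S) z ≡ false) →
                       (∃₂ λ t z → t ∈ T × z ∈ Z × adj true t z ≡ true) ⊎ (∀ {t z} → t ∈ T → z ∈ Z → adj true t z ≡ false) → Progress x y (length (bag S))
        case-end (inj₁ (z , z∈ , e′)) = exploit S eq e′ (proj₁ (Z-off z∈)) (proj₂ (Z-off z∈)) long
        case-end (inj₂ none) = case-rotated none (∃₂⊎∀₂ (adj true) T Z)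
        case-rotated none (inj₁ (t , z , t∈ , z∈ , tz)) = case-⊎
          (λ i → let (xs , ys , u , q , βu) = ∈-successors (adj true (β S)) G i in
            rotate-A S eq q βu tz (proj₁ (Z-off z∈)) (proj₂ (Z-off z∈)) long)
          (λ i → let (xs , ys , u , q , βu) = ∈-successors (adj true (β S)) (B S) i in
            rotate-B S eq q βu tz (proj₁ (Z-off z∈)) (proj₂ (Z-off z∈)) long)
          (∈-++⁻ (successors (adj true (β S)) G) t∈)
        case-rotated none (inj₂ blue′) = ⊥-elim (separated T Z uT uZ
          (λ {t} i j → adj-not true (λ q → proj₂ (Z-off j) (T⊆ (subst (_∈ T) q i))) (blue′ i j)) (many none) wide)

      any-progress : ∀ {x y} (S : Tails x y) → Progress x y (length (bag S))
      any-progress S with ≤-total (length (B S)) (length (A S))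
      ... | inj₁ h = progress S h
      ... | inj₂ h = subst (Progress _ _) (mirror-bag S) (mirror-progress (progress (mirror S)
          (≤-trans (≤-reflexive (length-reverse (A S))) (≤-trans h (≤-reflexive (sym (length-reverse (B S))))))))

      long-path : ∀ {x y} → x ≢ y → x ∉ I → y ∉ I → LongPath x y
      long-path {x} {y} x≢y xI yI = go (suc N) (tails {A = [ x ]} {[ y ]} [ x ]ʷ [ y ]ʷ (Unique-∷⁺ (λ { (here q) → x≢y q }) (◇ ◂ ◇))
          λ { (here refl) → xI ; (there (here refl)) → yI }) (m≤m+n (suc N) 2)
        where
        go : ∀ fuel (S : Tails x y) → N < fuel + length (bag S) → LongPath x y
        go zero S h = ⊥-elim (<-irrefl refl (<-≤-trans h (≤-trans (length-⊆ (unique S) λ {v} _ → ∈-vertices v) (≤-reflexive length-vertices))))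
        go (suc fuel) S h = case-⊎ id (λ { (S′ , h′) → go fuel S′ (≤-trans h (≤-trans (≤-reflexive (sym (+-suc fuel _))) (+-monoʳ-≤ fuel h′))) }) (any-progress S)

    -- Shortening a path

    data Overlap {A : Set} (f : A → Bool) (g : A → Bool) (h : A → Bool) (k : A → Bool) (x : A) : Set where
      fg : f x ≡ true → g x ≡ true → Overlap f g h k x
      fh : f x ≡ true → h x ≡ true → Overlap f g h k x
      fk : f x ≡ true → k x ≡ true → Overlap f g h k x
      gh : g x ≡ true → h x ≡ true → Overlap f g h k x
      gk : g x ≡ true → k x ≡ true → Overlap f g h k x
      hk : h x ≡ true → k x ≡ true → Overlap f g h k x

    overlap? : ∀ {A : Set} (f g h k : A → Bool) x → Overlap f g h k x ⊎ ι (f x) + ι (g x) + ι (h x) + ι (k x) ≤ 1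
    overlap? f g h k x with f x in ef | g x in eg | h x in eh | k x in ek
    ... | true  | true  | _     | _     = inj₁ (fg ef eg)
    ... | true  | false | true  | _     = inj₁ (fh ef eh)
    ... | true  | false | false | true  = inj₁ (fk ef ek)
    ... | true  | false | false | false = inj₂ ≤-refl
    ... | false | true  | true  | _     = inj₁ (gh eg eh)
    ... | false | true  | false | true  = inj₁ (gk eg ek)
    ... | false | true  | false | false = inj₂ ≤-refl
    ... | false | false | true  | true  = inj₁ (hk eh ek)
    ... | false | false | true  | false = inj₂ ≤-refl
    ... | false | false | false | true  = inj₂ ≤-refl
    ... | false | false | false | false = inj₂ z≤n

    opaque
      overlap-arith : (a b p d a′ b′ p′ d′ l : ℕ) → a + b + p + d ≤ 1 → a′ + b′ + p′ + d′ ≤ l →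
          (a + a′) + (b + b′) + (p + p′) + (d + d′) ≤ 1 + l
      overlap-arith a b p d a′ b′ p′ d′ l h1 h2 =
          linear 1 0 (h1 ⊕ h2) (solve (a ∷ b ∷ p ∷ d ∷ a′ ∷ b′ ∷ p′ ∷ d′ ∷ l ∷ []))

    four-sets : ∀ {A : Set} (f g h k : A → Bool) xs →
                (∃ λ x → x ∈ xs × Overlap f g h k x) ⊎ # f xs + # g xs + # h xs + # k xs ≤ length xs
    four-sets f g h k [] = inj₂ z≤n
    four-sets f g h k (x ∷ xs) with overlap? f g h k x | four-sets f g h k xs
    ... | inj₁ o | _ = inj₁ (x , here refl , o)
    ... | inj₂ _ | inj₁ (y , y∈ , o) = inj₁ (y , there y∈ , o)
    ... | inj₂ a | inj₂ b = inj₂ (overlap-arith (ι (f x)) (ι (g x)) (ι (h x)) (ι (k x)) (# f xs) (# g xs) (# h xs) (# k xs) (length xs) a b)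

    -- Four consecutive vertices of a path. Neighbourhoods shifted by different amounts become
    -- predicates on one and the same window, so that `four-sets` treats them like unshifted ones.
    record Window : Set where
      constructor window
      field
        at₀ at₁ at₂ at₃ : Vertex
    open Window

    windows : Vertex → Vertex → Vertex → List Vertex → List Window
    windows a b d []       = []
    windows a b d (z ∷ xs) = window a b d z ∷ windows b d z xs

    length-windows : ∀ a b d xs → length (windows a b d xs) ≡ length xs
    length-windows a b d []       = refl
    length-windows a b d (z ∷ xs) = cong suc (length-windows b d z xs)

    ∈-windows : ∀ {a b d} xs {w} → w ∈ windows a b d xs →
                ∃₂ λ ys zs → a ∷ b ∷ d ∷ xs ≡ ys ++ at₀ w ∷ at₁ w ∷ at₂ w ∷ at₃ w ∷ zs
    ∈-windows (z ∷ xs) (here refl) = [] , xs , refl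
    ∈-windows {a} (z ∷ xs) (there i) with ∈-windows xs i
    ... | ys , zs , q = a ∷ ys , zs , cong (a ∷_) q

    module _ (p : Vertex → Bool) where

      three : ∀ a b d → ι (p a) + (ι (p b) + (ι (p d) + 0)) ≤ 3
      three a b d = +-mono-≤ (ι≤1 (p a)) (+-mono-≤ (ι≤1 (p b)) (+-mono-≤ (ι≤1 (p d)) z≤n))

      step-in : ∀ t {x y} → x ≤ 3 + y → t + x ≤ 3 + (t + y)
      step-in t {x} {y} h = linear 1 0 h (solve (t ∷ x ∷ y ∷ []))

      count₀ : ∀ a b d xs → # p (a ∷ b ∷ d ∷ xs) ≤ 3 + # (p ∘ at₀) (windows a b d xs)
      count₀ a b d []       = three a b d
      count₀ a b d (z ∷ xs) = step-in (ι (p a)) (count₀ b d z xs)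

      count₁ : ∀ a b d xs → # p (b ∷ d ∷ xs) ≤ 2 + # (p ∘ at₁) (windows a b d xs)
      count₁ a b d []       = +-mono-≤ (ι≤1 (p b)) (+-mono-≤ (ι≤1 (p d)) z≤n)
      count₁ a b d (z ∷ xs) = add (ι (p b)) (count₁ b d z xs)
        where
        add : ∀ t {x y} → x ≤ 2 + y → t + x ≤ 2 + (t + y)
        add t {x} {y} h = linear 1 0 h (solve (t ∷ x ∷ y ∷ []))

      count₂ : ∀ a b d xs → # p (d ∷ xs) ≤ 1 + # (p ∘ at₂) (windows a b d xs)
      count₂ a b d []       = +-mono-≤ (ι≤1 (p d)) z≤n
      count₂ a b d (z ∷ xs) = add (ι (p d)) (count₂ b d z xs)
        where
        add : ∀ t {x y} → x ≤ 1 + y → t + x ≤ 1 + (t + y)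
        add t {x} {y} h = linear 1 0 h (solve (t ∷ x ∷ y ∷ []))

      count₃ : ∀ a b d xs → # p xs ≤ # (p ∘ at₃) (windows a b d xs)
      count₃ a b d []       = z≤n
      count₃ a b d (z ∷ xs) = +-monoʳ-≤ (ι (p z)) (count₃ b d z xs)

    peel : ∀ {A : Set} k (xs : List A) → k ≤ length xs → ∃₂ λ (v : Vec.Vec A k) ys → xs ≡ Vec.toList v ++ ys
    peel zero    xs       h = Vec.[] , xs , refl
    peel (suc k) (x ∷ xs) (s≤s h) with peel k xs h
    ... | v , ys , e = x Vec.∷ v , ys , cong (x ∷_) e

    module Shorten (I : List Vertex) (I≤55 : length I ≤ 55) where

      record Path (x y : Vertex) : Set where
        constructor path
        field
          {verts} : List Vertex
          walk    : Walk (E true) x y verts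
          unique  : Unique verts
          avoids  : ∀ {v} → v ∈ verts → v ∉ I
      open Path

      record Shorter {x y} (P : Path x y) : Set where
        constructor shorter
        field
          shortened : Path x y
          saved     : ℕ
          1≤saved   : 1 ≤ saved
          saved≤10  : saved ≤ 10
          total     : length (verts shortened) + saved ≡ length (verts P)

      -- … u w ⋯ v w′ …: the stretch between v and w is traversed backwards, B and M are skipped.
      shortcut-inside : ∀ {x y} (P : Path x y) A B C M {Z u v w w′} →
                        verts P ≡ A ++ u ∷ B ++ v ∷ C ++ w ∷ M ++ w′ ∷ Z → E true u w → E true v w′ →
                        1 ≤ length B + length M → length B + length M ≤ 10 → Shorter P
      shortcut-inside (path wk un av) A B C M {Z} {u} {v} {w} {w′} refl uw vw′ lo hi =
        shorter (path (join w₁ uw (join (reverseʷ adj-sym w₂) vw′ w₃))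
            (proj₁ (Unique-++⁻ new (Unique-↭ perm un)))
            (λ i → av (∈-resp-↭ (↭-sym perm) (∈-++⁺ˡ i))))
          (length B + length M) lo hi
          (trans (cong (length new +_) (sym (length-++ B))) (trans (sym (length-++ new)) (sym (↭-length perm))))
        where
        rest = v ∷ C ++ w ∷ M ++ w′ ∷ Z
        w₁ = prefix-walk A wk
        wv : Walk (E true) v _ rest
        wv = drop-walk (A ++ u ∷ B) (subst (Walk (E true) _ _) (sym (++-assoc A (u ∷ B) rest)) wk)
        w₂ : Walk (E true) v w ((v ∷ C) ++ [ w ])
        w₂ = prefix-walk (v ∷ C) wv
        w₃ : Walk (E true) w′ _ (w′ ∷ Z)
        w₃ = drop-walk (v ∷ C ++ w ∷ M) (subst (Walk (E true) _ _) (cong (v ∷_) (sym (++-assoc C (w ∷ M) (w′ ∷ Z)))) wv)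
        back = reverse ((v ∷ C) ++ [ w ])
        new = (A ++ [ u ]) ++ back ++ w′ ∷ Z
        perm : A ++ u ∷ B ++ rest ↭ new ++ (B ++ M)
        perm = ↭-trans (↭-reflexive (sym (++-assoc A [ u ] (B ++ rest))))
          (↭-trans (++⁺ˡ (A ++ [ u ]) tail) (↭-reflexive (sym (++-assoc (A ++ [ u ]) (back ++ w′ ∷ Z) (B ++ M)))))
          where
          tail : B ++ rest ↭ (back ++ w′ ∷ Z) ++ (B ++ M)
          tail = ↭-trans (++⁺ˡ B (↭-trans (↭-reflexive (cong (v ∷_) (sym (++-assoc C [ w ] (M ++ w′ ∷ Z)))))
                   (↭-trans (++⁺ˡ ((v ∷ C) ++ [ w ]) (++-comm M (w′ ∷ Z)))
                     (↭-trans (↭-reflexive (sym (++-assoc ((v ∷ C) ++ [ w ]) (w′ ∷ Z) M))) (++⁺ʳ M (++⁺ʳ (w′ ∷ Z) (↭-sym (↭-reverse ((v ∷ C) ++ [ w ])))))))))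
                   (shifts B (back ++ w′ ∷ Z) {M})

      shortcut-outside : ∀ {x y} (P : Path x y) A B {Z u v z d} → verts P ≡ A ++ u ∷ B ++ v ∷ Z →
                         z ∉ verts P → z ∉ I → E true u z → E true v z → length B ≡ suc d → 1 ≤ d → d ≤ 10 → Shorter P
      shortcut-outside (path wk un av) A B {Z} {u} {v} {z} {d} refl z∉ zI uz vz lB lo hi =
        shorter (path (join w₁ uz (adj-sym vz ∷ʷ w₂)) unew avoid) d lo hi
          (size (length A) (length Z) (length B) d lB (trans (length-++ (A ++ [ u ])) (cong (_+ suc (suc (length Z))) (length-++ A)))
            (trans (length-++ A) (cong (λ t → length A + suc t) (length-++ B))))
        where
        w₁ = prefix-walk A wk
        w₂ : Walk (E true) v _ (v ∷ Z)
        w₂ = drop-walk (A ++ u ∷ B) (subst (Walk (E true) _ _) (sym (++-assoc A (u ∷ B) (v ∷ Z))) wk)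
        new = (A ++ [ u ]) ++ z ∷ v ∷ Z
        perm : z ∷ (A ++ u ∷ B ++ v ∷ Z) ↭ new ++ B
        perm = ↭-trans (prep z (↭-trans (↭-reflexive (sym (++-assoc A [ u ] (B ++ v ∷ Z))))
            (↭-trans (++⁺ˡ (A ++ [ u ]) (++-comm B (v ∷ Z))) (↭-reflexive (sym (++-assoc (A ++ [ u ]) (v ∷ Z) B))))))
          (++⁺ʳ B (↭-sym (shift z (A ++ [ u ]) (v ∷ Z))))
        unew = proj₁ (Unique-++⁻ new (Unique-↭ perm (Unique-∷⁺ z∉ un)))
        avoid : ∀ {x} → x ∈ new → x ∉ I
        avoid i with ∈-resp-↭ (↭-sym perm) (∈-++⁺ˡ i)
        ... | here refl = zI
        ... | there j   = av j
        size : ∀ a z b d {p q} → b ≡ suc d → p ≡ (a + 1) + suc (suc z) → q ≡ a + suc (b + suc z) → p + d ≡ q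
        size a z _ d refl refl refl = solve (a ∷ z ∷ d ∷ [])

      opaque
        -- The sum of all inequalities is 4(m + γ + e) ≤ N + 739, that is, 3e + 4γ ≤ 738. The
        -- weights 3 and 4 in `slack` have their origin here.
        shorten-arith : (m γ e N d₀ d₁ d₂ d₃ i₀ i₁ i₂ i₃ o₀ o₁ o₂ o₃ l o : ℕ) → m + γ + e ≤ d₀ + 120 →
            m + γ + e ≤ d₁ + 120 → m + γ + e ≤ d₂ + 120 → m + γ + e ≤ d₃ + 120 → d₀ ≤ 55 + (13 + i₀ + o₀) →
            d₁ ≤ 55 + (13 + i₁ + o₁) → d₂ ≤ 55 + (13 + i₂ + o₂) → d₃ ≤ 55 + (13 + i₃ + o₃) →
            i₀ + i₁ + i₂ + i₃ ≤ l → o₀ + o₁ + o₂ + o₃ ≤ o → (13 + l) + o ≤ N → 1 + N ≡ 4 * m + e →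
            999 ≤ 3 * e + 4 * γ → ⊥
        shorten-arith m γ e N d₀ d₁ d₂ d₃ i₀ i₁ i₂ i₃ o₀ o₁ o₂ o₃ l o h1 h2 h3 h4 h5 h6 h7 h8 h9 h10 h11 h12 h13 =
            1≰0 (linear 1 260 (h1 ⊕ h2 ⊕ h3 ⊕ h4 ⊕ h5 ⊕ h6 ⊕ h7 ⊕ h8 ⊕ h9 ⊕ h10 ⊕ h11 ⊕ (≤-reflexive h12)
            ⊕ h13) (solve (m ∷ γ ∷ e ∷ N ∷ d₀ ∷ d₁ ∷ d₂ ∷ d₃ ∷ i₀ ∷ i₁ ∷ i₂ ∷ i₃ ∷ o₀ ∷ o₁ ∷ o₂ ∷ o₃ ∷ l ∷
            o ∷ [])))

        inside-arith : (d i v t o r x : ℕ) → d ≤ i + v → i ≤ 55 → v ≤ r + o → r ≤ 10 + x → x ≤ 3 + t →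
            d ≤ 55 + (13 + t + o)
        inside-arith d i v t o r x h1 h2 h3 h4 h5 =
            linear 1 0 (h1 ⊕ h2 ⊕ h3 ⊕ h4 ⊕ h5) (solve (d ∷ i ∷ v ∷ t ∷ o ∷ r ∷ x ∷ []))

      -- The red neighbourhoods of q₀, q₃, q₆, q₉ outside the path are pairwise disjoint, and so are
      -- those on the path after shifting by 3, 2, 1, 0; otherwise there is a shortcut. But 4δ > N.
      shorten : ∀ {x y} (P : Path x y) → 13 ≤ length (verts P) → Shorter P
      -- Ten vertices q₀ ... q₉, and a, b, d to open the first window. Three is the least spacing
      -- for which the detour q₀ z q₃ saves a vertex: two are skipped and one is inserted.
      shorten {x} {y} (path {L₀} wk un av) big with peel 13 L₀ big
      ... | q₀ Vec.∷ q₁ Vec.∷ q₂ Vec.∷ q₃ Vec.∷ q₄ Vec.∷ q₅ Vec.∷ q₆ Vec.∷ q₇ Vec.∷ q₈ Vec.∷ q₉ Vec.∷ a Vec.∷ b Vec.∷ d Vec.∷ Vec.[] , xs , refl =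
        case-in (four-sets (adj true q₀ ∘ at₀) (adj true q₃ ∘ at₁) (adj true q₆ ∘ at₂) (adj true q₉ ∘ at₃) (windows a b d xs))
        where
        P : Path x y
        P = path wk un av
        r = a ∷ b ∷ d ∷ xs
        pre = q₀ ∷ q₁ ∷ q₂ ∷ q₃ ∷ q₄ ∷ q₅ ∷ q₆ ∷ q₇ ∷ q₈ ∷ q₉ ∷ []
        L = pre ++ r
        Z = vertices ∖ I ∖ L
        inside : ∀ {w} → w ∈ windows a b d xs → Overlap (adj true q₀ ∘ at₀) (adj true q₃ ∘ at₁) (adj true q₆ ∘ at₂) (adj true q₉ ∘ at₃) w → Shorter P
        inside {window v₀ v₁ v₂ v₃} w∈ o with ∈-windows xs w∈
        ... | ys , zs , eq = by o
          where
          eq₁ : r ≡ (ys ++ v₀ ∷ []) ++ v₁ ∷ v₂ ∷ v₃ ∷ zs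
          eq₁ = trans eq (sym (++-assoc ys (v₀ ∷ []) _))
          eq₂ : r ≡ (ys ++ v₀ ∷ v₁ ∷ []) ++ v₂ ∷ v₃ ∷ zs
          eq₂ = trans eq (sym (++-assoc ys (v₀ ∷ v₁ ∷ []) _))
          by : Overlap (adj true q₀ ∘ at₀) (adj true q₃ ∘ at₁) (adj true q₆ ∘ at₂) (adj true q₉ ∘ at₃) (window v₀ v₁ v₂ v₃) → Shorter P
          by (fg e₁ e₂) = shortcut-inside P [] (q₁ ∷ q₂ ∷ []) (q₄ ∷ q₅ ∷ q₆ ∷ q₇ ∷ q₈ ∷ q₉ ∷ ys) [] (cong (pre ++_) eq) e₁ e₂ (s≤s z≤n) (m≤m+n 2 8)
          by (fh e₁ e₂) = shortcut-inside P [] (q₁ ∷ q₂ ∷ q₃ ∷ q₄ ∷ q₅ ∷ []) (q₇ ∷ q₈ ∷ q₉ ∷ ys) (v₁ ∷ []) (cong (pre ++_) eq) e₁ e₂ (s≤s z≤n) (m≤m+n 6 4)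
          by (fk e₁ e₂) = shortcut-inside P [] (q₁ ∷ q₂ ∷ q₃ ∷ q₄ ∷ q₅ ∷ q₆ ∷ q₇ ∷ q₈ ∷ []) ys (v₁ ∷ v₂ ∷ []) (cong (pre ++_) eq) e₁ e₂ (s≤s z≤n) ≤-refl
          by (gh e₁ e₂) = shortcut-inside P (q₀ ∷ q₁ ∷ q₂ ∷ []) (q₄ ∷ q₅ ∷ []) (q₇ ∷ q₈ ∷ q₉ ∷ ys ++ v₀ ∷ []) [] (cong (pre ++_) eq₁) e₁ e₂ (s≤s z≤n) (m≤m+n 2 8)
          by (gk e₁ e₂) = shortcut-inside P (q₀ ∷ q₁ ∷ q₂ ∷ []) (q₄ ∷ q₅ ∷ q₆ ∷ q₇ ∷ q₈ ∷ []) (ys ++ v₀ ∷ []) (v₂ ∷ []) (cong (pre ++_) eq₁) e₁ e₂ (s≤s z≤n) (m≤m+n 6 4)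
          by (hk e₁ e₂) = shortcut-inside P (q₀ ∷ q₁ ∷ q₂ ∷ q₃ ∷ q₄ ∷ q₅ ∷ []) (q₇ ∷ q₈ ∷ []) (ys ++ v₀ ∷ v₁ ∷ []) [] (cong (pre ++_) eq₂) e₁ e₂ (s≤s z≤n) (m≤m+n 2 8)
        outside : ∀ {z} → z ∈ Z → Overlap (adj true q₀) (adj true q₃) (adj true q₆) (adj true q₉) z → Shorter P
        outside {z} z∈ = by
          where
          z∉ : z ∉ L
          z∉ = proj₂ (∈-∖⁻ (vertices ∖ I) L z∈)
          zI : z ∉ I
          zI = proj₂ (∈-∖⁻ vertices I (proj₁ (∈-∖⁻ (vertices ∖ I) L z∈)))
          by : Overlap (adj true q₀) (adj true q₃) (adj true q₆) (adj true q₉) z → Shorter P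
          by (fg e₁ e₂) = shortcut-outside P [] (q₁ ∷ q₂ ∷ []) refl z∉ zI e₁ e₂ refl ≤-refl (m≤m+n 1 9)
          by (fh e₁ e₂) = shortcut-outside P [] (q₁ ∷ q₂ ∷ q₃ ∷ q₄ ∷ q₅ ∷ []) refl z∉ zI e₁ e₂ refl (s≤s z≤n) (m≤m+n 4 6)
          by (fk e₁ e₂) = shortcut-outside P [] (q₁ ∷ q₂ ∷ q₃ ∷ q₄ ∷ q₅ ∷ q₆ ∷ q₇ ∷ q₈ ∷ []) refl z∉ zI e₁ e₂ refl (s≤s z≤n) (m≤m+n 7 3)
          by (gh e₁ e₂) = shortcut-outside P (q₀ ∷ q₁ ∷ q₂ ∷ []) (q₄ ∷ q₅ ∷ []) refl z∉ zI e₁ e₂ refl ≤-refl (m≤m+n 1 9)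
          by (gk e₁ e₂) = shortcut-outside P (q₀ ∷ q₁ ∷ q₂ ∷ []) (q₄ ∷ q₅ ∷ q₆ ∷ q₇ ∷ q₈ ∷ []) refl z∉ zI e₁ e₂ refl (s≤s z≤n) (m≤m+n 4 6)
          by (hk e₁ e₂) = shortcut-outside P (q₀ ∷ q₁ ∷ q₂ ∷ q₃ ∷ q₄ ∷ q₅ ∷ []) (q₇ ∷ q₈ ∷ []) refl z∉ zI e₁ e₂ refl ≤-refl (m≤m+n 1 9)
        bound : ∀ q t → red q r ≤ 3 + t → red q vertices ≤ 55 + (13 + t + red q Z)
        bound q t h = inside-arith (red q vertices) (length I) (red q (vertices ∖ I)) t (red q Z) (red q L) (red q r)
          (#-∖-≤ (adj true q) I vertices-unique) I≤55 split
          (≤-trans (≤-reflexive (#-++ (adj true q) pre r)) (+-monoˡ-≤ (red q r) (#≤length (adj true q) pre))) h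
          where
          split : red q (vertices ∖ I) ≤ red q L + red q Z
          split = ≤-trans (#-⊆ (adj true q) (Unique-∖ I vertices-unique) cover) (≤-reflexive (#-++ (adj true q) L Z))
            where
            cover : vertices ∖ I ⊆ L ++ Z
            cover {v} i with v ∈ᵇ L in eq
            ... | true  = ∈-++⁺ˡ (∈ᵇ-true L eq)
            ... | false = ∈-++⁺ʳ L (∈-∖⁺ L i (∈ᵇ-false L eq))
        case-out : # (adj true q₀ ∘ at₀) (windows a b d xs) + # (adj true q₃ ∘ at₁) (windows a b d xs) + # (adj true q₆ ∘ at₂) (windows a b d xs) + # (adj true q₉ ∘ at₃) (windows a b d xs) ≤ length (windows a b d xs) →
                   (∃ λ z → z ∈ Z × Overlap (adj true q₀) (adj true q₃) (adj true q₆) (adj true q₉) z) ⊎ red q₀ Z + red q₃ Z + red q₆ Z + red q₉ Z ≤ length Z → Shorter P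
        case-out h (inj₁ (z , z∈ , o)) = outside z∈ o
        case-out h (inj₂ h′) = ⊥-elim (shorten-arith m γ e N (red q₀ vertices) (red q₃ vertices) (red q₆ vertices) (red q₉ vertices)
          (# (adj true q₀ ∘ at₀) (windows a b d xs)) (# (adj true q₃ ∘ at₁) (windows a b d xs)) (# (adj true q₆ ∘ at₂) (windows a b d xs)) (# (adj true q₉ ∘ at₃) (windows a b d xs))
          (red q₀ Z) (red q₃ Z) (red q₆ Z) (red q₉ Z) (length xs) (length Z)
          (red-degree q₀) (red-degree q₃) (red-degree q₆) (red-degree q₉)
          (bound q₀ _ (count₀ (adj true q₀) a b d xs))
          (bound q₃ _ (+-mono-≤ (ι≤1 (adj true q₃ a)) (count₁ (adj true q₃) a b d xs)))
          (bound q₆ _ (+-mono-≤ (ι≤1 (adj true q₆ a)) (+-mono-≤ (ι≤1 (adj true q₆ b)) (count₂ (adj true q₆) a b d xs))))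
          (bound q₉ _ (+-mono-≤ (ι≤1 (adj true q₉ a)) (+-mono-≤ (ι≤1 (adj true q₉ b)) (+-mono-≤ (ι≤1 (adj true q₉ d)) (count₃ (adj true q₉) a b d xs)))))
          (≤-trans h (≤-reflexive (length-windows a b d xs))) h′ fits N≡ slack)
          where
          fits : (13 + length xs) + length Z ≤ N
          fits = ≤-trans (≤-reflexive (sym (length-++ L)))
            (≤-trans (length-⊆ (Unique-++⁺ un (Unique-∖ L (Unique-∖ I vertices-unique)) λ i j → proj₂ (∈-∖⁻ (vertices ∖ I) L j) i) λ {v} _ → ∈-vertices v)
              (≤-reflexive length-vertices))
        case-in : (∃ λ w → w ∈ windows a b d xs × Overlap (adj true q₀ ∘ at₀) (adj true q₃ ∘ at₁) (adj true q₆ ∘ at₂) (adj true q₉ ∘ at₃) w) ⊎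
                  # (adj true q₀ ∘ at₀) (windows a b d xs) + # (adj true q₃ ∘ at₁) (windows a b d xs) + # (adj true q₆ ∘ at₂) (windows a b d xs) + # (adj true q₉ ∘ at₃) (windows a b d xs) ≤ length (windows a b d xs) → Shorter P
        case-in (inj₁ (w , w∈ , o)) = inside w∈ o
        case-in (inj₂ h) = case-out h (four-sets (adj true q₀) (adj true q₃) (adj true q₆) (adj true q₉) Z)

    -- Closing up at exactly 2m vertices

    opaque
      close-sizes : (m l b s t h : ℕ) → l + b + s ≡ 2 * m + 1 → h ≡ 1 + (b + s) → h ≡ 2 + t →
          l + t ≤ 2 * m
      close-sizes m l b s t h h1 h2 h3 =
          linear 1 0 ((≤-reflexive h1) ⊕ (≤-reflexive h2) ⊕ (≤-reflexive (sym h3))) (solve (m ∷ l ∷ b ∷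
          s ∷ t ∷ h ∷ []))

      close-sizes′ : (m l b s t h : ℕ) → l + b + s ≡ 2 * m + 1 → h ≡ 1 + (b + s) → h ≡ 2 + t →
          2 * m ≤ l + t
      close-sizes′ m l b s t h h1 h2 h3 =
          linear 1 0 ((≤-reflexive (sym h1)) ⊕ (≤-reflexive (sym h2)) ⊕ (≤-reflexive h3)) (solve (m ∷ l
          ∷ b ∷ s ∷ t ∷ h ∷ []))

      fit-long : (m l b : ℕ) → 20 ≤ m → b ≤ 3 * 9 → 2 * m + 1 < l + b → 13 ≤ l
      fit-long m l b h1 h2 h3 = linear 1 2 (2 ⊗ h1 ⊕ h2 ⊕ h3) (solve (m ∷ l ∷ b ∷ []))

      fit-next : (m l l′ b k : ℕ) → 2 * m + 1 < l + b → l′ + k ≡ l → k ≤ 10 → 2 * m + 1 ≤ l′ + b + 9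
      fit-next m l l′ b k h1 h2 h3 =
          linear 1 0 (h1 ⊕ (≤-reflexive (sym h2)) ⊕ h3) (solve (m ∷ l ∷ l′ ∷ b ∷ k ∷ []))

      fit-fuel : (l l′ k f : ℕ) → l < 1 + f → l′ + k ≡ l → 1 ≤ k → l′ < f
      fit-fuel l l′ k f h1 h2 h3 =
          linear 1 0 (h1 ⊕ (≤-reflexive h2) ⊕ h3) (solve (l ∷ l′ ∷ k ∷ f ∷ []))

      fit-offset : (m l b s : ℕ) → 2 * m + 1 ≤ l + b + 9 → l + b + s ≡ 2 * m + 1 → s ≤ 9
      fit-offset m l b s h1 h2 = linear 1 0 (h1 ⊕ (≤-reflexive h2)) (solve (m ∷ l ∷ b ∷ s ∷ []))

      fit-start : (m l b : ℕ) → 2 * m ≤ l → 9 ≤ b → 2 * m + 1 ≤ l + b + 9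
      fit-start m l b h1 h2 = linear 1 (b + 8) h1 (solve (m ∷ l ∷ b ∷ []))

    impossible : ⊥
    impossible = assemble (build-gadget 9 ≤-refl)
      where
      assemble : Gadget some-vertex 9 → ⊥
      assemble (gadget {y} base w≤base base≤ {body} size x∈ y∈ gpath) =
        start-from (long-path x≢y xI yI)
        where
        x = some-vertex
        -- The long path ends in x and y, so of the gadget only the other vertices are forbidden to
        -- it.
        inner : Vertex → Bool
        inner v = v ∈ᵇ body ∧ not (v ∈ᵇ (x ∷ y ∷ []))
        I = filterᵇ inner vertices
        uI = Unique-filterᵇ inner vertices-unique
        I≤55 : length I ≤ 55
        I≤55 = ≤-trans (≤-reflexive (length-filterᵇ inner vertices)) (≤-trans (#-mono vertices λ {v} _ q → ∧-elimˡ {v ∈ᵇ body} q)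
          (≤-trans (#-∈ body vertices-unique) size))
        I-off : ∀ {v} → v ∈ I → v ∉ x ∷ y ∷ []
        I-off {v} i = ∈ᵇ-false (x ∷ y ∷ []) (not-true (∧-elimʳ {v ∈ᵇ body} (proj₂ (∈-filterᵇ⁻ inner vertices i))))
        xI : x ∉ I
        xI i = I-off i (here refl)
        yI : y ∉ I
        yI i = I-off i (there (here refl))
        repeats : ∀ {v z L} → Walk (E true) v z L → Unique L → 2 ≤ length L → v ≢ z
        repeats [ _ ]ʷ u (s≤s ()) q
        repeats (r ∷ʷ w) u h q = Unique-∷⁻ u (subst (_∈ _) (sym q) (end-∈ w))
        x≢y : x ≢ y
        x≢y = let (L , wL , uL , lL , _) = gpath 0 z≤n in
          repeats wL uL (≤-trans (s≤s (≤-trans (≤-trans (s≤s z≤n) w≤base) (m≤m+n base 0))) (≤-reflexive (sym lL)))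
        open LongPaths I uI I≤55
        open Shorten I I≤55

        -- The gadget path has base + s + 1 vertices and shares x and y with `P`, so the cycle has
        -- |P| + base + s - 1 of them.
        close : (P : Path x y) → ∀ s → s ≤ 9 → length (Path.verts P) + base + s ≡ 2 * m + 1 → ⊥
        close (path {L} wL uL avL) s s≤9 len = go (gpath s s≤9)
          where
          go : (∃ λ G → Walk (E true) x y G × Unique G × length G ≡ suc (base + s) × G ⊆ body) → ⊥
          go (_ , [ _ ]ʷ , _ , lG , _) = x≢y refl
          go (_ , (_∷ʷ_ {b = a} {xs = G₁} xa wG) , uG , lG , G⊆) = go₂ (unsnoc-walk wG big)
            where
            big : 2 ≤ length G₁
            big = ≤-trans (≤-trans (s≤s (s≤s z≤n)) w≤base) (≤-trans (m≤m+n base s) (≤-reflexive (sym (suc-injective lG))))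
            go₂ : (∃₂ λ b G₂ → G₁ ≡ G₂ ++ [ y ] × Walk (E true) a b G₂ × E true b y) → ⊥
            go₂ (b , G₂ , refl , w₂ , by) = no-red-cycle (ring {S = vertices}
                (join wL (adj-sym by) (reverseʷ adj-sym w₂)) (adj-sym xa)
                (Unique-++⁺ uL (Unique-↭ (↭-sym (↭-reverse G₂)) (proj₁ (Unique-++⁻ G₂ (proj₁ (proj₂ (Unique-++⁻ [ x ] uG))))))
                  λ i j → avL i (inI (∈-resp-↭ (↭-reverse G₂) j)))
                (≤-antisym (≤-trans (≤-reflexive lens) (close-sizes m (length L) base s (length G₂) _ len lG lG′))
                  (≤-trans (close-sizes′ m (length L) base s (length G₂) _ len lG lG′) (≤-reflexive (sym lens))))
                (λ {v} _ → ∈-vertices v))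
              where
              lens : length (L ++ reverse G₂) ≡ length L + length G₂
              lens = trans (length-++ L) (cong (length L +_) (length-reverse G₂))
              lG′ : length (x ∷ G₂ ++ [ y ]) ≡ 2 + length G₂
              lG′ = cong suc (trans (length-++ G₂) (+-comm (length G₂) 1))
              inI : ∀ {v} → v ∈ G₂ → v ∈ I
              inI {v} i = ∈-filterᵇ⁺ inner (∈-vertices v) (∧-intro (∈⇒∈ᵇ (G⊆ (there (∈-++⁺ˡ i))))
                (cong not (∉⇒∈ᵇ {zs = x ∷ y ∷ []} λ { (here q) → Unique-∷⁻ uG (subst (_∈ G₂ ++ [ y ]) q (∈-++⁺ˡ i))
                                  ; (there (here q)) → proj₂ (proj₂ (Unique-++⁻ G₂ (proj₁ (proj₂ (Unique-++⁻ [ x ] uG))))) i (here q) })))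

        -- The offset s covers ten consecutive values of |P| + base, and shortening changes |P| by
        -- at most ten, so this range cannot be jumped over.
        fit : ∀ fuel (P : Path x y) → length (Path.verts P) < fuel → 2 * m + 1 ≤ length (Path.verts P) + base + 9 → ⊥
        fit (suc fuel) P lt near with length (Path.verts P) + base ≤? 2 * m + 1
        ... | yes h = close P s (fit-offset m (length (Path.verts P)) base s near s≡) s≡
          where
          s = 2 * m + 1 ∸ (length (Path.verts P) + base)
          s≡ : length (Path.verts P) + base + s ≡ 2 * m + 1
          s≡ = m+[n∸m]≡n h
        -- With m ≥ 20 and base ≤ 27 a path that is still too long has the 13 vertices that
        -- `shorten` asks for.
        ... | no ¬h = again (shorten P (fit-long m (length (Path.verts P)) base 20≤m base≤ (≰⇒> ¬h)))
          where
          again : Shorter P → ⊥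
          again (shorter P′ k 1≤k k≤10 tot) = fit fuel P′
            (fit-fuel (length (Path.verts P)) (length (Path.verts P′)) k fuel lt tot 1≤k)
            (fit-next m (length (Path.verts P)) (length (Path.verts P′)) base k (≰⇒> ¬h) tot k≤10)

        start-from : LongPath x y → ⊥
        start-from (longPath {L} w u av long) = fit (suc (length L)) (path w u av) ≤-refl (fit-start m (length L) base long w≤base)

-- Decidability of the arrow relation

Searchable : Set → Set₁
Searchable A = (Q : A → Set) → (∀ a → Dec (Q a)) → Dec (∃ Q)

search-Bool : Searchable Bool
search-Bool Q Q? with Q? true | Q? false
... | yes q | _     = yes (true , q)
... | no _  | yes q = yes (false , q)
... | no ¬t | no ¬f = no λ { (true , q) → ¬t q ; (false , q) → ¬f q }

search-Vec : ∀ {A} → Searchable A → ∀ k → Searchable (Vec.Vec A k)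
search-Vec s zero    Q Q? with Q? Vec.[]
... | yes q = yes (Vec.[] , q)
... | no ¬q = no λ { (Vec.[] , q) → ¬q q }
search-Vec s (suc k) Q Q? with s (λ a → ∃ λ v → Q (a Vec.∷ v)) (λ a → search-Vec s k (λ v → Q (a Vec.∷ v)) (λ v → Q? (a Vec.∷ v)))
... | yes (a , v , q) = yes (a Vec.∷ v , q)
... | no ¬q = no λ { (a Vec.∷ v , q) → ¬q (a , v , q) }

-- Functions are searched through their tables, since extensionality is not available.
search-function : ∀ {A} → Searchable A → ∀ k (Q : (Fin k → A) → Set) → (∀ f → Dec (Q f)) →
                  (∀ {f g} → (∀ i → f i ≡ g i) → Q f → Q g) → Dec (∃ Q)
search-function s k Q Q? ext with search-Vec s k (Q ∘ Vec.lookup) (Q? ∘ Vec.lookup)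
... | yes (v , q) = yes (Vec.lookup v , q)
... | no ¬q = no λ { (f , q) → ¬q (Vec.tabulate f , ext (λ i → sym (Vecₚ.lookup∘tabulate f i)) q) }
  where import Data.Vec.Properties as Vecₚ

DecidableAdj : Graph → Set
DecidableAdj H = ∀ a b → Dec (Adj H a b)

cycle-decidable : ∀ ℓ → DecidableAdj (Cycle ℓ)
cycle-decidable ℓ i j = (suc (toℕ i) ≟ toℕ j) ⊎-dec ((suc (toℕ j) ≟ toℕ i) ⊎-dec
  (((toℕ i ≟ 0) ×-dec (suc (toℕ j) ≟ ℓ)) ⊎-dec ((toℕ j ≟ 0) ×-dec (suc (toℕ i) ≟ ℓ))))
  where
  open import Data.Nat using (_≟_)
  open import Relation.Nullary.Decidable using (_⊎-dec_; _×-dec_)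

wheel-decidable : ∀ k → DecidableAdj (Wheel k)
wheel-decidable k fzero    fzero    = no λ ()
wheel-decidable k fzero    (fsuc j) = yes fzero
wheel-decidable k (fsuc i) fzero    = yes fzero
wheel-decidable k (fsuc i) (fsuc j) = cycle-decidable k i j

copy-ext : ∀ {N} {c d : Colouring N} {col H} → (∀ u v → c u v ≡ d u v) → HasCopy c col H → HasCopy d col H
copy-ext e (f , inj , edges) = f , inj , λ a b h → trans (sym (e (f a) (f b))) (edges a b h)

copy? : ∀ {N} (c : Colouring N) col H → DecidableAdj H → Dec (HasCopy c col H)
copy? {N} c col H adj? = search-function (λ Q → Finₚ.any?) (V H) IsCopy isCopy? ext
  where
  open import Relation.Nullary.Decidable using (_×-dec_; _→-dec_; map′)
  IsCopy : (Fin (V H) → Fin N) → Set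
  IsCopy f = Injective _≡_ _≡_ f × ((a b : Fin (V H)) → Adj H a b → c (f a) (f b) ≡ col)
  isCopy? : ∀ f → Dec (IsCopy f)
  isCopy? f = map′ (λ h {x} {y} → h x y) (λ h x y → h {x} {y})
      (Finₚ.all? λ x → Finₚ.all? λ y → (f x Finₚ.≟ f y) →-dec (x Finₚ.≟ y))
    ×-dec (Finₚ.all? λ a → Finₚ.all? λ b → adj? a b →-dec (c (f a) (f b) Boolₚ.≟ col))
  ext : ∀ {f g} → (∀ i → f i ≡ g i) → IsCopy f → IsCopy g
  ext e (inj , edges) = (λ {x} {y} h → inj (trans (e x) (trans h (sym (e y))))) ,
    λ a b h → trans (cong₂ c (sym (e a)) (sym (e b))) (edges a b h)

-- The Ramsey number has to be exhibited as a least value, and `least` searches for it by deciding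
-- the arrow relation at each N.
arrows? : ∀ N H₁ H₂ → DecidableAdj H₁ → DecidableAdj H₂ → Dec (Arrows N H₁ H₂)
arrows? N H₁ H₂ d₁ d₂ = decide (search-function (search-Vec search-Bool N) N (Bad ∘ table) (bad? ∘ table) ext)
  where
  open import Relation.Nullary.Decidable using (_×-dec_; ¬?)
  import Data.Vec.Properties as Vecₚ
  table : (Fin N → Vec.Vec Bool N) → Colouring N
  table f u v = Vec.lookup (f u) v
  Bad : Colouring N → Set
  Bad c = Symmetric c × ¬ HasCopy c true H₁ × ¬ HasCopy c false H₂
  bad? : ∀ c → Dec (Bad c)
  bad? c = (Finₚ.all? λ u → Finₚ.all? λ v → c u v Boolₚ.≟ c v u) ×-dec (¬? (copy? c true H₁ d₁) ×-dec ¬? (copy? c false H₂ d₂))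
  transfer : ∀ {c d} → (∀ u v → c u v ≡ d u v) → Bad c → Bad d
  transfer e (s , n₁ , n₂) = (λ u v → trans (sym (e u v)) (trans (s u v) (e v u))) ,
    (λ h → n₁ (copy-ext {H = H₁} (λ u v → sym (e u v)) h)) , (λ h → n₂ (copy-ext {H = H₂} (λ u v → sym (e u v)) h))
  ext : ∀ {f g} → (∀ i → f i ≡ g i) → Bad (table f) → Bad (table g)
  ext e = transfer λ u v → cong (λ r → Vec.lookup r v) (e u)
  decide : Dec (∃ λ f → Bad (table f)) → Dec (Arrows N H₁ H₂)
  decide (yes (f , s , n₁ , n₂)) = no λ h → case-⊎ n₁ n₂ (h (table f) s)
  decide (no none) = yes arrows
    where
    arrows : Arrows N H₁ H₂
    arrows c s with copy? c true H₁ d₁ | copy? c false H₂ d₂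
    ... | yes p | _ = inj₁ p
    ... | no _  | yes q = inj₂ q
    ... | no ¬p | no ¬q = ⊥-elim (none ((λ u → Vec.tabulate (c u)) , transfer (λ u v → sym (Vecₚ.lookup∘tabulate (c u) v)) (s , ¬p , ¬q)))

least : ∀ {P : ℕ → Set} → (∀ k → Dec (P k)) → ∀ U → P U → ∃ λ R → P R × (∀ k → k < R → ¬ P k) × R ≤ U
least {P} P? U pU = go 0 U (λ k ()) refl
  where
  go : ∀ k f → (∀ j → j < k → ¬ P j) → k + f ≡ U → ∃ λ R → P R × (∀ k → k < R → ¬ P k) × R ≤ U
  go k f below e with P? k
  ... | yes p = k , p , below , ≤-trans (m≤m+n k f) (≤-reflexive e)
  go k zero below e | no ¬p = ⊥-elim (¬p (subst P (trans (sym e) (+-identityʳ k)) pU))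
  go k (suc f) below e | no ¬p = go (suc k) f extended (trans (sym (+-suc k f)) e)
    where
    extended : ∀ j → j < suc k → ¬ P j
    extended j (s≤s h) p with m≤n⇒m<n∨m≡n h
      where open import Data.Nat.Properties using (m≤n⇒m<n∨m≡n)
    ... | inj₁ lt   = below j lt p
    ... | inj₂ refl = ¬p p

-- The lower bound: two disjoint red cliques on 2m − 1 vertices

module TwoCliques (m n N : ℕ) (2≤m : 2 ≤ m) (2≤n : 2 ≤ n) (N< : N < 4 * m ∸ 1) where

  half : ℕ
  half = 2 * m ∸ 1

  half≡ : half + 1 ≡ 2 * m
  half≡ = m∸n+n≡m (≤-trans (≤-trans (s≤s z≤n) 2≤m) (m≤m+n m _))

  side : Fin N → Bool
  side u = does (toℕ u <? half)

  colouring : Colouring N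
  colouring u v = does (side u Boolₚ.≟ side v)

  symmetric : Symmetric colouring
  symmetric u v with side u | side v
  ... | true  | true  = refl
  ... | true  | false = refl
  ... | false | true  = refl
  ... | false | false = refl

  opaque
    half-lt : (m N h q : ℕ) → N < q → q + 1 ≡ 4 * m → h + 1 ≡ 2 * m → N ≤ h + h
    half-lt m N h q h1 h2 h3 =
        linear 1 0 (h1 ⊕ (≤-reflexive h2) ⊕ 2 ⊗ (≤-reflexive (sym h3))) (solve (m ∷ N ∷ h ∷ q ∷ []))

  N≤ : N ≤ half + half
  N≤ = half-lt m N half (4 * m ∸ 1) N< (m∸n+n≡m (≤-trans (≤-trans (s≤s z≤n) 2≤m) (m≤m+n m _))) half≡

  -- A red cycle never changes sides, and either side has at most 2m - 1 vertices, the second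
  -- because N ≤ 2(2m - 1).
  no-cycle : ¬ HasCopy colouring true (Cycle (2 * m))
  no-cycle (f , inj , edges) = by-side (side (f start)) refl
    where
    0<ℓ : 0 < 2 * m
    0<ℓ = ≤-trans (≤-trans (s≤s z≤n) 2≤m) (m≤m+n m _)
    start : Fin (2 * m)
    start = fromℕ< 0<ℓ
    connected : ∀ k (h : k < 2 * m) → side (f (fromℕ< h)) ≡ side (f start)
    connected zero h = cong (side ∘ f) (Finₚ.toℕ-injective (trans (Finₚ.toℕ-fromℕ< h) (sym (Finₚ.toℕ-fromℕ< 0<ℓ))))
    connected (suc k) h = trans (sym (does-yes (_ Boolₚ.≟ _) same)) (connected k (<⇒≤ h))
      where
      same = edges (fromℕ< (<⇒≤ h)) (fromℕ< h) (inj₁ (trans (cong suc (Finₚ.toℕ-fromℕ< (<⇒≤ h))) (sym (Finₚ.toℕ-fromℕ< h))))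
    all-same : ∀ i → side (f i) ≡ side (f start)
    all-same i = trans (cong (side ∘ f) (sym (Finₚ.fromℕ<-toℕ i (Finₚ.toℕ<n i)))) (connected (toℕ i) (Finₚ.toℕ<n i))
    too-many : (g : Fin (2 * m) → Fin half) → (∀ {i j} → g i ≡ g j → i ≡ j) → ⊥
    too-many g g-inj = <-irrefl refl (≤-trans (≤-reflexive (+-comm 1 half)) (≤-trans (≤-reflexive half≡) (Finₚ.injective⇒≤ {f = g} g-inj)))
    by-side : ∀ b → side (f start) ≡ b → ⊥
    by-side true e = too-many (λ i → fromℕ< (small i)) λ {i} {j} q → inj (Finₚ.toℕ-injective (Finₚ.fromℕ<-injective _ _ (small i) (small j) q))
      where
      small : ∀ i → toℕ (f i) < half
      small i = does-yes (toℕ (f i) <? half) (trans (all-same i) e)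
    by-side false e = too-many (λ i → fromℕ< (small i)) λ {i} {j} q →
        inj (Finₚ.toℕ-injective (∸-cancelʳ-≡ (large i) (large j) (Finₚ.fromℕ<-injective _ _ (small i) (small j) q)))
      where
      open import Data.Nat.Properties using (∸-cancelʳ-≡)
      large : ∀ i → half ≤ toℕ (f i)
      large i = ≮⇒≥ (does-no (toℕ (f i) <? half) (trans (all-same i) e))
      shifted : ∀ {t d} → d + half ≡ t → t < N → d < half
      shifted {t} {d} q h = below d half t N q h N≤
        where
        below : ∀ d h t N → d + h ≡ t → t < N → N ≤ h + h → d < h
        below d h t N h₁ h₂ h₃ = linear 1 0 (≤-reflexive h₁ ⊕ h₂ ⊕ h₃) (solve (d ∷ h ∷ t ∷ N ∷ []))
      small : ∀ i → toℕ (f i) ∸ half < half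
      small i = shifted (m∸n+n≡m (large i)) (Finₚ.toℕ<n (f i))

  -- The hub and two consecutive rim vertices form a triangle, whereas colour 2 is bipartite.
  no-wheel : ¬ HasCopy colouring false (Wheel (2 * n))
  no-wheel (f , _ , edges) = triangle (side (f fzero)) (side (f r₀)) (side (f r₁))
      (edges fzero r₀ fzero) (edges fzero r₁ fzero)
      (edges r₀ r₁ (inj₁ (trans (cong suc (Finₚ.toℕ-fromℕ< 0<)) (sym (Finₚ.toℕ-fromℕ< 1<)))))
    where
    1< : 1 < 2 * n
    1< = ≤-trans 2≤n (m≤m+n n _)
    0< : 0 < 2 * n
    0< = <⇒≤ 1<
    r₀ r₁ : Fin (suc (2 * n))
    r₀ = fsuc (fromℕ< 0<)
    r₁ = fsuc (fromℕ< 1<)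
    triangle : ∀ a b d → does (a Boolₚ.≟ b) ≡ false → does (a Boolₚ.≟ d) ≡ false → does (b Boolₚ.≟ d) ≡ false → ⊥
    triangle true  true  _     () _ _
    triangle true  false true  _ () _
    triangle true  false false _ _ ()
    triangle false true  true  _ _ ()
    triangle false true  false _ () _
    triangle false false _     () _ _

  fails : ¬ Arrows N (Cycle (2 * m)) (Wheel (2 * n))
  fails h = case-⊎ no-cycle no-wheel (h colouring symmetric)

-- The upper bound and the Ramsey number

arrows-upper : ∀ {m n γ e N} → m ≡ γ + n → 2 ≤ n → suc N ≡ 4 * m + e → 999 ≤ 3 * e + 4 * γ → Arrows N (Cycle (2 * m)) (Wheel (2 * n))
arrows-upper {m} {n} {γ} {e} m≡ 2≤n N≡ slack c c-sym
  with copy? c true (Cycle (2 * m)) (cycle-decidable (2 * m)) | copy? c false (Wheel (2 * n)) (wheel-decidable (2 * n))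
... | yes p | _ = inj₁ p
... | no _  | yes q = inj₂ q
... | no ¬p | no ¬q = ⊥-elim (Coloured.Contradiction.impossible c c-sym {m} {n} {γ} {e} m≡ 2≤n N≡ slack (λ R → ¬p (Coloured.ring⇒cycle c c-sym R)) ¬q)

opaque
  final-slack : (q γ e : ℕ) → 333 ≤ e + q → 3 * q ≤ 4 * γ → 999 ≤ 3 * e + 4 * γ
  final-slack q γ e h1 h2 = linear 1 0 (3 ⊗ h1 ⊕ h2) (solve (q ∷ γ ∷ e ∷ []))

  excess-arith : (U m q e : ℕ) → 4 * m + 332 ≤ U + q → 1 + U ≡ 4 * m + e → 333 ≤ e + q
  excess-arith U m q e h1 h2 = linear 1 0 (h1 ⊕ (≤-reflexive h2)) (solve (U ∷ m ∷ q ∷ e ∷ []))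

theorem1p5 : (m n : ℕ) → 2 ≤ n → n ≤ m →
    Σ ℕ λ R → IsRamseyNumber (Cycle (2 * m)) (Wheel (2 * n)) R ×
    ((4 * m ∸ 1 ≤ R) × (R ≤ ((4 * m + 332) ∸ ((333 * (m ∸ n)) / 251)) ⊔ (4 * m ∸ 1)))
theorem1p5 m n 2≤n n≤m =
  let (R , arrows , minimal , R≤U) = least (λ k → arrows? k (Cycle (2 * m)) (Wheel (2 * n)) (cycle-decidable (2 * m)) (wheel-decidable (2 * n))) U upper
  in R , (arrows , minimal) , ≮⇒≥ (λ h → TwoCliques.fails m n R (≤-trans 2≤n n≤m) 2≤n h arrows) , R≤U
  where
  open import Data.Nat.Properties using (m≤m⊔n; m≤n⊔m; m≤n+m∸n; *-cancelˡ-≤; *-monoˡ-≤)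
  open import Data.Nat.DivMod using (m/n*n≤m)
  γ = m ∸ n
  q = (333 * γ) / 251
  U = ((4 * m + 332) ∸ q) ⊔ (4 * m ∸ 1)
  4m≤ : 4 * m ≤ suc U
  4m≤ = ≤-trans (m≤n+m∸n (4 * m) 1) (s≤s (m≤n⊔m ((4 * m + 332) ∸ q) (4 * m ∸ 1)))
  -- The second term of the maximum ensures 4m ≤ U + 1, so nothing is truncated; the first will give
  -- e + q ≥ 333.
  e = suc U ∸ 4 * m
  U≡ : suc U ≡ 4 * m + e
  U≡ = sym (m+[n∸m]≡n 4m≤)
  -- From q ≤ 333γ / 251, because 3 · 333 = 999 ≤ 1004 = 4 · 251.
  3q≤4γ : 3 * q ≤ 4 * γ
  3q≤4γ = *-cancelˡ-≤ 251 (ratio q γ (m/n*n≤m (333 * γ) 251))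
    where
    ratio : ∀ q γ → q * 251 ≤ 333 * γ → 251 * (3 * q) ≤ 251 * (4 * γ)
    ratio q γ h = linear 1 (5 * γ) (3 ⊗ h) (solve (q ∷ γ ∷ []))
  upper : Arrows U (Cycle (2 * m)) (Wheel (2 * n))
  upper = arrows-upper {γ = γ} {e} (sym (m∸n+n≡m n≤m)) 2≤n U≡
    (final-slack q γ e (excess-arith U m q e (≤-trans (m≤n+m∸n (4 * m + 332) q)
      (≤-trans (+-monoʳ-≤ q (m≤m⊔n ((4 * m + 332) ∸ q) (4 * m ∸ 1))) (≤-reflexive (+-comm q U)))) U≡) 3q≤4γ)
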